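{- Let $\mathcal{C}$ be the class of simple connected graphs of minimum degree at least $4$. A graph $G$ is a minimal critical graph in $\mathcal{C}$ if and only if either $G$ is the square of a cycle of length at least $5$, or $G$ arises from a nonempty connected multihypergraph $H$ of minimum degree at least $2$ in which every hyperedge $e$ satisfies $|V(e)| \in \{1,2,3\}$, by replacing each hyperedge $e$ by a brick $B_e$ such that the vertices of attachment of $B_e$ are exactly the vertices in $V(e)$, and these vertices of attachment are at the same time the only objects (vertices or edges) of $B_e$ contained in more than one brick, and such that the following condition (TB) holds: (TB) $B_e$ is triangular (i.e. isomorphic to $K_3$) only if every vertex $x$ of $e$ is incident with precisely one hyperedge $f_x \neq e$, where $B_{f_x}$ is isomorphic to none of $K_5^-, K_{2,2,2}^-, K_5, K_{2,2,2}$, and for distinct vertices $x \ne y$ of $V(e)$ we have $V(f_x) \cap V(f_y) \neq \emptyset$ only if not both of $B_{f_x}, B_{f_y}$ are triangular, and $f_x = f_y$ only if $B_{f_x}$ is isomorphic to $K_5^{\triangleright\triangleleft}$ or $K_{2,2,2}^{\triangleright\triangleleft}$.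
   Context: For $G \in \mathcal{C}$, an edge $e$ is called essential if $G-e \notin \mathcal{C}$, and critical if the graph $G/e$ obtained by contracting $e$ to a single vertex and then deleting loops and multiple edges (simplifying) is not in $\mathcal{C}$. A graph $G \in \mathcal{C}$ is minimal critical if every edge of $G$ is both essential and critical. The square of a cycle $C$ has vertex set $V(C)$, two vertices being adjacent if their distance on $C$ is $1$ or $2$. Bricks: $K_{2,2,2}$ is the octahedron. For $Q \in \{K_5, K_{2,2,2}\}$: $Q^-$ is obtained from $Q$ by deleting one edge; $Q^{\triangledown}$ is obtained by deleting the three edges of a triangle; $Q^{\triangleright\triangleleft}$ is obtained by choosing a vertex $w$ and two independent edges $e',f'$ with both endpoints in $N_Q(w)$, deleting $w$, adding two new vertices $y,z$, and adding two edges from $y$ to the endpoints of $e'$ and two edges from $z$ to the endpoints of $f'$ (by symmetry of $K_5$ and $K_{2,2,2}$ these are well defined up to isomorphism). A brick is a graph isomorphic to one of $K_5, K_{2,2,2}, K_5^-, K_{2,2,2}^-, K_5^{\triangledown}, K_{2,2,2}^{\triangledown}, K_5^{\triangleright\triangleleft}, K_{2,2,2}^{\triangleright\triangleleft}, K_3$. Its vertices of attachment are: for $K_5$ and $K_{2,2,2}$ one arbitrary chosen vertex; for the other seven bricks, its vertices of degree less than $4$ (in the brick). A brick is triangular if it is isomorphic to $K_3$. In the multihypergraph $H$, each hyperedge $e$ has a vertex set $V(e)$, and the degree of a vertex is the number of hyperedges containing it. -}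

module Defs where

open import Level using (Level; 0ℓ) renaming (suc to lsuc)
open import Data.Nat using (ℕ; zero; suc; _+_; _<_; _≡ᵇ_; ⌊_/2⌋; _%_)
open import Data.Bool using (Bool; true; false; T; _∧_; _∨_; not; if_then_else_)
open import Data.Fin using (Fin; toℕ)
open import Data.List using (List; map; allFin)
open import Data.Nat.ListAction using (sum)
open import Data.Product using (Σ; ∃; ∃-syntax; _×_; _,_; proj₁; proj₂)
open import Data.Sum using (_⊎_)
open import Relation.Nullary using (¬_)
open import Relation.Binary.PropositionalEquality using (_≡_; _≢_)
open import Function.Bundles using (_↔_; _⇔_; Inverse)

-- Graphs.  A graph is a vertex type with an adjacency relation.
-- "Undirected" is imposed as a hypothesis (symmetry); simplicity
-- (no loops; multiple edges are impossible for a relation) is part of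
-- the class C below.

record Graph : Set₁ where
  field
    V   : Set
    Adj : V → V → Set
open Graph public

Finite : Set → Set
Finite A = Σ ℕ λ n → A ↔ Fin n

Symmetric : Graph → Set
Symmetric G = ∀ x y → Adj G x y → Adj G y x

Simple : Graph → Set
Simple G = Symmetric G × (∀ x → ¬ Adj G x x)

data Reach (G : Graph) : V G → V G → Set where
  here : ∀ {x} → Reach G x x
  step : ∀ {x y z} → Adj G x y → Reach G y z → Reach G x z

Connected : Graph → Set
Connected G = V G × (∀ x y → Reach G x y)

MinDeg≥4 : Graph → Set
MinDeg≥4 G = ∀ x → Σ (Fin 4 → V G) λ f →
  (∀ i j → f i ≡ f j → i ≡ j) × (∀ i → Adj G x (f i))

InC : Graph → Set
InC G = Simple G × Connected G × MinDeg≥4 G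

Edge : Graph → Set
Edge G = Σ (V G) λ u → Σ (V G) λ v → Adj G u v

deleteEdge : (G : Graph) → Edge G → Graph
deleteEdge G (u , v , _) = record
  { V = V G
  ; Adj = λ x y → Adj G x y × ¬ (x ≡ u × y ≡ v) × ¬ (x ≡ v × y ≡ u) }

-- G / e  (e = uv): v is merged into u, then loops and multiple edges
-- are removed.  Vertices of G/e are the vertices of G other than v;
-- a vertex x of G is represented by a (x itself, or u if x = v).
contractEdge : (G : Graph) → Edge G → Graph
contractEdge G (u , v , _) = record
  { V = Σ (V G) λ x → x ≢ v
  ; Adj = λ a b → proj₁ a ≢ proj₁ b ×
      (Σ (V G) λ x → Σ (V G) λ y → Adj G x y × Rep x a × Rep y b) }
  where
  Rep : V G → (Σ (V G) λ x → x ≢ v) → Set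
  Rep x a = (proj₁ a ≡ x) ⊎ (x ≡ v × proj₁ a ≡ u)

Essential : (G : Graph) → Edge G → Set
Essential G e = ¬ InC (deleteEdge G e)

Critical : (G : Graph) → Edge G → Set
Critical G e = ¬ InC (contractEdge G e)

MinimalCritical : Graph → Set
MinimalCritical G = InC G × (∀ e → Essential G e × Critical G e)

_≅_ : Graph → Graph → Set
G ≅ H = Σ (V G ↔ V H) λ φ →
  ∀ x y → Adj G x y ⇔ Adj H (Inverse.to φ x) (Inverse.to φ y)

CycleSq : ℕ → Graph
CycleSq m = record
  { V = Fin k
  ; Adj = λ i j →
      ((toℕ i + 1) % k ≡ toℕ j) ⊎ ((toℕ i + 2) % k ≡ toℕ j) ⊎
      ((toℕ j + 1) % k ≡ toℕ i) ⊎ ((toℕ j + 2) % k ≡ toℕ i) }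
  where
  k = 5 + m

SquareOfCycle : Graph → Set
SquareOfCycle G = Σ ℕ λ m → G ≅ CycleSq m   -- cycle length 5 + m ≥ 5

K5ℕ : ℕ → ℕ → Bool            -- vertices 0..4
K5ℕ i j = not (i ≡ᵇ j)

K222ℕ : ℕ → ℕ → Bool          -- vertices 0..5, non-edges {0,1},{2,3},{4,5}
K222ℕ i j = not (⌊ i /2⌋ ≡ᵇ ⌊ j /2⌋)

delEdge : ℕ → ℕ → (ℕ → ℕ → Bool) → ℕ → ℕ → Bool
delEdge a b Q i j = Q i j ∧ not (((i ≡ᵇ a) ∧ (j ≡ᵇ b)) ∨ ((i ≡ᵇ b) ∧ (j ≡ᵇ a)))

delTri : ℕ → ℕ → ℕ → (ℕ → ℕ → Bool) → ℕ → ℕ → Bool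
delTri a b c Q = delEdge a b (delEdge b c (delEdge a c Q))

-- Q has vertices 0..n-1.  Delete w, add y (reusing label w) and z
-- (label n); y is joined to a,b (edge e' = ab) and z to c,d (f' = cd).
dumbbell : ℕ → ℕ → ℕ → ℕ → ℕ → ℕ → (ℕ → ℕ → Bool) → ℕ → ℕ → Bool
dumbbell n w a b c d Q i j =
  (not (i ≡ᵇ w) ∧ not (i ≡ᵇ n) ∧ not (j ≡ᵇ w) ∧ not (j ≡ᵇ n) ∧ Q i j)
  ∨ ((i ≡ᵇ w) ∧ ((j ≡ᵇ a) ∨ (j ≡ᵇ b))) ∨ ((j ≡ᵇ w) ∧ ((i ≡ᵇ a) ∨ (i ≡ᵇ b)))
  ∨ ((i ≡ᵇ n) ∧ ((j ≡ᵇ c) ∨ (j ≡ᵇ d))) ∨ ((j ≡ᵇ n) ∧ ((i ≡ᵇ c) ∨ (i ≡ᵇ d)))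

data BrickType : Set where
  k5 k222 k5⁻ k222⁻ k5▽ k222▽ k5▷◁ k222▷◁ k3 : BrickType

size : BrickType → ℕ
size k5 = 5
size k222 = 6
size k5⁻ = 5
size k222⁻ = 6
size k5▽ = 5
size k222▽ = 6
size k5▷◁ = 6
size k222▷◁ = 7
size k3 = 3

brickℕ : BrickType → ℕ → ℕ → Bool
brickℕ k5 = K5ℕ
brickℕ k222 = K222ℕ
brickℕ k5⁻ = delEdge 0 2 K5ℕ
brickℕ k222⁻ = delEdge 0 2 K222ℕ
brickℕ k5▽ = delTri 0 2 4 K5ℕ
brickℕ k222▽ = delTri 0 2 4 K222ℕ
-- K5: w = 0, N(w) = {1,2,3,4}, e' = 12, f' = 34
brickℕ k5▷◁ = dumbbell 5 0 1 2 3 4 K5ℕ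
-- K222: w = 0, N(w) = {2,3,4,5}, e' = 24, f' = 35
brickℕ k222▷◁ = dumbbell 6 0 2 4 3 5 K222ℕ
brickℕ k3 i j = not (i ≡ᵇ j)

BAdj : (b : BrickType) → Fin (size b) → Fin (size b) → Set
BAdj b i j = T (brickℕ b (toℕ i) (toℕ j))

brick : BrickType → Graph
brick b = record { V = Fin (size b) ; Adj = BAdj b }

degree : (b : BrickType) → Fin (size b) → ℕ
degree b i = sum (map (λ j → if brickℕ b (toℕ i) (toℕ j) then 1 else 0) (allFin (size b)))

-- vertices of attachment: for K5, K222 one chosen vertex (vertex 0);
-- otherwise the vertices of degree < 4 in the brick
Attach : (b : BrickType) → Fin (size b) → Set
Attach k5 i = toℕ i ≡ 0
Attach k222 i = toℕ i ≡ 0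
Attach k5⁻ i = degree k5⁻ i < 4
Attach k222⁻ i = degree k222⁻ i < 4
Attach k5▽ i = degree k5▽ i < 4
Attach k222▽ i = degree k222▽ i < 4
Attach k5▷◁ i = degree k5▷◁ i < 4
Attach k222▷◁ i = degree k222▷◁ i < 4
Attach k3 i = degree k3 i < 4

record Hypergraph : Set₁ where
  field
    W   : Set
    m   : ℕ
    Inc : Fin m → W → Bool
open Hypergraph public

_∈ₕ_ : {H : Hypergraph} → W H → Fin (m H) → Set
_∈ₕ_ {H} x e = T (Inc H e x)

data HReach (H : Hypergraph) : W H → W H → Set where
  here : ∀ {x} → HReach H x x
  step : ∀ {x y z} (e : Fin (m H)) → _∈ₕ_ {H} x e → _∈ₕ_ {H} y e →
         HReach H y z → HReach H x z

GoodHypergraph : Hypergraph → Set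
GoodHypergraph H =
  Finite (W H) × W H × (∀ x y → HReach H x y) ×
  (∀ x → Σ (Fin (m H)) λ e → Σ (Fin (m H)) λ f →
      e ≢ f × _∈ₕ_ {H} x e × _∈ₕ_ {H} x f) ×
  (∀ e → Σ ℕ λ k → (k ≡ 1 ⊎ k ≡ 2 ⊎ k ≡ 3) ×
      ((Σ (W H) λ x → _∈ₕ_ {H} x e) ↔ Fin k))

-- G arises from H by replacing each hyperedge e by a brick B_e
-- (of type ty e, embedded into G by φ e), vertices of H being
-- embedded by ι.
record BrickReplacement (G : Graph) (H : Hypergraph) : Set where
  field
    ι    : W H → V G
    ι-inj : ∀ x y → ι x ≡ ι y → x ≡ y
    ty   : Fin (m H) → BrickType
    φ    : (e : Fin (m H)) → Fin (size (ty e)) → V G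
    φ-inj : ∀ e i j → φ e i ≡ φ e j → i ≡ j
    φ-hom : ∀ e i j → BAdj (ty e) i j → Adj G (φ e i) (φ e j)
    attach⊆ : ∀ e i → Attach (ty e) i →
                Σ (W H) λ x → _∈ₕ_ {H} x e × ι x ≡ φ e i
    attach⊇ : ∀ e x → _∈ₕ_ {H} x e →
                Σ (Fin (size (ty e))) λ i → Attach (ty e) i × φ e i ≡ ι x
    covV : ∀ v → Σ (Fin (m H)) λ e → Σ (Fin (size (ty e))) λ i → φ e i ≡ v
    covE : ∀ x y → Adj G x y → Σ (Fin (m H)) λ e →
             Σ (Fin (size (ty e))) λ i → Σ (Fin (size (ty e))) λ j →
             BAdj (ty e) i j × φ e i ≡ x × φ e j ≡ y
    shareV : ∀ e f → e ≢ f → ∀ i j → φ e i ≡ φ f j →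
               Attach (ty e) i × Attach (ty f) j
    shareE : ∀ e f i j k l → BAdj (ty e) i j → BAdj (ty f) k l →
               ((φ e i ≡ φ f k × φ e j ≡ φ f l) ⊎ (φ e i ≡ φ f l × φ e j ≡ φ f k)) →
               e ≡ f

module _ {G : Graph} {H : Hypergraph} (R : BrickReplacement G H) where
  open BrickReplacement R

  B : Fin (m H) → Graph
  B e = brick (ty e)

  Triangular : Fin (m H) → Set
  Triangular e = B e ≅ brick k3

  OnlyOther : Fin (m H) → W H → Fin (m H) → Set
  OnlyOther e x f = f ≢ e × _∈ₕ_ {H} x f ×
    (∀ g → _∈ₕ_ {H} x g → g ≡ e ⊎ g ≡ f)

  TB : Set
  TB = ∀ e → Triangular e →
    (∀ x → _∈ₕ_ {H} x e → Σ (Fin (m H)) λ f → OnlyOther e x f ×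
        ¬ (B f ≅ brick k5⁻) × ¬ (B f ≅ brick k222⁻) ×
        ¬ (B f ≅ brick k5) × ¬ (B f ≅ brick k222)) ×
    (∀ x y fx fy → _∈ₕ_ {H} x e → _∈ₕ_ {H} y e → x ≢ y →
        OnlyOther e x fx → OnlyOther e y fy →
        ((Σ (W H) λ z → _∈ₕ_ {H} z fx × _∈ₕ_ {H} z fy) →
            ¬ (Triangular fx × Triangular fy)) ×
        (fx ≡ fy → (B fx ≅ brick k5▷◁) ⊎ (B fx ≅ brick k222▷◁)))

FromBricks : Graph → Set₁
FromBricks G = Σ Hypergraph λ H → GoodHypergraph H ×
  Σ (BrickReplacement G H) λ R → TB R

{-# OPTIONS --safe #-}
module Submission where

-- A graph in the class is minimal critical iff (E1) every edge has an end of degree 4 and (E2) every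
-- edge uv has a common neighbour of degree 4, or u and v are twins of degree 4 (N[u] = N[v]).
--
-- From bricks to criticality: non-attachment vertices have degree 4 inside their brick, so (E1) and (E2)
-- are finite checks on the bricks, except for K₃, where (TB) forces all three vertices to have degree 4.
--
-- From criticality to bricks: call two edges equivalent if they are linked by a chain of triangles; the
-- bricks are the equivalence classes. By (E2) the link G[N(v)] of a vertex v of degree 4 has no isolated
-- vertex, which leaves seven shapes. K₄, K₄⁻, claw, paw and C₄ determine the class of v outright; for 2K₂
-- the class is a triangle unless a neighbour has another shape; for P₄ either the class is determined, or
-- the third vertex of the path has link P₄ as well, and walking on in this way traces the square of a
-- cycle, or runs into a determined class. Since triangle-closed edge sets sharing an edge coincide, the bricks partition
-- the edges, and any failure of (TB) would create a triangle meeting two classes.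

open import Defs
open import Data.Bool using (Bool; T; _∧_; _∨_; false; true)
open import Data.Bool.Properties using (T-irrelevant; T?)
open import Data.Empty using (⊥; ⊥-elim)
open import Data.Fin using (Fin; _↑ʳ_; _↑ˡ_; fromℕ<; inject≤; punchIn; punchOut; splitAt; suc; toℕ; zero)
open import Data.Fin.Patterns using (0F; 1F; 2F; 3F; 4F; 5F; 6F)
open import Data.Fin.Permutation using (↔⇒≡)
open import Data.Fin.Properties using (0≢1+n; <-cmp; all?; any?; injective⇒≤; inject≤-injective; punchIn-injective; punchIn-punchOut; punchInᵢ≢i; splitAt-↑ʳ; splitAt-↑ˡ; suc-injective; toℕ-fromℕ<; toℕ-injective; toℕ<n)
open import Data.List using (List; []; _∷_; allFin; cartesianProduct; filter; length; lookup; map)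
open import Data.List.Membership.Propositional using (_∈_)
open import Data.List.Membership.Propositional.Properties using (∈-allFin; ∈-cartesianProduct⁺; ∈-filter⁺; ∈-filter⁻; ∈-lookup; ∈-map⁺)
open import Data.List.Relation.Unary.All using (All; []; _∷_)
open import Data.List.Relation.Unary.AllPairs using (AllPairs; []; _∷_)
open import Data.List.Relation.Unary.Any using (Any; here; index; there)
open import Data.List.Relation.Unary.Any.Properties using (lookup-index)
open import Data.List.Relation.Unary.Unique.Propositional using (Unique)
open import Data.Nat using (_%_; _+_; _<?_; _<_; _∸_; _≤?_; _≤_; suc; s≤s; zero; z≤n; ℕ)
open import Data.Nat.DivMod using (%-distribˡ-+; [m+n]%n≡m%n; m%n%n≡m%n; m%n<n; m<n⇒m%n≡m)
open import Data.Nat.Properties using (+-assoc; +-comm; +-identityʳ; 1+n≢n; 1+n≰n; <-irrefl; <⇒≤; m+[n∸m]≡n; m≤n+m; m≤n⇒m<n∨m≡n; m≤n⇒m≤1+n; m≤n⇒∃[o]m+o≡n; n<1+n; ≤-pred; ≤-refl; ≤-reflexive; ≤-trans; ≤⇒≯; ≮⇒≥)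
open import Data.Product using (_,_; _×_; proj₁; proj₂; Σ; ∃)
open import Data.Product.Properties using (≡-dec)
open import Data.Sum using ([_,_]′; _⊎_; inj₁; inj₂; swap) renaming (map to map⊎)
open import Data.Vec using (Vec; []; _∷_)
open import Function.Base using (_∘_)
open import Function.Bundles using (Equivalence; Inverse; _↔_; _⇔_; mk↔ₛ′; mk⇔)
open import Function.Construct.Identity using (↔-id)
open import Relation.Binary.Definitions using (DecidableEquality; tri<; tri>; tri≈)
open import Relation.Binary.PropositionalEquality using (_≡_; _≢_; cong; module ≡-Reasoning; refl; subst; subst₂; sym; trans)
open import Relation.Nullary using (Dec; _×-dec_; _⊎-dec_; no; yes; ¬?; ¬_)
open import Relation.Nullary.Decidable using (False; _→-dec_; decidable-stable; from-yes; fromWitness; isYes; map′; toWitness; toWitnessFalse)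
open import Relation.Unary using (Decidable)
import Data.Bool.Properties as Bool
import Data.Fin as Fin
import Data.List.Membership.DecPropositional as DecMembership
import Data.List.Relation.Unary.All as All
import Data.List.Relation.Unary.Any as Any
import Data.List.Relation.Unary.Unique.Propositional.Properties as Unique
import Data.Nat as ℕ
import Data.Vec as Vec
import Data.Vec.Properties as VecP

-- (E1) is derived from (E2): if both ends of an edge have degree at least 5, (E2) supplies a common
-- neighbour, the detour through it keeps the graph connected after deletion, and the edge would not
-- be essential. Hence contractions are analysed before deletions.
--
-- The engine of the classification is (E2) at the fourth edge of a degree 4 vertex whose other
-- three neighbours are known. Vertices all of whose neighbours are known cannot be adjacent to the
-- new end; a single remaining candidate must therefore be adjacent to it and have degree 4. This
-- both bounds degrees and locates new vertices of a brick.
--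
-- Squares of cycles do not come from P₄ alone: K₅ and the octahedron, when they have no vertex of
-- degree at least 5, are the squares of the cycles of length 5 and 6 and exhaust the graph. So
-- every local step concludes with a disjunction whose first alternative is global, and finiteness
-- moves it outside at the end.
--
-- Adjacency is an arbitrary relation. The decidability that the case distinctions consume is itself
-- extracted from the essentiality of all edges.

record AtLeast {A : Set} (k : ℕ) (P : A → Set) : Set where
  constructor atLeast
  field
    pick      : Fin k → A
    pick-inj  : ∀ i j → pick i ≡ pick j → i ≡ j
    pick-holds : ∀ i → P (pick i)
open AtLeast public

-- Degree bounds are data on both sides, because a degree cannot be computed from an undecided
-- adjacency relation. The covering family may repeat elements and may contain elements outside `P`.
record AtMost {A : Set} (k : ℕ) (P : A → Set) : Set where
  constructor atMost
  field
    cover     : Fin k → A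
    cover-all : ∀ z → P z → ∃ λ i → z ≡ cover i

module _ {A : Set} where

  AtLeast-map : ∀ {k} {P Q : A → Set} → (∀ z → P z → Q z) → AtLeast k P → AtLeast k Q
  AtLeast-map h (atLeast f inj p) = atLeast f inj λ i → h (f i) (p i)

  AtMost-map : ∀ {k} {P Q : A → Set} → (∀ z → Q z → P z) → AtMost k P → AtMost k Q
  AtMost-map h (atMost g c) = atMost g λ z q → c z (h z q)

  AtLeast-image : ∀ {k} {B : Set} {P : A → Set} {Q : B → Set} (φ : B → A) →
    (∀ x y → φ x ≡ φ y → x ≡ y) → (∀ z → Q z → P (φ z)) → AtLeast k Q → AtLeast k P
  AtLeast-image φ φ-inj h (atLeast f inj q) =
    atLeast (λ i → φ (f i)) (λ i j eq → inj i j (φ-inj _ _ eq)) λ i → h (f i) (q i)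

  AtMost-image : ∀ {k} {B : Set} {P : A → Set} {Q : B → Set} (φ : B → A) →
    (∀ z → P z → ∃ λ y → Q y × z ≡ φ y) → AtMost k Q → AtMost k P
  AtMost-image φ h (atMost g c) = atMost (λ i → φ (g i)) λ z p →
    let y , q , z≡ = h z p
        i , y≡ = c y q
    in i , trans z≡ (cong φ y≡)

  AtLeast-≤ : ∀ {k l} {P : A → Set} → l ≤ k → AtLeast k P → AtLeast l P
  AtLeast-≤ l≤k (atLeast f inj p) =
    atLeast (λ i → f (inject≤ i l≤k))
      (λ i j eq → inject≤-injective l≤k l≤k i j (inj _ _ eq)) λ i → p _

  AtLeast⇒≤ : ∀ {k l} {P : A → Set} → AtLeast k P → AtMost l P → k ≤ l
  AtLeast⇒≤ {k} {l} (atLeast f inj p) (atMost g c) = injective⇒≤ h-inj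
    where
    h : Fin k → Fin l
    h i = proj₁ (c (f i) (p i))
    h-eq : ∀ i → f i ≡ g (h i)
    h-eq i = proj₂ (c (f i) (p i))
    h-inj : ∀ {i j} → h i ≡ h j → i ≡ j
    h-inj {i} {j} eq = inj i j (trans (h-eq i) (trans (cong g eq) (sym (h-eq j))))

  AtLeast-add : ∀ {k} {P : A → Set} z → P z → AtLeast k (λ w → P w × w ≢ z) → AtLeast (suc k) P
  AtLeast-add {k} {P} z pz (atLeast f inj p) = atLeast f⁺ inj⁺ p⁺
    where
    f⁺ : Fin (suc k) → A
    f⁺ zero = z
    f⁺ (suc i) = f i
    inj⁺ : ∀ i j → f⁺ i ≡ f⁺ j → i ≡ j
    inj⁺ zero zero _ = refl
    inj⁺ zero (suc j) eq = ⊥-elim (proj₂ (p j) (sym eq))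
    inj⁺ (suc i) zero eq = ⊥-elim (proj₂ (p i) eq)
    inj⁺ (suc i) (suc j) eq = cong suc (inj i j eq)
    p⁺ : ∀ i → P (f⁺ i)
    p⁺ zero = pz
    p⁺ (suc i) = proj₁ (p i)

  AtLeast-⊎ : ∀ {k l} {P Q R : A → Set} → (∀ z → P z → R z) → (∀ z → Q z → R z) →
    (∀ z → P z → ¬ Q z) → AtLeast k P → AtLeast l Q → AtLeast (k + l) R
  AtLeast-⊎ {zero} P⊆R Q⊆R dis _ q = AtLeast-map Q⊆R q
  AtLeast-⊎ {suc k} {P = P} P⊆R Q⊆R dis (atLeast f inj p) q =
    AtLeast-add (f zero) (P⊆R _ (p zero)) (AtLeast-⊎ {k} {P = λ z → P z × z ≢ f zero}
      (λ z (pz , z≢) → P⊆R z pz , z≢) (λ z qz → Q⊆R z qz , λ { refl → dis z (p zero) qz })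
      (λ z (pz , _) → dis z pz)
      (atLeast (λ i → f (suc i)) (λ i j eq → suc-injective (inj _ _ eq))
        λ i → p (suc i) , λ eq → 0≢1+n (inj zero (suc i) (sym eq))) q)

  AtMost-⊎ : ∀ {k l} {P Q R : A → Set} → (∀ z → R z → P z ⊎ Q z) →
    AtMost k P → AtMost l Q → AtMost (k + l) R
  AtMost-⊎ {k} {l} {R = R} split (atMost f c) (atMost g d) =
    atMost (λ i → [ f , g ]′ (splitAt k i)) c⁺
    where
    c⁺ : ∀ z → R z → ∃ λ i → z ≡ [ f , g ]′ (splitAt k i)
    c⁺ z r with split z r
    ... | inj₁ p = let i , eq = c z p in i ↑ˡ l , trans eq (cong [ f , g ]′ (sym (splitAt-↑ˡ k i l)))
    ... | inj₂ q = let j , eq = d z q in k ↑ʳ j , trans eq (cong [ f , g ]′ (sym (splitAt-↑ʳ k l j)))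

  AtMost-remove : ∀ {k} {P : A → Set} z → P z → AtMost (suc k) P → AtMost k (λ w → P w × w ≢ z)
  AtMost-remove {k} {P} z pz (atMost g c) = atMost (λ j → g (punchIn i j)) c⁻
    where
    i = proj₁ (c z pz)
    c⁻ : ∀ w → P w × w ≢ z → ∃ λ j → w ≡ g (punchIn i j)
    c⁻ w (pw , w≢z) with c w pw
    ... | j , w≡ = punchOut i≢j , trans w≡ (cong g (sym (punchIn-punchOut i≢j)))
      where
      i≢j : i ≢ j
      i≢j eq = w≢z (trans w≡ (trans (cong g (sym eq)) (sym (proj₂ (c z pz)))))

  module _ (_≟_ : DecidableEquality A) where

    opaque
      AtLeast-remove : ∀ {k} {P : A → Set} z → AtLeast (suc k) P → AtLeast k (λ w → P w × w ≢ z)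
      AtLeast-remove z (atLeast f inj p) with any? (λ i → f i ≟ z)
      ... | yes (i , fi≡z) =
        atLeast (λ j → f (punchIn i j))
        (λ j l eq → punchIn-injective i j l (inj _ _ eq))
        λ j → p _ , λ eq → punchInᵢ≢i i j (inj _ _ (trans eq (sym fi≡z)))
      ... | no ¬z =
        atLeast (λ j → f (suc j)) (λ j l eq → suc-injective (inj _ _ eq)) λ j → p _ , λ eq → ¬z (suc j , eq)

    opaque
      -- An element missed by `k` distinct ones would give `k + 1`, against the upper bound. Applied
      -- to four known neighbours of a vertex of degree 4.
      covers : ∀ {k} {P : A → Set} → AtMost k P → (l : AtLeast k P) →
               ∀ z → P z → ∃ λ i → z ≡ pick l i
      covers {k} most (atLeast f inj p) z pz with any? (λ i → z ≟ f i)
      ... | yes r = r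
      ... | no ¬r = ⊥-elim (1+n≰n (AtLeast⇒≤
        (AtLeast-add z pz (atLeast f inj λ i → p i , λ eq → ¬r (i , sym eq))) most))

    opaque
      -- Pigeonhole. It produces the edge by which an attachment vertex leaves its brick.
      escape : ∀ {k l} {P Q : A → Set} → Decidable Q → AtLeast k P → AtMost l Q → l < k →
               ∃ λ z → P z × ¬ Q z
      escape Q? (atLeast f inj p) most l<k with any? (λ i → ¬? (Q? (f i)))
      ... | yes (i , ¬q) = f i , p i , ¬q
      ... | no none = ⊥-elim (1+n≰n (≤-trans l<k (AtLeast⇒≤
        (atLeast f inj λ i → decidable-stable (Q? (f i)) λ ¬q → none (i , ¬q)) most)))

-- Enumeration and search over finite types.

lookup-injective : {A : Set} {xs : List A} → Unique xs → ∀ i j → lookup xs i ≡ lookup xs j → i ≡ j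
lookup-injective (_ ∷ _) zero zero _ = refl
lookup-injective (x∉ ∷ _) zero (suc j) eq = ⊥-elim (All.lookup x∉ (∈-lookup j) eq)
lookup-injective (x∉ ∷ _) (suc i) zero eq = ⊥-elim (All.lookup x∉ (∈-lookup i) (sym eq))
lookup-injective (_ ∷ u) (suc i) (suc j) eq = cong suc (lookup-injective u i j eq)

module _ {n : ℕ} {P : Fin n → Set} (P? : Decidable P) where

  members : List (Fin n)
  members = filter P? (allFin n)

  member-holds : ∀ i → P (lookup members i)
  member-holds i = proj₂ (∈-filter⁻ P? {xs = allFin n} (∈-lookup i))

  members-injective : ∀ i j → lookup members i ≡ lookup members j → i ≡ j
  members-injective = lookup-injective (Unique.filter⁺ P? (Unique.allFin⁺ n))

  member-index : ∀ x → P x → Σ (Fin (length members)) λ i → x ≡ lookup members i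
  member-index x px = index x∈ , lookup-index x∈
    where
    x∈ : x ∈ members
    x∈ = ∈-filter⁺ P? (∈-allFin x) px

  members-AtLeast : AtLeast (length members) P
  members-AtLeast = atLeast (lookup members) members-injective member-holds

  members-AtMost : AtMost (length members) P
  members-AtMost = atMost (lookup members) member-index

module _ {A B : Set} (φ : A ↔ B) where
  open Inverse φ

  to-injective : ∀ x y → to x ≡ to y → x ≡ y
  to-injective x y eq = trans (sym (strictlyInverseʳ x)) (trans (cong from eq) (strictlyInverseʳ y))

  from-injective : ∀ x y → from x ≡ from y → x ≡ y
  from-injective x y eq = trans (sym (strictlyInverseˡ x)) (trans (cong to eq) (strictlyInverseˡ y))

module _ {A : Set} (fin : Finite A) where
  open Inverse (proj₂ fin)

  opaque
    finite-≟ : DecidableEquality A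
    finite-≟ x y = map′ (to-injective (proj₂ fin) x y) (cong to) (to x Fin.≟ to y)

  opaque
    search : {P : A → Set} → Decidable P → Dec (∃ P)
    search {P} P? = map′ (λ (i , p) → from i , p)
      (λ (x , p) → to x , subst P (sym (strictlyInverseʳ x)) p) (any? (λ i → P? (from i)))

  opaque
    universal : {P : A → Set} → Decidable P → Dec (∀ x → P x)
    universal {P} P? with search (λ x → ¬? (P? x))
    ... | yes (x , ¬p) = no λ all → ¬p (all x)
    ... | no none = yes λ x → decidable-stable (P? x) λ ¬p → none (x , ¬p)

distribute-Fin : ∀ n {Q : Set} {P : Fin n → Set} → (∀ i → Q ⊎ P i) → Q ⊎ (∀ i → P i)
distribute-Fin zero f = inj₂ λ ()
distribute-Fin (suc n) f with f zero | distribute-Fin n (λ i → f (suc i))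
... | inj₁ q | _ = inj₁ q
... | inj₂ _ | inj₁ q = inj₁ q
... | inj₂ p | inj₂ ps = inj₂ λ { zero → p ; (suc i) → ps i }

-- `Q` will be the global alternative that the graph is the square of a cycle, which may surface at
-- any single edge.
distribute : {A : Set} → Finite A → {Q : Set} {P : A → Set} → (∀ x → Q ⊎ P x) → Q ⊎ (∀ x → P x)
distribute (n , φ) {P = P} f with distribute-Fin n (λ i → f (Inverse.from φ i))
... | inj₁ q = inj₁ q
... | inj₂ ps = inj₂ λ x → subst P (Inverse.strictlyInverseʳ φ x) (ps (Inverse.to φ x))

-- Local form of minimal criticality

Deg≤4 Deg≥5 : (G : Graph) → V G → Set
Deg≤4 G x = AtMost 4 (Adj G x)
Deg≥5 G x = AtLeast 5 (Adj G x)

Twins : (G : Graph) → V G → V G → Set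
Twins G x y = Deg≤4 G x × Deg≤4 G y ×
  (∀ z → z ≢ x → Adj G y z → Adj G x z) × (∀ z → z ≢ y → Adj G x z → Adj G y z)

CommonDeg4 : (G : Graph) → V G → V G → Set
CommonDeg4 G x y = ∃ λ w → Deg≤4 G w × Adj G x w × Adj G y w

record LocallyCritical (G : Graph) : Set where
  field
    edge-end  : ∀ {x y} → Adj G x y → Deg≤4 G x ⊎ Deg≤4 G y
    edge-crit : ∀ {x y} → Adj G x y → CommonDeg4 G x y ⊎ Twins G x y

-- Uses that any two proofs of x ≢ v are definitionally equal (⊥ is a proof-irrelevant record).
Σ≢-≡ : {A : Set} {v : A} (a b : Σ A λ x → x ≢ v) → proj₁ a ≡ proj₁ b → a ≡ b
Σ≢-≡ (x , p) (.x , q) refl = refl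

at-least-4 : (G : Graph) → MinDeg≥4 G → ∀ x → AtLeast 4 (Adj G x)
at-least-4 G deg x = let f , inj , adj = deg x in atLeast f inj adj

min-degree-4 : (G : Graph) → (∀ x → AtLeast 4 (Adj G x)) → MinDeg≥4 G
min-degree-4 G deg x = pick (deg x) , pick-inj (deg x) , pick-holds (deg x)

contract-degree : (G : Graph) (e : Edge G) {P : V G → Set} (a : V (contractEdge G e)) →
  (∀ b → Adj (contractEdge G e) a b → P (proj₁ b)) → AtMost 3 P → ¬ InC (contractEdge G e)
contract-degree G e a h most (_ , _ , deg) = 1+n≰n (AtLeast⇒≤
  (AtLeast-image {Q = Adj (contractEdge G e) a} proj₁ Σ≢-≡ h (at-least-4 (contractEdge G e) deg a)) most)

-- Deleting an edge costs an end of degree 4 one neighbour. Contracting it merges two neighbours of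
-- a common neighbour of degree 4, leaving that vertex three; for twins the merged vertex has only
-- the three remaining neighbours of `u`.
locally-critical⇒minimal-critical : (G : Graph) → InC G → LocallyCritical G → MinimalCritical G
locally-critical⇒minimal-critical G inC@((G-sym , G-irr) , _) L = inC , λ e → essential e , critical e
  where
  open LocallyCritical L

  essential : ∀ e → Essential G e
  essential e@(u , v , uv) (_ , _ , deg) with edge-end uv
  ... | inj₁ u≤4 = 1+n≰n (AtLeast⇒≤
    (AtLeast-map (λ z (uz , ¬z , _) → uz , λ z≡v → ¬z (refl , z≡v)) (at-least-4 (deleteEdge G e) deg u))
    (AtMost-remove v uv u≤4))
  ... | inj₂ v≤4 = 1+n≰n (AtLeast⇒≤
    (AtLeast-map (λ z (vz , _ , ¬z) → vz , λ z≡u → ¬z (refl , z≡u)) (at-least-4 (deleteEdge G e) deg v))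
    (AtMost-remove u (G-sym u v uv) v≤4))

  critical : ∀ e → Critical G e
  critical e@(u , v , uv) with edge-crit uv
  ... | inj₁ (w , w≤4 , uw , vw) = contract-degree G e (w , w≢v) nbr
      (AtMost-remove v (G-sym v w vw) w≤4)
    where
    w≢v : w ≢ v
    w≢v refl = G-irr w vw
    nbr : ∀ b → Adj (contractEdge G e) (w , w≢v) b → Adj G w (proj₁ b) × proj₁ b ≢ v
    nbr (b , b≢v) (_ , x , y , xy , inj₁ refl , inj₁ refl) = xy , b≢v
    nbr (b , b≢v) (_ , x , y , xy , inj₁ refl , inj₂ (_ , refl)) = G-sym u w uw , b≢v
    nbr b (_ , x , y , xy , inj₂ (_ , refl) , _) = ⊥-elim (G-irr w uw)
  ... | inj₂ (u≤4 , _ , v⊆u , _) = contract-degree G e (u , u≢v) nbr (AtMost-remove v uv u≤4)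
    where
    u≢v : u ≢ v
    u≢v refl = G-irr u uv
    nbr : ∀ b → Adj (contractEdge G e) (u , u≢v) b → Adj G u (proj₁ b) × proj₁ b ≢ v
    nbr (b , b≢v) (_ , x , y , xy , inj₁ refl , inj₁ refl) = xy , b≢v
    nbr (b , b≢v) (u≢b , x , y , xy , inj₂ (refl , _) , inj₁ refl) = v⊆u b (u≢b ∘ sym) xy , b≢v
    nbr (b , b≢v) (u≢b , x , y , xy , _ , inj₂ (_ , refl)) = ⊥-elim (u≢b refl)

-- The witnesses of connectedness and minimum degree mention finitely many edges; these already span
-- a graph in the class, so an essential edge must be one of them.
module DecideAdj (G : Graph) (fin : Finite (V G)) (G-irr : ∀ x → ¬ Adj G x x) (G-sym : Symmetric G)
                 (con : Connected G) (deg : MinDeg≥4 G) where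

  infix 4 _≟_
  _≟_ : DecidableEquality (V G)
  _≟_ = finite-≟ fin

  OnWalk : ∀ {x y} → Reach G x y → V G → V G → Set
  OnWalk here u v = ⊥
  OnWalk (step {x} {y} _ r) u v = (x ≡ u × y ≡ v) ⊎ OnWalk r u v

  onWalk? : ∀ {x y} (r : Reach G x y) u v → Dec (OnWalk r u v)
  onWalk? here u v = no λ ()
  onWalk? (step {x} {y} _ r) u v = (x ≟ u ×-dec y ≟ v) ⊎-dec onWalk? r u v

  onWalk⇒adj : ∀ {x y} (r : Reach G x y) {u v} → OnWalk r u v → Adj G u v
  onWalk⇒adj (step xy r) (inj₁ (refl , refl)) = xy
  onWalk⇒adj (step xy r) (inj₂ o) = onWalk⇒adj r o

  Used : V G → V G → Set
  Used u v = (∃ λ i → proj₁ (deg u) i ≡ v) ⊎ (∃ λ x → ∃ λ y → OnWalk (proj₂ con x y) u v)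

  used? : ∀ u v → Dec (Used u v)
  used? u v = any? (λ i → proj₁ (deg u) i ≟ v)
    ⊎-dec search fin (λ x → search fin λ y → onWalk? (proj₂ con x y) u v)

  used⇒adj : ∀ {u v} → Used u v → Adj G u v
  used⇒adj {u} (inj₁ (i , refl)) = proj₂ (proj₂ (deg u)) i
  used⇒adj (inj₂ (x , y , o)) = onWalk⇒adj (proj₂ con x y) o

  unused⇒inessential : ∀ {u v} (uv : Adj G u v) → ¬ Used u v → ¬ Used v u → InC (deleteEdge G (u , v , uv))
  unused⇒inessential {u} {v} uv ¬uv ¬vu =
    ((λ x y (xy , p , q) → G-sym x y xy , (λ (a , b) → q (b , a)) , λ (a , b) → p (b , a)) , λ x (xx , _) → G-irr x xx) ,
    (proj₁ con , λ x y → avoid (proj₂ con x y) (λ o → ¬uv (inj₂ (x , y , o))) λ o → ¬vu (inj₂ (x , y , o))) ,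
    λ x → let f , inj , adj = deg x in f , inj , λ i →
      adj i , (λ { (refl , eq) → ¬uv (inj₁ (i , eq)) }) , λ { (refl , eq) → ¬vu (inj₁ (i , eq)) }
    where
    avoid : ∀ {x y} (r : Reach G x y) → ¬ OnWalk r u v → ¬ OnWalk r v u → Reach (deleteEdge G (u , v , uv)) x y
    avoid here _ _ = here
    avoid (step xy r) p q = step (xy , p ∘ inj₁ , q ∘ inj₁) (avoid r (p ∘ inj₂) (q ∘ inj₂))

  essential⇒decidable : (∀ e → Essential G e) → ∀ u v → Dec (Adj G u v)
  essential⇒decidable ess u v with used? u v | used? v u
  ... | yes p | _ = yes (used⇒adj p)
  ... | no _ | yes q = yes (G-sym v u (used⇒adj q))
  ... | no ¬p | no ¬q = no λ uv → ess (u , v , uv) (unused⇒inessential uv ¬p ¬q)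

-- Bricks

all-types? : {P : BrickType → Set} → Decidable P → Dec (∀ t → P t)
all-types? {P} P? = map′
  (λ (a , b , c , d , e , f , g , h , i) → λ where
    k5 → a ; k222 → b ; k5⁻ → c ; k222⁻ → d ; k5▽ → e ; k222▽ → f ; k5▷◁ → g ; k222▷◁ → h ; k3 → i)
  (λ p → p k5 , p k222 , p k5⁻ , p k222⁻ , p k5▽ , p k222▽ , p k5▷◁ , p k222▷◁ , p k3)
  (P? k5 ×-dec P? k222 ×-dec P? k5⁻ ×-dec P? k222⁻ ×-dec P? k5▽ ×-dec P? k222▽ ×-dec
   P? k5▷◁ ×-dec P? k222▷◁ ×-dec P? k3)

-- whole, heavy: all degrees inside the brick are at least 4, resp. at least 3.
whole heavy bowtie triangular : BrickType → Bool
whole k5 = true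
whole k222 = true
whole _ = false
heavy k5⁻ = true
heavy k222⁻ = true
heavy t = whole t
bowtie k5▷◁ = true
bowtie k222▷◁ = true
bowtie _ = false
triangular k3 = true
triangular _ = false

≅-refl : (G : Graph) → G ≅ G
≅-refl G = ↔-id (V G) , λ x y → mk⇔ (λ a → a) λ a → a

triangular⇒iso : ∀ t → T (triangular t) → brick t ≅ brick k3
triangular⇒iso k3 _ = ≅-refl _

bowtie-iso : ∀ t → T (bowtie t) → (brick t ≅ brick k5▷◁) ⊎ (brick t ≅ brick k222▷◁)
bowtie-iso k5▷◁ _ = inj₁ (≅-refl _)
bowtie-iso k222▷◁ _ = inj₂ (≅-refl _)

heavy-iso : ∀ t → T (heavy t) →
  (brick t ≅ brick k5⁻) ⊎ (brick t ≅ brick k222⁻) ⊎ (brick t ≅ brick k5) ⊎ (brick t ≅ brick k222)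
heavy-iso k5⁻ _ = inj₁ (≅-refl _)
heavy-iso k222⁻ _ = inj₂ (inj₁ (≅-refl _))
heavy-iso k5 _ = inj₂ (inj₂ (inj₁ (≅-refl _)))
heavy-iso k222 _ = inj₂ (inj₂ (inj₂ (≅-refl _)))

bAdj? : ∀ t i j → Dec (BAdj t i j)
bAdj? t i j = T? _

attach? : ∀ t i → Dec (Attach t i)
attach? k5 i = toℕ i ℕ.≟ 0
attach? k222 i = toℕ i ℕ.≟ 0
attach? k5⁻ i = degree k5⁻ i <? 4
attach? k222⁻ i = degree k222⁻ i <? 4
attach? k5▽ i = degree k5▽ i <? 4
attach? k222▽ i = degree k222▽ i <? 4
attach? k5▷◁ i = degree k5▷◁ i <? 4
attach? k222▷◁ i = degree k222▷◁ i <? 4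
attach? k3 i = degree k3 i <? 4

bdeg : ∀ t → Fin (size t) → ℕ
bdeg t i = length (members (bAdj? t i))

opaque
  BAdj-sym : ∀ t i j → BAdj t i j → BAdj t j i
  BAdj-sym = from-yes (all-types? λ t → all? λ i → all? λ j → bAdj? t i j →-dec bAdj? t j i)

  BAdj-irr : ∀ t i → ¬ BAdj t i i
  BAdj-irr = from-yes (all-types? λ t → all? λ i → ¬? (bAdj? t i i))

  bdeg-inner : ∀ t i → ¬ Attach t i → bdeg t i ≡ 4
  bdeg-inner = from-yes (all-types? λ t → all? λ i → ¬? (attach? t i) →-dec (bdeg t i ℕ.≟ 4))

  bdeg-≥2 : ∀ t i → 2 ≤ bdeg t i
  bdeg-≥2 = from-yes (all-types? λ t → all? λ i → 2 ≤? bdeg t i)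

  bdeg-whole : ∀ t → T (whole t) → ∀ i → bdeg t i ≡ 4
  bdeg-whole = from-yes (all-types? λ t → T? (whole t) →-dec all? λ i → bdeg t i ℕ.≟ 4)

  bdeg-attach-<4 : ∀ t → ¬ T (whole t) → ∀ i → Attach t i → bdeg t i < 4
  bdeg-attach-<4 = from-yes (all-types? λ t → ¬? (T? (whole t)) →-dec
    all? λ i → attach? t i →-dec (bdeg t i <? 4))

  bdeg-heavy : ∀ t → T (heavy t) → ∀ i → 3 ≤ bdeg t i
  bdeg-heavy = from-yes (all-types? λ t → T? (heavy t) →-dec all? λ i → 3 ≤? bdeg t i)

  bdeg-attach-light : ∀ t → ¬ T (heavy t) → ∀ i → Attach t i → bdeg t i ≡ 2
  bdeg-attach-light = from-yes (all-types? λ t → ¬? (T? (heavy t)) →-dec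
    all? λ i → attach? t i →-dec (bdeg t i ℕ.≟ 2))

  attachment : ∀ t → ∃ λ i → Attach t i
  attachment = from-yes (all-types? λ t → any? (attach? t))

  attachment-count : ∀ t → let k = length (members (attach? t)) in k ≡ 1 ⊎ k ≡ 2 ⊎ k ≡ 3
  attachment-count = from-yes (all-types? λ t → let k = length (members (attach? t)) in
    (k ℕ.≟ 1) ⊎-dec (k ℕ.≟ 2) ⊎-dec (k ℕ.≟ 3))

  whole-attachment-unique : ∀ t → T (whole t) → ∀ i j → Attach t i → Attach t j → i ≡ j
  whole-attachment-unique = from-yes (all-types? λ t → T? (whole t) →-dec
    all? λ i → all? λ j → attach? t i →-dec (attach? t j →-dec (i Fin.≟ j)))

  -- In the two excluded bricks the attachments hang on disjoint edges and are at distance 3. This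
  -- is the origin of the exception for `f_x = f_y` in (TB).
  attachments-close : ∀ t → ¬ T (bowtie t) → ∀ i j → Attach t i → Attach t j → i ≢ j →
    BAdj t i j ⊎ ∃ λ k → BAdj t i k × BAdj t j k
  attachments-close = from-yes (all-types? λ t → ¬? (T? (bowtie t)) →-dec
    all? λ i → all? λ j → attach? t i →-dec (attach? t j →-dec (¬? (i Fin.≟ j) →-dec
      (bAdj? t i j ⊎-dec any? λ k → bAdj? t i k ×-dec bAdj? t j k))))

  k3-attach : ∀ i → Attach k3 i
  k3-attach = from-yes (all? (attach? k3))

  k3-adjacent : ∀ i j → i ≢ j → BAdj k3 i j
  k3-adjacent = from-yes (all? λ i → all? λ j → ¬? (i Fin.≟ j) →-dec bAdj? k3 i j)

  edge-common : ∀ t i j → BAdj t i j → ∃ λ k → BAdj t i k × BAdj t j k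
  edge-common = from-yes (all-types? λ t → all? λ i → all? λ j → bAdj? t i j →-dec
    any? λ k → bAdj? t i k ×-dec bAdj? t j k)

  edge-inner-end : ∀ t → ¬ T (triangular t) → ∀ i j → BAdj t i j → ¬ Attach t i ⊎ ¬ Attach t j
  edge-inner-end = from-yes (all-types? λ t → ¬? (T? (triangular t)) →-dec
    all? λ i → all? λ j → bAdj? t i j →-dec (¬? (attach? t i) ⊎-dec ¬? (attach? t j)))

  -- The second alternative occurs only for the edge of K₅▽ missed by the deleted triangle.
  edge-inner-common : ∀ t → ¬ T (triangular t) → ∀ i j → BAdj t i j →
    (∃ λ k → ¬ Attach t k × BAdj t i k × BAdj t j k) ⊎
    (¬ Attach t i × ¬ Attach t j ×
     (∀ k → k ≢ i → BAdj t j k → BAdj t i k) × (∀ k → k ≢ j → BAdj t i k → BAdj t j k))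
  edge-inner-common = from-yes (all-types? λ t → ¬? (T? (triangular t)) →-dec
    all? λ i → all? λ j → bAdj? t i j →-dec
      ((any? λ k → ¬? (attach? t k) ×-dec bAdj? t i k ×-dec bAdj? t j k) ⊎-dec
       (¬? (attach? t i) ×-dec ¬? (attach? t j) ×-dec
         (all? λ k → ¬? (k Fin.≟ i) →-dec (bAdj? t j k →-dec bAdj? t i k)) ×-dec
         (all? λ k → ¬? (k Fin.≟ j) →-dec (bAdj? t i k →-dec bAdj? t j k)))))

-- Bounding the length of walks turns connectedness of the bricks into a finite check. The bound 3
-- used below is the distance between the attachments of a bow-tie.
Near : ∀ t → ℕ → Fin (size t) → Fin (size t) → Set
Near t zero i j = i ≡ j
Near t (suc n) i j = i ≡ j ⊎ ∃ λ k → BAdj t i k × Near t n k j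

near? : ∀ t n i j → Dec (Near t n i j)
near? t zero i j = i Fin.≟ j
near? t (suc n) i j = (i Fin.≟ j) ⊎-dec any? λ k → bAdj? t i k ×-dec near? t n k j

near-walk : ∀ t n {i j} → Near t n i j → Reach (brick t) i j
near-walk t zero refl = here
near-walk t (suc n) (inj₁ refl) = here
near-walk t (suc n) (inj₂ (k , ik , kj)) = step ik (near-walk t n kj)

opaque
  brick-near : ∀ t i j → Near t 3 i j
  brick-near = from-yes (all-types? λ t → all? λ i → all? λ j → near? t 3 i j)

brick-connected : ∀ t i j → Reach (brick t) i j
brick-connected t i j = near-walk t 3 (brick-near t i j)

-- An edge from which every edge of the brick is reached through at most four triangles.
base : ∀ t → Fin (size t) × Fin (size t)
base k5 = zero , suc zero
base k222 = zero , suc (suc zero)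
base k5⁻ = zero , suc zero
base k222⁻ = zero , suc (suc (suc zero))
base k5▽ = zero , suc zero
base k222▽ = zero , suc (suc (suc zero))
base k5▷◁ = zero , suc zero
base k222▷◁ = suc zero , suc (suc zero)
base k3 = zero , suc zero

TriNear : ∀ t → ℕ → Fin (size t) → Fin (size t) → Set
TriNear t zero i j = (proj₁ (base t) ≡ i × proj₂ (base t) ≡ j) ⊎ (proj₁ (base t) ≡ j × proj₂ (base t) ≡ i)
TriNear t (suc n) i k = TriNear t n i k ⊎
  ∃ λ j → BAdj t i k × BAdj t j k × BAdj t i j × (TriNear t n i j ⊎ TriNear t n k j)

triNear? : ∀ t n i j → Dec (TriNear t n i j)
triNear? t zero i j = (proj₁ (base t) Fin.≟ i ×-dec proj₂ (base t) Fin.≟ j) ⊎-dec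
                      (proj₁ (base t) Fin.≟ j ×-dec proj₂ (base t) Fin.≟ i)
triNear? t (suc n) i k = triNear? t n i k ⊎-dec
  any? λ j → bAdj? t i k ×-dec bAdj? t j k ×-dec bAdj? t i j ×-dec (triNear? t n i j ⊎-dec triNear? t n k j)

opaque
  brick-triNear : ∀ t i j → BAdj t i j → TriNear t 4 i j
  brick-triNear = from-yes (all-types? λ t → all? λ i → all? λ j → bAdj? t i j →-dec triNear? t 4 i j)

module TriangleConnected (t : BrickType) (S : Fin (size t) → Fin (size t) → Set)
  (S-sym : ∀ {i j} → S i j → S j i)
  (S-tri : ∀ {i j k} → BAdj t i j → BAdj t i k → BAdj t j k → S i j → S i k) where

  S-base : Set
  S-base = S (proj₁ (base t)) (proj₂ (base t))

  -- Membership travels in both directions along the chain of triangles to the base edge. So `S`,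
  -- once it contains one edge of the brick, contains them all.
  S⇔base : ∀ n {i j} → TriNear t n i j → (S-base → S i j) × (S i j → S-base)
  S⇔base zero (inj₁ (refl , refl)) = (λ s → s) , λ s → s
  S⇔base zero (inj₂ (refl , refl)) = S-sym , S-sym
  S⇔base (suc n) (inj₁ p) = S⇔base n p
  S⇔base (suc n) {i} {k} (inj₂ (j , ik , jk , ij , inj₁ p)) = let f , g = S⇔base n p in
    (λ s → S-tri ij ik jk (f s)) , λ s → g (S-tri ik ij (BAdj-sym t j k jk) s)
  S⇔base (suc n) {i} {k} (inj₂ (j , ik , jk , ij , inj₂ p)) = let f , g = S⇔base n p in
    (λ s → S-sym (S-tri (BAdj-sym t j k jk) (BAdj-sym t i k ik) (BAdj-sym t i j ij) (f s))) ,
    λ s → g (S-tri (BAdj-sym t i k ik) (BAdj-sym t j k jk) ij (S-sym s))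

  S-all : ∀ {i j k l} → BAdj t i j → BAdj t k l → S i j → S k l
  S-all ij kl s = proj₁ (S⇔base 4 (brick-triNear t _ _ kl)) (proj₂ (S⇔base 4 (brick-triNear t _ _ ij)) s)

BrickEdge : {A : Set} (t : BrickType) → (Fin (size t) → A) → A → A → Set
BrickEdge t φ x y = ∃ λ i → ∃ λ j → BAdj t i j × φ i ≡ x × φ j ≡ y

brickEdge? : {A : Set} → DecidableEquality A → ∀ t (φ : Fin (size t) → A) x y → Dec (BrickEdge t φ x y)
brickEdge? _≟_ t φ x y = any? λ i → any? λ j → bAdj? t i j ×-dec (φ i ≟ x) ×-dec (φ j ≟ y)

module _ {A : Set} {t : BrickType} {φ : Fin (size t) → A} (φ-inj : ∀ i j → φ i ≡ φ j → i ≡ j) where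

  brick-at-least : ∀ i {k} → k ≤ bdeg t i → AtLeast k (BrickEdge t φ (φ i))
  brick-at-least i k≤ = AtLeast-image φ φ-inj (λ j ij → i , j , ij , refl , refl)
    (AtLeast-≤ k≤ (members-AtLeast (bAdj? t i)))

  brick-neighbour : ∀ i {z} → BrickEdge t φ (φ i) z → ∃ λ j → BAdj t i j × z ≡ φ j
  brick-neighbour i (i′ , j , ij , p , refl) with φ-inj i′ i p
  ... | refl = j , ij , refl

  brick-at-most : ∀ i {k} → bdeg t i ≡ k → AtMost k (BrickEdge t φ (φ i))
  brick-at-most i refl = AtMost-image φ (λ z → brick-neighbour i) (members-AtMost (bAdj? t i))

-- The decomposition into bricks

-- A brick together with what the assembly consumes: `inner-full` confines sharing to attachments,
-- `attach-exit` gives every hypergraph vertex a second hyperedge, `tri-closed` makes bricks with a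
-- common edge coincide, and `k3-split` identifies the only other brick at a corner of a triangle.
record Placed (G : Graph) : Set where
  field
    type   : BrickType
    at     : Fin (size type) → V G
    at-inj : ∀ i j → at i ≡ at j → i ≡ j
    at-hom : ∀ i j → BAdj type i j → Adj G (at i) (at j)

  Has : V G → V G → Set
  Has = BrickEdge type at

  field
    inner-full  : ∀ i → ¬ Attach type i → ∀ z → Adj G (at i) z → Has (at i) z
    attach-exit : ∀ i → Attach type i → ∃ λ z → Adj G (at i) z × ¬ Has (at i) z
    tri-closed  : ∀ {x y z} → Has x y → Adj G x z → Adj G y z → Has x z
    k3-split    : T (triangular type) → ∀ i → ∃ λ p → ∃ λ q →
      Adj G p q × Adj G (at i) p × Adj G (at i) q × ¬ Has (at i) p × ¬ Has (at i) q ×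
      (∀ z → Adj G (at i) z → z ≡ p ⊎ z ≡ q ⊎ Has (at i) z)

  Has-sym : ∀ {x y} → Has x y → Has y x
  Has-sym (i , j , ij , p , q) = j , i , BAdj-sym type i j ij , q , p

  Has⇒adj : ∀ {x y} → Has x y → Adj G x y
  Has⇒adj (i , j , ij , refl , refl) = at-hom i j ij

  edge-at : ∀ i → ∃ λ j → BAdj type i j
  edge-at i = let two = AtLeast-≤ (bdeg-≥2 type i) (members-AtLeast (bAdj? type i)) in
    pick two zero , pick-holds two zero

module _ {G : Graph} where
  open Placed

  -- Both edge sets are closed under passing to another edge of a triangle, and a brick is connected in
  -- this sense.
  share⇒⊆ : (P Q : Placed G) → ∀ {x y u v} → Has P x y → Has Q x y → Has P u v → Has Q u v
  share⇒⊆ P Q (i , j , ij , refl , refl) q (k , l , kl , refl , refl) =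
    TriangleConnected.S-all (type P) (λ i j → Has Q (at P i) (at P j)) (Has-sym Q)
      (λ ij ik jk s → tri-closed Q s (at-hom P _ _ ik) (at-hom P _ _ jk)) ij kl q

size-3⇒triangular : ∀ t → size t ≡ 3 → T (triangular t)
size-3⇒triangular k3 _ = _

iso-k3⇒triangular : ∀ t → brick t ≅ brick k3 → T (triangular t)
iso-k3⇒triangular t (φ , _) = size-3⇒triangular t (↔⇒≡ φ)

-- (TB) speaks of isomorphism classes, not of types. Minimum degree 3 is an invariant common to all
-- four forbidden bricks, so a vertex of degree 2 rules them out together.
iso-heavy⇒degree-3 : ∀ s t → brick s ≅ brick t → T (heavy t) → ∀ i → AtLeast 3 (BAdj s i)
iso-heavy⇒degree-3 s t (φ , adj) h i = AtLeast-image from (from-injective φ)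
  (λ k ik → Equivalence.from (adj i (from k)) (subst (BAdj t (to i)) (sym (strictlyInverseˡ k)) ik))
  (AtLeast-≤ (bdeg-heavy t h (to i)) (members-AtLeast (bAdj? t (to i))))
  where
  open Inverse φ

-- Assembling the hypergraph from placed bricks.

module Assembly (G : Graph) (fin : Finite (V G)) (G-sym : Symmetric G) (G-irr : ∀ x → ¬ Adj G x x)
  (con : Connected G) (adj? : ∀ x y → Dec (Adj G x y)) (some-edge : Edge G)
  (cover-edge : ∀ x y → Adj G x y → Σ (Placed G) λ P → Placed.Has P x y) where
  open Placed

  infix 4 _≟_
  _≟_ : DecidableEquality (V G)
  _≟_ = finite-≟ fin

  open Inverse (proj₂ fin) using () renaming (to to code; from to decode; strictlyInverseʳ to decode-code)

  has? : ∀ (P : Placed G) x y → Dec (Has P x y)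
  has? P = brickEdge? _≟_ (type P) (at P)

  Disjoint : Placed G → Placed G → Set
  Disjoint P Q = ∀ x y → Has P x y → ¬ Has Q x y

  -- Greedy choice: a brick is added only for an edge not yet covered. If it shared an edge with an
  -- older brick, `share⇒⊆` would put all its edges into the older one, including the uncovered
  -- edge.
  collect : (es : List (V G × V G)) → Σ (List (Placed G)) λ Ps → AllPairs Disjoint Ps ×
    (∀ {x y} → (x , y) ∈ es → Adj G x y → Any (λ P → Has P x y) Ps)
  collect [] = [] , [] , λ ()
  collect ((x , y) ∷ es) with collect es | adj? x y
  ... | Ps , dis , cov | no ¬xy = Ps , dis , λ where
    (here refl) xy → ⊥-elim (¬xy xy)
    (there e) → cov e
  ... | Ps , dis , cov | yes xy with Any.any? (λ P → has? P x y) Ps | cover-edge x y xy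
  ... | yes old | _ = Ps , dis , λ where
    (here refl) _ → old
    (there e) → cov e
  ... | no new | P , Pxy = P ∷ Ps , fresh Ps new ∷ dis ,
    λ { (here refl) _ → here Pxy ; (there e) uv → there (cov e uv) }
    where
    fresh : ∀ Qs → ¬ Any (λ Q → Has Q x y) Qs → All (Disjoint P) Qs
    fresh [] _ = []
    fresh (Q ∷ Qs) new =
      (λ u v Puv Quv → new (here (share⇒⊆ P Q Puv Quv Pxy))) ∷ fresh Qs (new ∘ there)

  lookup-disjoint : ∀ {Ps} → AllPairs Disjoint Ps → ∀ e f {x y} →
    Has (lookup Ps e) x y → Has (lookup Ps f) x y → e ≡ f
  lookup-disjoint (_ ∷ _) zero zero _ _ = refl
  lookup-disjoint (d ∷ _) zero (suc f) p q = ⊥-elim (All.lookup d (∈-lookup f) _ _ p q)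
  lookup-disjoint (d ∷ _) (suc e) zero p q = ⊥-elim (All.lookup d (∈-lookup e) _ _ q p)
  lookup-disjoint (_ ∷ ds) (suc e) (suc f) p q = cong suc (lookup-disjoint ds e f p q)

  pairs : List (V G × V G)
  pairs = map (λ (i , j) → decode i , decode j) (cartesianProduct (allFin _) (allFin _))

  ∈-pairs : ∀ x y → (x , y) ∈ pairs
  ∈-pairs x y = subst₂ (λ a b → (a , b) ∈ pairs) (decode-code x) (decode-code y)
    (∈-map⁺ _ (∈-cartesianProduct⁺ (∈-allFin (code x)) (∈-allFin (code y))))

  opaque
    collection : Σ (List (Placed G)) λ Ps → AllPairs Disjoint Ps ×
      (∀ x y → Adj G x y → Any (λ P → Has P x y) Ps)
    collection = let Ps , dis , cov = collect pairs in Ps , dis , λ x y → cov (∈-pairs x y)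

  bricks : List (Placed G)
  bricks = proj₁ collection

  E : Set
  E = Fin (length bricks)

  P : E → Placed G
  P = lookup bricks

  ty : E → BrickType
  ty e = type (P e)

  φ : ∀ e → Fin (size (ty e)) → V G
  φ e = at (P e)

  same : ∀ {e f x y} → Has (P e) x y → Has (P f) x y → e ≡ f
  same = lookup-disjoint (proj₁ (proj₂ collection)) _ _

  brick-of : ∀ {x y} → Adj G x y → Σ E λ e → Has (P e) x y
  brick-of {x} {y} xy = index any , lookup-index any
    where
    any = proj₂ (proj₂ collection) x y xy

  -- All edges at an inner vertex belong to its brick, so a second brick through that vertex would
  -- share an edge with the first.
  shared⇒attach : ∀ {e f} → e ≢ f → ∀ i j → φ e i ≡ φ f j → Attach (ty e) i
  shared⇒attach {e} {f} e≢f i j eq = decidable-stable (attach? (ty e) i) λ inner →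
    let k , jk = edge-at (P f) j
        f-has = j , k , jk , sym eq , refl
    in e≢f (same (inner-full (P e) i inner _ (Has⇒adj (P f) f-has)) f-has)

  Attached : Fin (proj₁ fin) → Set
  Attached c = Σ E λ e → ∃ λ i → Attach (ty e) i × φ e i ≡ decode c

  attached? : Decidable Attached
  attached? c = any? λ e → any? λ i → attach? (ty e) i ×-dec φ e i ≟ decode c

  Vertex : Set
  Vertex = Fin (length (members attached?))

  ι : Vertex → V G
  ι w = decode (lookup (members attached?) w)

  ι-inj : ∀ x y → ι x ≡ ι y → x ≡ y
  ι-inj x y eq = members-injective attached? x y (from-injective (proj₂ fin) _ _ eq)

  vertex : ∀ e i → Attach (ty e) i → Σ Vertex λ w → ι w ≡ φ e i
  vertex e i a = let w , eq = member-index attached? (code (φ e i)) (e , i , a , sym (decode-code _)) in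
    w , trans (cong decode (sym eq)) (decode-code _)

  _∋_ : E → Vertex → Set
  e ∋ x = ∃ λ i → Attach (ty e) i × φ e i ≡ ι x

  ∋? : ∀ e x → Dec (e ∋ x)
  ∋? e x = any? λ i → attach? (ty e) i ×-dec φ e i ≟ ι x

  H : Hypergraph
  H = record { W = Vertex ; m = length bricks ; Inc = λ e x → isYes (∋? e x) }

  R : BrickReplacement G H
  R = record
    { ι = ι
    ; ι-inj = ι-inj
    ; ty = ty
    ; φ = φ
    ; φ-inj = λ e → at-inj (P e)
    ; φ-hom = λ e → at-hom (P e)
    ; attach⊆ = λ e i a → let w , eq = vertex e i a in w , fromWitness (i , a , sym eq) , eq
    ; attach⊇ = λ e x x∈e → toWitness x∈e
    ; covV = covV
    ; covE = λ x y xy → brick-of xy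
    ; shareV = λ e f e≢f i j eq → shared⇒attach e≢f i j eq , shared⇒attach (e≢f ∘ sym) j i (sym eq)
    ; shareE = λ e f i j k l ij kl → λ
        { (inj₁ (p , q)) → same (i , j , ij , refl , refl) (k , l , kl , sym p , sym q)
        ; (inj₂ (p , q)) → same (i , j , ij , refl , refl) (l , k , BAdj-sym (ty f) k l kl , sym p , sym q) }
    }
    where
    -- No vertex is isolated: a walk to an end of `some-edge` starts with an edge, or else is empty,
    -- and then `some-edge` serves.
    neighbour : ∀ {x y} → Reach G x y → (∃ λ z → Adj G y z) → ∃ λ z → Adj G x z
    neighbour here n = n
    neighbour (step xy _) _ = _ , xy
    covV : ∀ v → Σ E λ e → ∃ λ i → φ e i ≡ v
    covV v = let a , b , ab = some-edge
                 z , vz = neighbour (proj₂ con v a) (b , ab)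
                 e , i , _ , _ , eq , _ = brick-of vz
             in e , i , eq

  attach-of : ∀ {e x i} → φ e i ≡ ι x → e ∋ x
  attach-of {e} {x} {i} eq with member-holds attached? x
  ... | f , j , a , eq′ with e Fin.≟ f
  ... | yes refl = j , a , eq′
  ... | no e≢f = i , shared⇒attach e≢f i j (trans eq (sym eq′)) , eq

  -- The walk is followed with a current brick `e` and a hypergraph vertex `x` of `e` already
  -- reached. When the next edge lies in another brick `f`, the current vertex is an attachment of
  -- both bricks and becomes the next hypergraph vertex.
  hyper-walk : ∀ {u v} → Reach G u v → ∀ {e i} → φ e i ≡ u → ∀ x → e ∋ x → ∀ y → ι y ≡ v → HReach H x y
  hyper-walk here {e} eq x x∈e y refl = step e (fromWitness x∈e) (fromWitness (attach-of {e} eq)) here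
  hyper-walk (step uu′ r) {e} {i} eq x x∈e y y≡ with brick-of uu′
  ... | f , j , k , jk , eqj , eqk with e Fin.≟ f
  ... | yes refl = hyper-walk r eqk x x∈e y y≡
  ... | no e≢f =
    let i-att = shared⇒attach e≢f i j (trans eq (sym eqj))
        j-att = shared⇒attach (e≢f ∘ sym) j i (trans eqj (sym eq))
        x′ , eq′ = vertex e i i-att
    in step e (fromWitness x∈e) (fromWitness (i , i-att , sym eq′))
         (hyper-walk r eqk x′ (j , j-att , trans eqj (sym (trans eq′ eq))) y y≡)

  other-brick : ∀ {e x} → e ∋ x → Σ E λ f → e ≢ f × f ∋ x
  other-brick {e} {x} (i , a , eq) with attach-exit (P e) i a
  ... | z , az , ¬has with brick-of az
  ... | f , has@(j , _ , _ , eqj , _) = f , e≢f , j , shared⇒attach (e≢f ∘ sym) j i eqj , trans eqj eq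
    where
    e≢f : e ≢ f
    e≢f refl = ¬has has

  good : GoodHypergraph H
  good = (_ , ↔-id _) , w₀ , connected , degree≥2 , size-ok
    where
    e₀ : E
    e₀ = let _ , _ , ab = some-edge in proj₁ (brick-of ab)
    w₀ : Vertex
    w₀ = let i , a = attachment (ty e₀) in proj₁ (vertex e₀ i a)
    connected : ∀ x y → HReach H x y
    connected x y with member-holds attached? x
    ... | e , i , a , eq = hyper-walk (proj₂ con (ι x) (ι y)) eq x (i , a , eq) y refl
    degree≥2 : ∀ x → Σ E λ e → Σ E λ f → e ≢ f × T (Inc H e x) × T (Inc H f x)
    degree≥2 x with member-holds attached? x
    ... | e , x∈e with other-brick {e} {x} x∈e
    ... | f , e≢f , x∈f = e , f , e≢f , fromWitness x∈e , fromWitness x∈f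
    size-ok : ∀ e → Σ ℕ λ k → (k ≡ 1 ⊎ k ≡ 2 ⊎ k ≡ 3) × ((Σ Vertex λ x → T (Inc H e x)) ↔ Fin k)
    size-ok e = length as , attachment-count (ty e) , mk↔ₛ′ to from to-from from-to
      where
      as = members (attach? (ty e))
      to : (Σ Vertex λ x → T (Inc H e x)) → Fin (length as)
      to (x , x∈e) = let i , a , _ = toWitness x∈e in proj₁ (member-index (attach? (ty e)) i a)
      from : Fin (length as) → Σ Vertex λ x → T (Inc H e x)
      from k = let i = lookup as k
                   a = member-holds (attach? (ty e)) k
                   x , eq = vertex e i a
               in x , fromWitness (i , a , sym eq)
      lookup-to : ∀ p → φ e (lookup as (to p)) ≡ ι (proj₁ p)
      lookup-to (x , x∈e) = let i , a , eq = toWitness x∈e in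
        trans (cong (φ e) (sym (proj₂ (member-index (attach? (ty e)) i a)))) eq
      ι-from : ∀ k → ι (proj₁ (from k)) ≡ φ e (lookup as k)
      ι-from k = proj₂ (vertex e (lookup as k) (member-holds (attach? (ty e)) k))
      Σ-≡ : (p q : Σ Vertex λ x → T (Inc H e x)) → proj₁ p ≡ proj₁ q → p ≡ q
      Σ-≡ (x , p) (.x , q) refl = cong (x ,_) (T-irrelevant p q)
      to-from : ∀ k → to (from k) ≡ k
      to-from k = members-injective (attach? (ty e)) _ _
        (at-inj (P e) _ _ (trans (lookup-to (from k)) (ι-from k)))
      from-to : ∀ p → from (to p) ≡ p
      from-to p = Σ-≡ _ _ (ι-inj _ _ (trans (ι-from (to p)) (lookup-to p)))

  k3-has : ∀ {e x y} → T (triangular (ty e)) → e ∋ x → e ∋ y → x ≢ y → Has (P e) (ι x) (ι y)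
  k3-has {e} {x} {y} tri (i , _ , p) (j , _ , q) x≢y = i , j , go (ty e) tri i j i≢j , p , q
    where
    i≢j : i ≢ j
    i≢j refl = x≢y (ι-inj x y (trans (sym p) q))
    go : ∀ t → T (triangular t) → ∀ i j → i ≢ j → BAdj t i j
    go k3 _ = k3-adjacent

  private
    _∈′_ : Vertex → E → Set
    x ∈′ e = T (Inc H e x)

  tb : TB R
  tb e tri-iso = unique , separated
    where
    tri : T (triangular (ty e))
    tri = iso-k3⇒triangular (ty e) tri-iso

    -- The two outside neighbours `p`, `q` of the corner are adjacent, so closure under triangles
    -- puts both edges into one brick `f`. These are the only edges of `f` at the corner, whence no
    -- brick of minimum degree 3.
    unique : ∀ x → x ∈′ e → Σ E λ f → OnlyOther R e x f ×
      ¬ (brick (ty f) ≅ brick k5⁻) × ¬ (brick (ty f) ≅ brick k222⁻) ×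
      ¬ (brick (ty f) ≅ brick k5) × ¬ (brick (ty f) ≅ brick k222)
    unique x x∈e with toWitness x∈e
    ... | i , a , eq with k3-split (P e) tri i
    ... | p , q , pq , ip , iq , ¬p , ¬q , full with brick-of ip
    ... | f , f-ip@(j , _ , _ , eqj , _) =
      f , (f≢e , fromWitness (j , shared⇒attach f≢e j i eqj , trans eqj eq) , only) ,
      light k5⁻ _ , light k222⁻ _ , light k5 _ , light k222 _
      where
      f≢e : f ≢ e
      f≢e refl = ¬p f-ip
      f-iq : Has (P f) (φ e i) q
      f-iq = tri-closed (P f) f-ip iq pq
      only : ∀ g → x ∈′ g → g ≡ e ⊎ g ≡ f
      only g x∈g with toWitness x∈g
      ... | k , _ , eqk with edge-at (P g) k
      ... | l , kl = decide (k , l , kl , trans eqk (sym eq) , refl)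
        where
        decide : ∀ {z} → Has (P g) (φ e i) z → g ≡ e ⊎ g ≡ f
        decide {z} g-has with full z (Has⇒adj (P g) g-has)
        ... | inj₁ refl = inj₂ (same g-has f-ip)
        ... | inj₂ (inj₁ refl) = inj₂ (same g-has f-iq)
        ... | inj₂ (inj₂ e-has) = inj₁ (same g-has e-has)
      two : AtMost 2 (Has (P f) (φ e i))
      two = atMost (λ { zero → p ; (suc zero) → q }) λ z f-has → decide f-has (full z (Has⇒adj (P f) f-has))
        where
        decide : ∀ {z} → Has (P f) (φ e i) z → z ≡ p ⊎ z ≡ q ⊎ Has (P e) (φ e i) z → _
        decide _ (inj₁ z≡p) = zero , z≡p
        decide _ (inj₂ (inj₁ z≡q)) = suc zero , z≡q
        decide f-has (inj₂ (inj₂ e-has)) = ⊥-elim (f≢e (same f-has e-has))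
      light : ∀ t → T (heavy t) → ¬ (brick (ty f) ≅ brick t)
      light t h iso = 1+n≰n (AtLeast⇒≤ (AtLeast-image (φ f) (at-inj (P f))
        (λ k jk → j , k , jk , eqj , refl) (iso-heavy⇒degree-3 (ty f) t iso h j)) two)

    separated : ∀ x y fx fy → x ∈′ e → y ∈′ e → x ≢ y → OnlyOther R e x fx → OnlyOther R e y fy →
      ((Σ Vertex λ z → z ∈′ fx × z ∈′ fy) → ¬ (Triangular R fx × Triangular R fy)) ×
      (fx ≡ fy → (brick (ty fx) ≅ brick k5▷◁) ⊎ (brick (ty fx) ≅ brick k222▷◁))
    -- In each forbidden situation some vertex outside the edge `x y` is joined to both its ends by
    -- edges of `fx` and `fy`, or `x y` itself lies in one of these bricks. Closure of `e` under
    -- triangles then makes `e` share an edge with another brick.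
    separated x y fx fy x∈e y∈e x≢y (fx≢e , x∈fx , _) (fy≢e , y∈fy , _) = not-both , same-brick
      where
      e-xy : Has (P e) (ι x) (ι y)
      e-xy = k3-has {e} {x} {y} tri (toWitness x∈e) (toWitness y∈e) x≢y

      not-both : (Σ Vertex λ z → z ∈′ fx × z ∈′ fy) → ¬ (Triangular R fx × Triangular R fy)
      not-both (z , z∈fx , z∈fy) (tx , ty′) = fx≢e (same fx-xz
          (tri-closed (P e) e-xy (Has⇒adj (P fx) fx-xz) (Has⇒adj (P fy) fy-yz)))
        where
        fx-tri = iso-k3⇒triangular (ty fx) tx
        fy-tri = iso-k3⇒triangular (ty fy) ty′
        x≢z : x ≢ z
        x≢z refl = fy≢e (same (k3-has {fy} {x} {y} fy-tri (toWitness z∈fy) (toWitness y∈fy) x≢y) e-xy)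
        y≢z : y ≢ z
        y≢z refl = fx≢e (same (k3-has {fx} {x} {y} fx-tri (toWitness x∈fx) (toWitness z∈fx) x≢y) e-xy)
        fx-xz : Has (P fx) (ι x) (ι z)
        fx-xz = k3-has {fx} {x} {z} fx-tri (toWitness x∈fx) (toWitness z∈fx) x≢z
        fy-yz : Has (P fy) (ι y) (ι z)
        fy-yz = k3-has {fy} {y} {z} fy-tri (toWitness y∈fy) (toWitness z∈fy) y≢z

      same-brick : fx ≡ fy → (brick (ty fx) ≅ brick k5▷◁) ⊎ (brick (ty fx) ≅ brick k222▷◁)
      same-brick refl with T? (bowtie (ty fx)) | toWitness x∈fx | toWitness y∈fy
      ... | yes b | _ | _ = bowtie-iso (ty fx) b
      ... | no ¬b | i , ai , p | j , aj , q
        with attachments-close (ty fx) ¬b i j ai aj (λ { refl → x≢y (ι-inj x y (trans (sym p) q)) })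
      ... | inj₁ ij = ⊥-elim (fx≢e (same (i , j , ij , p , q) e-xy))
      ... | inj₂ (k , ik , jk) = ⊥-elim (fx≢e (same fx-xk
          (tri-closed (P e) e-xy (Has⇒adj (P fx) fx-xk) (Has⇒adj (P fx) (j , k , jk , q , refl)))))
        where
        fx-xk : Has (P fx) (ι x) (φ fx k)
        fx-xk = i , k , ik , p , refl

  from-bricks : FromBricks G
  from-bricks = H , good , R , tb

-- Minimal criticality of brick compositions and squares of cycles

reach-trans : {G : Graph} → ∀ {x y z} → Reach G x y → Reach G y z → Reach G x z
reach-trans here r = r
reach-trans (step a q) r = step a (reach-trans q r)

reach-map : {G G′ : Graph} (φ : V G → V G′) → (∀ x y → Adj G x y → Adj G′ (φ x) (φ y)) →
  ∀ {x y} → Reach G x y → Reach G′ (φ x) (φ y)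
reach-map φ hom here = here
reach-map φ hom (step a r) = step (hom _ _ a) (reach-map φ hom r)

module Composition (G : Graph) (G-sym : Symmetric G) (H : Hypergraph) (good : GoodHypergraph H)
  (R : BrickReplacement G H) (tb : TB R) where
  open BrickReplacement R

  E : Set
  E = Fin (m H)

  Has : E → V G → V G → Set
  Has e = BrickEdge (ty e) (φ e)

  same : ∀ {e f x y} → Has e x y → Has f x y → e ≡ f
  same (i , j , ij , refl , refl) (k , l , kl , p , q) = shareE _ _ i j k l ij kl (inj₁ (sym p , sym q))

  Has⇒adj : ∀ {e x y} → Has e x y → Adj G x y
  Has⇒adj (i , j , ij , refl , refl) = φ-hom _ i j ij

  irr : ∀ x → ¬ Adj G x x
  irr x xx with covE x x xx
  ... | e , i , j , ij , p , q with φ-inj e i j (trans p (sym q))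
  ... | refl = BAdj-irr (ty e) i ij

  inner-full : ∀ e i → ¬ Attach (ty e) i → ∀ z → Adj G (φ e i) z → Has e (φ e i) z
  inner-full e i inner z iz with covE _ _ iz
  ... | f , has@(k , l , kl , p , q) with e Fin.≟ f
  ... | yes refl = has
  ... | no e≢f = ⊥-elim (inner (proj₁ (shareV e f e≢f i k (sym p))))

  inner-deg≤4 : ∀ e i → ¬ Attach (ty e) i → Deg≤4 G (φ e i)
  inner-deg≤4 e i inner = AtMost-map (inner-full e i inner) (brick-at-most (φ-inj e) i (bdeg-inner (ty e) i inner))

  -- Two bricks meet at the vertex, each has at least two edges there, and no edge is shared.
  vertex-deg≥4 : ∀ x → AtLeast 4 (Adj G (ι x))
  vertex-deg≥4 x with proj₁ (proj₂ (proj₂ (proj₂ good))) x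
  ... | e , f , e≢f , x∈e , x∈f with attach⊇ e x x∈e | attach⊇ f x x∈f
  ... | i , _ , p | j , _ , q = AtLeast-⊎ (λ _ → Has⇒adj) (λ _ → Has⇒adj) (λ z a b → e≢f (same a b))
    (subst (λ v → AtLeast 2 (Has e v)) p (brick-at-least (φ-inj e) i (bdeg-≥2 (ty e) i)))
    (subst (λ v → AtLeast 2 (Has f v)) q (brick-at-least (φ-inj f) j (bdeg-≥2 (ty f) j)))

  deg≥4 : ∀ v → AtLeast 4 (Adj G v)
  deg≥4 v with covV v
  ... | e , i , refl with attach? (ty e) i
  ... | yes a = let x , _ , eq = attach⊆ e i a in subst (λ v → AtLeast 4 (Adj G v)) eq (vertex-deg≥4 x)
  ... | no inner = AtLeast-map (λ _ → Has⇒adj)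
    (brick-at-least (φ-inj e) i (subst (4 ≤_) (sym (bdeg-inner (ty e) i inner)) (s≤s (s≤s (s≤s (s≤s z≤n))))))

  within : ∀ e i j → Reach G (φ e i) (φ e j)
  within e i j = reach-map (φ e) (φ-hom e) (brick-connected (ty e) i j)

  between : ∀ e x y → _∈ₕ_ {H} x e → _∈ₕ_ {H} y e → Reach G (ι x) (ι y)
  between e x y x∈e y∈e with attach⊇ e x x∈e | attach⊇ e y y∈e
  ... | i , _ , p | j , _ , q = subst₂ (Reach G) p q (within e i j)

  along : ∀ {x y} → HReach H x y → Reach G (ι x) (ι y)
  along here = here
  along (step e x∈e y∈e r) = reach-trans (between e _ _ x∈e y∈e) (along r)

  connected : Connected G
  connected = ι (proj₁ (proj₂ good)) , walk
    where
    walk : ∀ u v → Reach G u v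
    walk u v with covV u | covV v
    ... | e , i , refl | f , j , refl with attachment (ty e) | attachment (ty f)
    ... | i₀ , a | j₀ , b with attach⊆ e i₀ a | attach⊆ f j₀ b
    ... | x , _ , p | y , _ , q = reach-trans (within e i i₀) (reach-trans
      (subst₂ (Reach G) p q (along (proj₁ (proj₂ (proj₂ good)) x y))) (within f j₀ j))

  k3-all-attach : ∀ t → T (triangular t) → ∀ i → Attach t i
  k3-all-attach k3 _ = k3-attach

  k3-light : ∀ t → T (triangular t) → ¬ T (heavy t)
  k3-light k3 _ ()

  -- By (TB) just one further brick passes through a corner, and it is none of those with degree at
  -- least 3 at an attachment. Both bricks contribute two edges.
  triangle-deg≤4 : ∀ e → T (triangular (ty e)) → ∀ i → Deg≤4 G (φ e i)
  triangle-deg≤4 e tri i with attach⊆ e i (k3-all-attach (ty e) tri i)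
  ... | x , x∈e , eq with proj₁ (tb e (triangular⇒iso (ty e) tri)) x x∈e
  ... | f , (f≢e , x∈f , only) , ¬k5⁻ , ¬k222⁻ , ¬k5 , ¬k222 with attach⊇ f x x∈f
  ... | j , j-att , p = AtMost-⊎ which
        (brick-at-most (φ-inj e) i (bdeg-attach-light (ty e) (k3-light (ty e) tri) i (k3-all-attach (ty e) tri i)))
        (subst (λ v → AtMost 2 (Has f v)) (trans p eq) (brick-at-most (φ-inj f) j (bdeg-attach-light (ty f) light j j-att)))
    where
    light : ¬ T (heavy (ty f))
    light h with heavy-iso (ty f) h
    ... | inj₁ iso = ¬k5⁻ iso
    ... | inj₂ (inj₁ iso) = ¬k222⁻ iso
    ... | inj₂ (inj₂ (inj₁ iso)) = ¬k5 iso
    ... | inj₂ (inj₂ (inj₂ iso)) = ¬k222 iso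
    which : ∀ z → Adj G (φ e i) z → Has e (φ e i) z ⊎ Has f (φ e i) z
    which z iz with covE _ _ iz
    ... | g , has@(k , l , kl , q , _) with g Fin.≟ e
    ... | yes refl = inj₁ has
    ... | no g≢e with attach⊆ g k (proj₁ (shareV g e g≢e k i q))
    ... | x′ , x′∈g , eq′ with ι-inj x′ x (trans eq′ (trans q (sym eq)))
    ... | refl with only g x′∈g
    ... | inj₁ g≡e = ⊥-elim (g≢e g≡e)
    ... | inj₂ refl = inj₂ has

  locally-critical : LocallyCritical G
  locally-critical = record { edge-end = end ; edge-crit = crit }
    where
    end : ∀ {x y} → Adj G x y → Deg≤4 G x ⊎ Deg≤4 G y
    end xy with covE _ _ xy
    ... | e , i , j , ij , refl , refl with T? (triangular (ty e))
    ... | yes tri = inj₁ (triangle-deg≤4 e tri i)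
    ... | no ¬tri with edge-inner-end (ty e) ¬tri i j ij
    ... | inj₁ inner = inj₁ (inner-deg≤4 e i inner)
    ... | inj₂ inner = inj₂ (inner-deg≤4 e j inner)

    contained : ∀ e i j → ¬ Attach (ty e) j → (∀ k → k ≢ i → BAdj (ty e) j k → BAdj (ty e) i k) →
      ∀ z → z ≢ φ e i → Adj G (φ e j) z → Adj G (φ e i) z
    contained e i j inner j⊆i z z≢ jz with inner-full e j inner z jz
    ... | j′ , k , jk , p , refl with φ-inj e j′ j p
    ... | refl = φ-hom e i k (j⊆i k (λ { refl → z≢ refl }) jk)

    crit : ∀ {x y} → Adj G x y → CommonDeg4 G x y ⊎ Twins G x y
    crit xy with covE _ _ xy
    ... | e , i , j , ij , refl , refl with T? (triangular (ty e))
    ... | yes tri with edge-common (ty e) i j ij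
    ... | k , ik , jk = inj₁ (φ e k , triangle-deg≤4 e tri k , φ-hom e i k ik , φ-hom e j k jk)
    crit xy | e , i , j , ij , refl , refl | no ¬tri with edge-inner-common (ty e) ¬tri i j ij
    ... | inj₁ (k , inner , ik , jk) = inj₁ (φ e k , inner-deg≤4 e k inner , φ-hom e i k ik , φ-hom e j k jk)
    ... | inj₂ (i-inner , j-inner , j⊆i , i⊆j) = inj₂
      (inner-deg≤4 e i i-inner , inner-deg≤4 e j j-inner , contained e i j j-inner j⊆i , contained e j i i-inner i⊆j)

  minimal-critical : MinimalCritical G
  minimal-critical = locally-critical⇒minimal-critical G
    ((G-sym , irr) , connected , min-degree-4 G deg≥4) locally-critical

-- Squares of cycles.

module CycleSquare (m : ℕ) where

  n : ℕ
  n = 5 + m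

  C : Graph
  C = CycleSq m

  absorb : ∀ a b → (a % n + b) % n ≡ (a + b) % n
  absorb a b = begin
    (a % n + b) % n         ≡⟨ %-distribˡ-+ (a % n) b n ⟩
    (a % n % n + b % n) % n ≡⟨ cong (λ r → (r + b % n) % n) (m%n%n≡m%n a n) ⟩
    (a % n + b % n) % n     ≡⟨ %-distribˡ-+ a b n ⟨
    (a + b) % n             ∎
    where open ≡-Reasoning

  rot : ℕ → Fin n → Fin n
  rot k i = fromℕ< (m%n<n (toℕ i + k) n)

  toℕ-rot : ∀ k i → toℕ (rot k i) ≡ (toℕ i + k) % n
  toℕ-rot k i = toℕ-fromℕ< _

  rot-rot : ∀ k l i → rot l (rot k i) ≡ rot (k + l) i
  rot-rot k l i = toℕ-injective (begin
    toℕ (rot l (rot k i))     ≡⟨ toℕ-rot l (rot k i) ⟩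
    (toℕ (rot k i) + l) % n   ≡⟨ cong (λ r → (r + l) % n) (toℕ-rot k i) ⟩
    ((toℕ i + k) % n + l) % n ≡⟨ absorb (toℕ i + k) l ⟩
    (toℕ i + k + l) % n       ≡⟨ cong (_% n) (+-assoc (toℕ i) k l) ⟩
    (toℕ i + (k + l)) % n     ≡⟨ toℕ-rot (k + l) i ⟨
    toℕ (rot (k + l) i)       ∎)
    where open ≡-Reasoning

  rot-n : ∀ i → rot n i ≡ i
  rot-n i = toℕ-injective (trans (toℕ-rot n i) (trans ([m+n]%n≡m%n (toℕ i) n) (m<n⇒m%n≡m (toℕ<n i))))

  rot-0 : ∀ i → rot 0 i ≡ i
  rot-0 i = toℕ-injective (trans (toℕ-rot 0 i) (trans (cong (_% n) (+-identityʳ (toℕ i))) (m<n⇒m%n≡m (toℕ<n i))))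

  -- A further rotation by `n ∸ toℕ i` sends `i` to 0, so the shift `k` can be read off modulo `n`.
  -- This gives injectivity in the shift and the length of a walk from `i` to `j`.
  unrotate : ∀ k i → (toℕ i + (k + (n ∸ toℕ i))) % n ≡ k % n
  unrotate k i = begin
    (toℕ i + (k + (n ∸ toℕ i))) % n ≡⟨ cong (_% n) (sym (+-assoc (toℕ i) k _)) ⟩
    (toℕ i + k + (n ∸ toℕ i)) % n   ≡⟨ cong (λ r → (r + (n ∸ toℕ i)) % n) (+-comm (toℕ i) k) ⟩
    (k + toℕ i + (n ∸ toℕ i)) % n   ≡⟨ cong (_% n) (+-assoc k (toℕ i) _) ⟩
    (k + (toℕ i + (n ∸ toℕ i))) % n ≡⟨ cong (λ r → (k + r) % n) (m+[n∸m]≡n (<⇒≤ (toℕ<n i))) ⟩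
    (k + n) % n                     ≡⟨ [m+n]%n≡m%n k n ⟩
    k % n                           ∎
    where open ≡-Reasoning

  rot-injective : ∀ {k l} i → k < n → l < n → rot k i ≡ rot l i → k ≡ l
  rot-injective {k} {l} i k<n l<n eq = begin
    k                                 ≡⟨ m<n⇒m%n≡m k<n ⟨
    k % n                             ≡⟨ back k ⟨
    toℕ (rot (n ∸ toℕ i) (rot k i))   ≡⟨ cong (λ j → toℕ (rot (n ∸ toℕ i) j)) eq ⟩
    toℕ (rot (n ∸ toℕ i) (rot l i))   ≡⟨ back l ⟩
    l % n                             ≡⟨ m<n⇒m%n≡m l<n ⟩
    l                                 ∎
    where
    open ≡-Reasoning
    back : ∀ k → toℕ (rot (n ∸ toℕ i) (rot k i)) ≡ k % n
    back k = trans (cong toℕ (rot-rot k (n ∸ toℕ i) i)) (trans (toℕ-rot _ i) (unrotate k i))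

  to-rot : ∀ k i j → (toℕ i + k) % n ≡ toℕ j → j ≡ rot k i
  to-rot k i j eq = toℕ-injective (trans (sym eq) (sym (toℕ-rot k i)))

  back-rot : ∀ k l {i j} → k + l ≡ n → j ≡ rot k i → i ≡ rot l j
  back-rot k l {i} k+l≡n refl = sym (trans (rot-rot k l i) (trans (cong (λ r → rot r i) k+l≡n) (rot-n i)))

  -- Modulo `n` these are 1, 2, -2 and -1. They differ pairwise because `n` is at least 5.
  offset : Fin 4 → ℕ
  offset zero = 1
  offset (suc zero) = 2
  offset (suc (suc zero)) = 3 + m
  offset (suc (suc (suc zero))) = 4 + m

  offset<n : ∀ o → offset o < n
  offset<n zero = s≤s (s≤s z≤n)
  offset<n (suc zero) = s≤s (s≤s (s≤s z≤n))
  offset<n (suc (suc zero)) = m≤n+m (4 + m) 1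
  offset<n (suc (suc (suc zero))) = ≤-refl

  offset-injective : ∀ o p → offset o ≡ offset p → o ≡ p
  offset-injective zero zero _ = refl
  offset-injective zero (suc zero) ()
  offset-injective zero (suc (suc zero)) ()
  offset-injective zero (suc (suc (suc zero))) ()
  offset-injective (suc zero) (suc zero) _ = refl
  offset-injective (suc zero) (suc (suc zero)) ()
  offset-injective (suc zero) (suc (suc (suc zero))) ()
  offset-injective (suc (suc zero)) (suc (suc zero)) _ = refl
  offset-injective (suc (suc zero)) (suc (suc (suc zero))) eq = ⊥-elim (1+n≢n (sym eq))
  offset-injective (suc (suc (suc zero))) (suc (suc zero)) eq = ⊥-elim (1+n≢n eq)
  offset-injective (suc (suc (suc zero))) (suc (suc (suc zero))) _ = refl

  offset≢0 : ∀ o → offset o ≢ 0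
  offset≢0 zero ()
  offset≢0 (suc zero) ()
  offset≢0 (suc (suc zero)) ()
  offset≢0 (suc (suc (suc zero))) ()

  adj-rot₁ : ∀ i → Adj C i (rot 1 i)
  adj-rot₁ i = inj₁ (sym (toℕ-rot 1 i))

  adj-rot₂ : ∀ i → Adj C i (rot 2 i)
  adj-rot₂ i = inj₂ (inj₁ (sym (toℕ-rot 2 i)))

  C-sym : Symmetric C
  C-sym i j (inj₁ p) = inj₂ (inj₂ (inj₁ p))
  C-sym i j (inj₂ (inj₁ p)) = inj₂ (inj₂ (inj₂ p))
  C-sym i j (inj₂ (inj₂ (inj₁ p))) = inj₁ p
  C-sym i j (inj₂ (inj₂ (inj₂ p))) = inj₂ (inj₁ p)

  adj-offset : ∀ i o → Adj C i (rot (offset o) i)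
  adj-offset i zero = adj-rot₁ i
  adj-offset i (suc zero) = adj-rot₂ i
  adj-offset i (suc (suc zero)) = C-sym _ i (subst (Adj C (rot (3 + m) i))
    (sym (back-rot (3 + m) 2 (+-comm (3 + m) 2) refl)) (adj-rot₂ (rot (3 + m) i)))
  adj-offset i (suc (suc (suc zero))) = C-sym _ i (subst (Adj C (rot (4 + m) i))
    (sym (back-rot (4 + m) 1 (+-comm (4 + m) 1) refl)) (adj-rot₁ (rot (4 + m) i)))

  offset-adj : ∀ i j → Adj C i j → ∃ λ o → j ≡ rot (offset o) i
  offset-adj i j (inj₁ p) = zero , to-rot 1 i j p
  offset-adj i j (inj₂ (inj₁ p)) = suc zero , to-rot 2 i j p
  offset-adj i j (inj₂ (inj₂ (inj₁ p))) = suc (suc (suc zero)) , back-rot 1 (4 + m) refl (to-rot 1 j i p)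
  offset-adj i j (inj₂ (inj₂ (inj₂ p))) = suc (suc zero) , back-rot 2 (3 + m) refl (to-rot 2 j i p)

  deg≤4 : ∀ i → Deg≤4 C i
  deg≤4 i = atMost (λ o → rot (offset o) i) (offset-adj i)

  deg≥4 : ∀ i → AtLeast 4 (Adj C i)
  deg≥4 i = atLeast (λ o → rot (offset o) i)
    (λ o p eq → offset-injective o p (rot-injective i (offset<n o) (offset<n p) eq)) (adj-offset i)

  C-irr : ∀ i → ¬ Adj C i i
  C-irr i ii = let o , eq = offset-adj i i ii in
    offset≢0 o (sym (rot-injective i (s≤s z≤n) (offset<n o) (trans (rot-0 i) eq)))

  C-connected : Connected C
  C-connected = zero , λ i j → subst (Reach C i) (arrive i j) (walk (toℕ j + (n ∸ toℕ i)) i)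
    where
    walk : ∀ k i → Reach C i (rot k i)
    walk zero i = subst (Reach C i) (sym (rot-0 i)) here
    walk (suc k) i = step (adj-rot₁ i) (subst (Reach C (rot 1 i)) (rot-rot 1 k i) (walk k (rot 1 i)))
    arrive : ∀ i j → rot (toℕ j + (n ∸ toℕ i)) i ≡ j
    arrive i j = toℕ-injective (trans (toℕ-rot _ i) (trans (unrotate (toℕ j) i) (m<n⇒m%n≡m (toℕ<n j))))

  -- Three consecutive vertices of the cycle form a triangle, and every edge of the square lies in
  -- such a triangle.
  common : ∀ i j → Adj C i j → ∃ λ k → Adj C i k × Adj C j k
  common i j (inj₁ p) with to-rot 1 i j p
  ... | refl = rot 2 i , adj-rot₂ i , subst (Adj C (rot 1 i)) (rot-rot 1 1 i) (adj-rot₁ (rot 1 i))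
  common i j (inj₂ (inj₁ p)) with to-rot 2 i j p
  ... | refl = rot 1 i , adj-rot₁ i , C-sym _ _ (subst (Adj C (rot 1 i)) (rot-rot 1 1 i) (adj-rot₁ (rot 1 i)))
  common i j (inj₂ (inj₂ (inj₁ p))) = let k , jk , ik = common j i (inj₁ p) in k , ik , jk
  common i j (inj₂ (inj₂ (inj₂ p))) = let k , jk , ik = common j i (inj₂ (inj₁ p)) in k , ik , jk

square-of-cycle⇒minimal-critical : (G : Graph) → SquareOfCycle G → MinimalCritical G
square-of-cycle⇒minimal-critical G (m , φ , adj) = locally-critical⇒minimal-critical G inC record
  { edge-end = λ {x} _ → inj₁ (low x)
  ; edge-crit = λ {x} {y} xy → let k , xk , yk = common (to x) (to y) (hom xy) in
      inj₁ (from k , low (from k) , pull xk , pull yk) }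
  where
  open CycleSquare m
  open Inverse φ
  hom : ∀ {x y} → Adj G x y → Adj C (to x) (to y)
  hom = Equivalence.to (adj _ _)
  pull : ∀ {x k} → Adj C (to x) k → Adj G x (from k)
  pull {x} {k} xk = Equivalence.from (adj x (from k)) (subst (Adj C (to x)) (sym (strictlyInverseˡ k)) xk)
  low : ∀ x → Deg≤4 G x
  low x = AtMost-image from (λ z xz → to z , hom xz , sym (strictlyInverseʳ z)) (deg≤4 (to x))
  inC : InC G
  inC = ((λ x y xy → subst (Adj G y) (strictlyInverseʳ x) (pull (C-sym _ _ (hom xy)))) , λ x xx → C-irr _ (hom xx)) ,
    (from zero , λ x y → subst₂ (Reach G) (strictlyInverseʳ x) (strictlyInverseʳ y)
      (reach-map from (λ i j ij → pull (subst (λ r → Adj C r j) (sym (strictlyInverseˡ i)) ij))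
        (proj₂ C-connected (to x) (to y)))) ,
    min-degree-4 G λ x → AtLeast-image from (from-injective φ) (λ k → pull) (deg≥4 (to x))

-- Finite tables for bricks and for graphs on four vertices.

_∈ᶠ?_ : ∀ {n} (i : Fin n) (is : List (Fin n)) → Dec (i ∈ is)
_∈ᶠ?_ = DecMembership._∈?_ Fin._≟_

_∈ᵖ?_ : ∀ {n} (p : Fin n × Fin n) (ps : List (Fin n × Fin n)) → Dec (p ∈ ps)
_∈ᵖ?_ = DecMembership._∈?_ (≡-dec Fin._≟_ Fin._≟_)

-- Edges and non-edges are listed as pairs i < j. A tip is a pair of vertices of attachment with a
-- common neighbour in the brick.
edges nonEdges tips : ∀ t → List (Fin (size t) × Fin (size t))
edges k5 = (0F , 1F) ∷ (0F , 2F) ∷ (0F , 3F) ∷ (0F , 4F) ∷ (1F , 2F) ∷ (1F , 3F) ∷ (1F , 4F) ∷ (2F , 3F) ∷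
  (2F , 4F) ∷ (3F , 4F) ∷ []
edges k222 = (0F , 2F) ∷ (0F , 3F) ∷ (0F , 4F) ∷ (0F , 5F) ∷ (1F , 2F) ∷ (1F , 3F) ∷ (1F , 4F) ∷
  (1F , 5F) ∷ (2F , 4F) ∷ (2F , 5F) ∷ (3F , 4F) ∷ (3F , 5F) ∷ []
edges k5⁻ = (0F , 1F) ∷ (0F , 3F) ∷ (0F , 4F) ∷ (1F , 2F) ∷ (1F , 3F) ∷ (1F , 4F) ∷ (2F , 3F) ∷ (2F , 4F) ∷
  (3F , 4F) ∷ []
edges k222⁻ = (0F , 3F) ∷ (0F , 4F) ∷ (0F , 5F) ∷ (1F , 2F) ∷ (1F , 3F) ∷ (1F , 4F) ∷ (1F , 5F) ∷
  (2F , 4F) ∷ (2F , 5F) ∷ (3F , 4F) ∷ (3F , 5F) ∷ []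
edges k5▽ = (0F , 1F) ∷ (0F , 3F) ∷ (1F , 2F) ∷ (1F , 3F) ∷ (1F , 4F) ∷ (2F , 3F) ∷ (3F , 4F) ∷ []
edges k222▽ = (0F , 3F) ∷ (0F , 5F) ∷ (1F , 2F) ∷ (1F , 3F) ∷ (1F , 4F) ∷ (1F , 5F) ∷ (2F , 5F) ∷
  (3F , 4F) ∷ (3F , 5F) ∷ []
edges k5▷◁ = (0F , 1F) ∷ (0F , 2F) ∷ (1F , 2F) ∷ (1F , 3F) ∷ (1F , 4F) ∷ (2F , 3F) ∷ (2F , 4F) ∷
  (3F , 4F) ∷ (3F , 5F) ∷ (4F , 5F) ∷ []
edges k222▷◁ = (0F , 2F) ∷ (0F , 4F) ∷ (1F , 2F) ∷ (1F , 3F) ∷ (1F , 4F) ∷ (1F , 5F) ∷ (2F , 4F) ∷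
  (2F , 5F) ∷ (3F , 4F) ∷ (3F , 5F) ∷ (3F , 6F) ∷ (5F , 6F) ∷ []
edges k3 = (0F , 1F) ∷ (0F , 2F) ∷ (1F , 2F) ∷ []

nonEdges k5 = []
nonEdges k222 = (0F , 1F) ∷ (2F , 3F) ∷ (4F , 5F) ∷ []
nonEdges k5⁻ = (0F , 2F) ∷ []
nonEdges k222⁻ = (0F , 1F) ∷ (0F , 2F) ∷ (2F , 3F) ∷ (4F , 5F) ∷ []
nonEdges k5▽ = (0F , 2F) ∷ (0F , 4F) ∷ (2F , 4F) ∷ []
nonEdges k222▽ = (0F , 1F) ∷ (0F , 2F) ∷ (0F , 4F) ∷ (2F , 3F) ∷ (2F , 4F) ∷ (4F , 5F) ∷ []
nonEdges k5▷◁ = (0F , 3F) ∷ (0F , 4F) ∷ (0F , 5F) ∷ (1F , 5F) ∷ (2F , 5F) ∷ []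
nonEdges k222▷◁ = (0F , 1F) ∷ (0F , 3F) ∷ (0F , 5F) ∷ (0F , 6F) ∷ (1F , 6F) ∷ (2F , 3F) ∷ (2F , 6F) ∷
  (4F , 5F) ∷ (4F , 6F) ∷ []
nonEdges k3 = []

tips k5 = []
tips k222 = []
tips k5⁻ = (0F , 2F) ∷ []
tips k222⁻ = (0F , 2F) ∷ []
tips k5▽ = (0F , 2F) ∷ (0F , 4F) ∷ (2F , 4F) ∷ []
tips k222▽ = (0F , 2F) ∷ (0F , 4F) ∷ (2F , 4F) ∷ []
tips k5▷◁ = []
tips k222▷◁ = []
tips k3 = (0F , 1F) ∷ (0F , 2F) ∷ (1F , 2F) ∷ []

inners : ∀ t → List (Fin (size t))
inners k5 = 1F ∷ 2F ∷ 3F ∷ 4F ∷ []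
inners k222 = 1F ∷ 2F ∷ 3F ∷ 4F ∷ 5F ∷ []
inners k5⁻ = 1F ∷ 3F ∷ 4F ∷ []
inners k222⁻ = 1F ∷ 3F ∷ 4F ∷ 5F ∷ []
inners k5▽ = 1F ∷ 3F ∷ []
inners k222▽ = 1F ∷ 3F ∷ 5F ∷ []
inners k5▷◁ = 1F ∷ 2F ∷ 3F ∷ 4F ∷ []
inners k222▷◁ = 1F ∷ 2F ∷ 3F ∷ 4F ∷ 5F ∷ []
inners k3 = []

opaque
  ∈-edges : ∀ t i j → i Fin.< j → BAdj t i j → (i , j) ∈ edges t
  ∈-edges = from-yes (all-types? λ t → all? λ i → all? λ j →
    (i Fin.<? j) →-dec (bAdj? t i j →-dec ((i , j) ∈ᵖ? edges t)))

  ∈-nonEdges : ∀ t i j → i Fin.< j → ¬ BAdj t i j → (i , j) ∈ nonEdges t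
  ∈-nonEdges = from-yes (all-types? λ t → all? λ i → all? λ j →
    (i Fin.<? j) →-dec (¬? (bAdj? t i j) →-dec ((i , j) ∈ᵖ? nonEdges t)))

  ∈-inners : ∀ t i → ¬ Attach t i → i ∈ inners t
  ∈-inners = from-yes (all-types? λ t → all? λ i → ¬? (attach? t i) →-dec (i ∈ᶠ? inners t))

  ∈-tips : ∀ t i j → i Fin.< j → Attach t i → Attach t j → (∃ λ k → BAdj t k i × BAdj t k j) → (i , j) ∈ tips t
  ∈-tips = from-yes (all-types? λ t → all? λ i → all? λ j → (i Fin.<? j) →-dec
    (attach? t i →-dec (attach? t j →-dec
      ((any? λ k → bAdj? t k i ×-dec bAdj? t k j) →-dec ((i , j) ∈ᵖ? tips t)))))

cAdj? : ∀ m i j → Dec (Adj (CycleSq m) i j)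
cAdj? m i j = (_ ℕ.≟ _) ⊎-dec (_ ℕ.≟ _) ⊎-dec (_ ℕ.≟ _) ⊎-dec (_ ℕ.≟ _)

-- Antipodal vertices of the octahedron are opposite on the 6-cycle.
k222-order : Fin 6 → Fin 6
k222-order = Vec.lookup (zero ∷ suc (suc zero) ∷ suc (suc (suc (suc zero))) ∷
  suc zero ∷ suc (suc (suc zero)) ∷ suc (suc (suc (suc (suc zero)))) ∷ [])

opaque
  k5-cyclic : ∀ i j → (Adj (CycleSq 0) i j → BAdj k5 i j) × (BAdj k5 i j → Adj (CycleSq 0) i j)
  k5-cyclic = from-yes (all? λ i → all? λ j →
    (cAdj? 0 i j →-dec bAdj? k5 i j) ×-dec (bAdj? k5 i j →-dec cAdj? 0 i j))

  k222-cyclic : ∀ i j → let k = k222-order i ; l = k222-order j in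
    (Adj (CycleSq 1) i j → BAdj k222 k l) × (BAdj k222 k l → Adj (CycleSq 1) i j)
  k222-cyclic = from-yes (all? λ i → all? λ j → let k = k222-order i ; l = k222-order j in
    (cAdj? 1 i j →-dec bAdj? k222 k l) ×-dec (bAdj? k222 k l →-dec cAdj? 1 i j))

  k222-order-injective : ∀ i j → k222-order i ≡ k222-order j → i ≡ j
  k222-order-injective = from-yes (all? λ i → all? λ j →
    (k222-order i Fin.≟ k222-order j) →-dec (i Fin.≟ j))

  k222-order-surjective : ∀ k → ∃ λ i → k222-order i ≡ k
  k222-order-surjective = from-yes (all? λ k → any? λ i → k222-order i Fin.≟ k)

-- A graph on {0,1,2,3} is the vector of the adjacencies 01, 02, 03, 12, 13, 23. The shapes are K₄, K₄⁻,
-- paw, claw, C₄, P₄ and 2K₂, which up to isomorphism are all such graphs without isolated vertices.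
shape : Fin 7 → Vec Bool 6
shape 0F = true ∷ true ∷ true ∷ true ∷ true ∷ true ∷ []
shape 1F = true ∷ true ∷ true ∷ true ∷ true ∷ false ∷ []
shape 2F = true ∷ true ∷ true ∷ true ∷ false ∷ false ∷ []
shape 3F = true ∷ true ∷ true ∷ false ∷ false ∷ false ∷ []
shape 4F = true ∷ false ∷ true ∷ true ∷ false ∷ true ∷ []
shape 5F = true ∷ false ∷ false ∷ true ∷ false ∷ true ∷ []
shape 6F = true ∷ false ∷ false ∷ false ∷ false ∷ true ∷ []

entry : Vec Bool 6 → Fin 4 → Fin 4 → Bool
entry (p ∷ q ∷ r ∷ s ∷ t ∷ u ∷ []) = λ where
  0F 1F → p ; 1F 0F → p
  0F 2F → q ; 2F 0F → q
  0F 3F → r ; 3F 0F → r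
  1F 2F → s ; 2F 1F → s
  1F 3F → t ; 3F 1F → t
  2F 3F → u ; 3F 2F → u
  _  _  → false

noIsolated : Vec Bool 6 → Bool
noIsolated (p ∷ q ∷ r ∷ s ∷ t ∷ u ∷ []) = (p ∨ q ∨ r) ∧ (p ∨ s ∨ t) ∧ (q ∨ s ∨ u) ∧ (r ∨ t ∨ u)

AllDistinct : {A : Set} → A → A → A → A → Set
AllDistinct i j k l = i ≢ j × i ≢ k × i ≢ l × j ≢ k × j ≢ l × k ≢ l

relabel : Vec Bool 6 → Fin 4 → Fin 4 → Fin 4 → Fin 4 → Vec Bool 6
relabel es i j k l = let e = entry es in e i j ∷ e i k ∷ e i l ∷ e j k ∷ e j l ∷ e k l ∷ []

all-vec? : ∀ n {P : Vec Bool n → Set} → (∀ v → Dec (P v)) → Dec (∀ v → P v)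
all-vec? zero P? = map′ (λ { p [] → p }) (λ p → p []) (P? [])
all-vec? (suc n) P? = map′ (λ { (p , q) (true ∷ v) → p v ; (p , q) (false ∷ v) → q v })
  (λ p → (λ v → p (true ∷ v)) , λ v → p (false ∷ v))
  (all-vec? n (λ v → P? (true ∷ v)) ×-dec all-vec? n (λ v → P? (false ∷ v)))

opaque
  normal-form : ∀ es → T (noIsolated es) → ∃ λ s → ∃ λ i → ∃ λ j → ∃ λ k → ∃ λ l →
    AllDistinct i j k l × relabel es i j k l ≡ shape s
  normal-form = from-yes (all-vec? 6 λ es → T? (noIsolated es) →-dec
    any? λ s → any? λ i → any? λ j → any? λ k → any? λ l →
      (¬? (i Fin.≟ j) ×-dec ¬? (i Fin.≟ k) ×-dec ¬? (i Fin.≟ l) ×-dec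
       ¬? (j Fin.≟ k) ×-dec ¬? (j Fin.≟ l) ×-dec ¬? (k Fin.≟ l)) ×-dec
      VecP.≡-dec Bool._≟_ (relabel es i j k l) (shape s))

some-true : ∀ {a b c} → T a ⊎ T b ⊎ T c → T (a ∨ b ∨ c)
some-true {true} _ = _
some-true {false} {true} _ = _
some-true {false} {false} (inj₂ (inj₂ c)) = c

all-true : ∀ {a b c d} → T a → T b → T c → T d → T (a ∧ b ∧ c ∧ d)
all-true {true} {true} {true} _ _ _ d = d

-- Local conditions from minimal criticality.

module Classification (G : Graph) (fin : Finite (V G)) (mc : MinimalCritical G) where

  G-sym : Symmetric G
  G-sym = proj₁ (proj₁ (proj₁ mc))

  G-irr : ∀ x → ¬ Adj G x x
  G-irr = proj₂ (proj₁ (proj₁ mc))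

  con : Connected G
  con = proj₁ (proj₂ (proj₁ mc))

  deg≥4 : ∀ x → AtLeast 4 (Adj G x)
  deg≥4 = at-least-4 G (proj₂ (proj₂ (proj₁ mc)))

  infix 4 _≟_
  _≟_ : DecidableEquality (V G)
  _≟_ = finite-≟ fin

  opaque
    adj? : ∀ x y → Dec (Adj G x y)
    adj? = DecideAdj.essential⇒decidable G fin G-irr G-sym con (proj₂ (proj₂ (proj₁ mc))) λ e → proj₁ (proj₂ mc e)

  opaque
    deg? : ∀ x → Deg≤4 G x ⊎ Deg≥5 G x
    deg? x with search fin (λ z → adj? x z ×-dec ¬? (any? λ i → z ≟ pick (deg≥4 x) i))
    ... | yes (z , xz , new) =
      inj₂ (AtLeast-add z xz (atLeast (pick (deg≥4 x)) (pick-inj (deg≥4 x)) λ i →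
        pick-holds (deg≥4 x) i , λ eq → new (i , sym eq)))
    ... | no none = inj₁ (atMost (pick (deg≥4 x)) λ z xz →
      decidable-stable (any? λ i → z ≟ pick (deg≥4 x) i) λ new → none (z , xz , new))

  high⇒¬low : ∀ {x} → Deg≥5 G x → ¬ Deg≤4 G x
  high⇒¬low hi lo = 1+n≰n (AtLeast⇒≤ hi lo)

  opaque
    deg≤4? : ∀ x → Dec (Deg≤4 G x)
    deg≤4? x with deg? x
    ... | inj₁ lo = yes lo
    ... | inj₂ hi = no (high⇒¬low hi)

  opaque
    ⊆-dec : ∀ x y → Dec (∀ z → z ≢ x → Adj G y z → Adj G x z)
    ⊆-dec x y = universal fin λ z → ¬? (z ≟ x) →-dec (adj? y z →-dec adj? x z)

  module Contract (u v : V G) (uv : Adj G u v) where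

    G/e : Graph
    G/e = contractEdge G (u , v , uv)

    u≢v : u ≢ v
    u≢v refl = G-irr u uv

    rep : V G → V G/e
    rep x with x ≟ v
    ... | yes _ = u , u≢v
    ... | no x≢v = x , x≢v

    rep-id : ∀ a → rep (proj₁ a) ≡ a
    rep-id (x , x≢v) with x ≟ v
    ... | yes eq = ⊥-elim (x≢v eq)
    ... | no _ = refl

    rep-step : ∀ {x y} → Adj G x y → rep x ≡ rep y ⊎ Adj G/e (rep x) (rep y)
    rep-step {x} {y} xy with x ≟ v | y ≟ v
    ... | yes refl | yes refl = inj₁ refl
    ... | yes refl | no y≢v with u ≟ y
    ... | yes refl = inj₁ refl
    ... | no u≢y = inj₂ (u≢y , x , y , xy , inj₂ (refl , refl) , inj₁ refl)
    rep-step {x} {y} xy | no x≢v | yes refl with x ≟ u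
    ... | yes refl = inj₁ refl
    ... | no x≢u = inj₂ (x≢u , x , y , xy , inj₁ refl , inj₂ (refl , refl))
    rep-step {x} {y} xy | no x≢v | no y≢v =
      inj₂ ((λ { refl → G-irr x xy }) , x , y , xy , inj₁ refl , inj₁ refl)

    rep-walk : ∀ {x y} → Reach G x y → Reach G/e (rep x) (rep y)
    rep-walk here = here
    rep-walk (step xy r) with rep-step xy
    ... | inj₁ eq = subst (λ a → Reach G/e a _) (sym eq) (rep-walk r)
    ... | inj₂ a = step a (rep-walk r)

    connected : Connected G/e
    connected = (u , u≢v) , λ a b →
      subst (λ a → Reach G/e a b) (rep-id a) (subst (Reach G/e (rep (proj₁ a))) (rep-id b)
        (rep-walk (proj₂ con (proj₁ a) (proj₁ b))))

    simple : Simple G/e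
    simple = (λ a b (a≢b , x , y , xy , p , q) → (a≢b ∘ sym) , y , x , G-sym x y xy , q , p) ,
             λ a (a≢a , _) → a≢a refl

    lift : ∀ {k} {P : V G → Set} a → (∀ z → P z → z ≢ v) →
      (∀ b → P (proj₁ b) → Adj G/e a b) → AtLeast k P → AtLeast k (Adj G/e a)
    lift a ≢v h (atLeast f inj p) = atLeast
      (λ i → f i , ≢v (f i) (p i)) (λ i j eq → inj i j (cong proj₁ eq)) λ i → h (f i , ≢v (f i) (p i)) (p i)

    merged : ∀ a → proj₁ a ≡ u → ∀ b → proj₁ b ≢ u → Adj G u (proj₁ b) ⊎ Adj G v (proj₁ b) → Adj G/e a b
    merged a refl b b≢u (inj₁ ub) = (b≢u ∘ sym) , u , _ , ub , inj₁ refl , inj₁ refl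
    merged a refl b b≢u (inj₂ vb) = (b≢u ∘ sym) , v , _ , vb , inj₂ (refl , refl) , inj₁ refl

    kept : ∀ a b → Adj G (proj₁ a) (proj₁ b) → Adj G/e a b
    kept a b ab = (λ eq → G-irr _ (subst (Adj G _) (sym eq) ab)) , _ , _ , ab , inj₁ refl , inj₁ refl

    via-v : ∀ a b → Adj G (proj₁ a) v → proj₁ a ≢ u → proj₁ b ≡ u → Adj G/e a b
    via-v a b av a≢u refl = a≢u , _ , v , av , inj₁ refl , inj₂ (refl , refl)

    module _ (none : ¬ CommonDeg4 G u v) where

      -- Only a vertex adjacent to both ends loses a neighbour in the contraction, and by `none`
      -- such a vertex has degree at least 5.
      degree-other : ∀ a → proj₁ a ≢ u → AtLeast 4 (Adj G/e a)
      degree-other a@(x , x≢v) x≢u with deg? x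
      ... | inj₂ hi = lift a (λ _ → proj₂) (λ b p → kept a b (proj₁ p)) (AtLeast-remove _≟_ v hi)
      ... | inj₁ lo with adj? x v
      ... | no ¬xv = lift a (λ { z xz refl → ¬xv xz }) (kept a) (deg≥4 x)
      ... | yes xv = lift {P = λ z → z ≡ u ⊎ Adj G x z × z ≢ v} a
        (λ { z (inj₁ refl) → u≢v ; z (inj₂ (_ , z≢v)) → z≢v })
        (λ { b (inj₁ eq) → via-v a b xv x≢u eq ; b (inj₂ (xb , _)) → kept a b xb })
        (AtLeast-add u (inj₁ refl) (AtLeast-map
          (λ { z p@(xz , _) → inj₂ p , λ { refl → none (x , lo , G-sym x u xz , G-sym x v xv) } })
          (AtLeast-remove _≟_ v (deg≥4 x))))

      -- An end of degree at least 5 keeps four neighbours. If both ends have degree 4 and are not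
      -- twins, a neighbour of one that the other lacks joins the three remaining neighbours of the
      -- other.
      degree-merged : ¬ Twins G u v → ∀ a → proj₁ a ≡ u → AtLeast 4 (Adj G/e a)
      degree-merged ¬tw a refl with deg? u | deg? v
      ... | inj₂ hi | _ = lift a (λ _ → proj₂)
        (λ b (ub , _) → merged a refl b (λ { refl → G-irr u ub }) (inj₁ ub)) (AtLeast-remove _≟_ v hi)
      ... | inj₁ _ | inj₂ hi = lift a (λ { z (vz , _) refl → G-irr v vz })
        (λ b (vb , b≢u) → merged a refl b b≢u (inj₂ vb)) (AtLeast-remove _≟_ u hi)
      ... | inj₁ lo | inj₁ lo′ with search fin (λ z → ¬? (z ≟ u) ×-dec adj? v z ×-dec ¬? (adj? u z))
      ... | yes (z , z≢u , vz , ¬uz) = lift {P = λ w → w ≢ u × w ≢ v × (Adj G u w ⊎ Adj G v w)} a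
        (λ _ (_ , p , _) → p) (λ b (b≢u , _ , p) → merged a refl b b≢u p)
        (AtLeast-add z (z≢u , (λ { refl → G-irr v vz }) , inj₂ vz) (AtLeast-map
          (λ w (uw , w≢v) → ((λ { refl → G-irr u uw }) , w≢v , inj₁ uw) , λ { refl → ¬uz uw })
          (AtLeast-remove _≟_ v (deg≥4 u))))
      ... | no v⊆u with search fin (λ z → ¬? (z ≟ v) ×-dec adj? u z ×-dec ¬? (adj? v z))
      ... | yes (z , z≢v , uz , ¬vz) = lift {P = λ w → w ≢ u × w ≢ v × (Adj G u w ⊎ Adj G v w)} a
        (λ _ (_ , p , _) → p) (λ b (b≢u , _ , p) → merged a refl b b≢u p)
        (AtLeast-add z ((λ { refl → G-irr u uz }) , z≢v , inj₁ uz) (AtLeast-map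
          (λ w (vw , w≢u) → (w≢u , (λ { refl → G-irr v vw }) , inj₂ vw) , λ { refl → ¬vz vw })
          (AtLeast-remove _≟_ u (deg≥4 v))))
      ... | no u⊆v = ⊥-elim (¬tw (lo , lo′ ,
        (λ z z≢u vz → decidable-stable (adj? u z) λ ¬uz → v⊆u (z , z≢u , vz , ¬uz)) ,
        λ z z≢v uz → decidable-stable (adj? v z) λ ¬vz → u⊆v (z , z≢v , uz , ¬vz)))

      contraction-in-class : ¬ Twins G u v → InC G/e
      contraction-in-class ¬tw = simple , connected , min-degree-4 G/e min-deg
        where
        min-deg : ∀ a → AtLeast 4 (Adj G/e a)
        min-deg a with proj₁ a ≟ u
        ... | yes eq = degree-merged ¬tw a eq
        ... | no neq = degree-other a neq

  opaque
    edge-crit : ∀ {x y} → Adj G x y → CommonDeg4 G x y ⊎ Twins G x y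
    edge-crit {x} {y} xy
      with search fin (λ w → deg≤4? w ×-dec adj? x w ×-dec adj? y w)
         | deg≤4? x ×-dec deg≤4? y ×-dec ⊆-dec x y ×-dec ⊆-dec y x
    ... | yes c | _ = inj₁ c
    ... | no _ | yes tw = inj₂ tw
    ... | no ¬c | no ¬tw = ⊥-elim (proj₂ (proj₂ mc (x , y , xy)) (Contract.contraction-in-class x y xy ¬c ¬tw))

  -- Passages along the deleted edge are rerouted through `w`, and ends of degree at least 5 can
  -- afford the loss.
  deletion-in-class : ∀ {x y w} (xy : Adj G x y) → Adj G x w → Adj G y w →
    Deg≥5 G x → Deg≥5 G y → InC (deleteEdge G (x , y , xy))
  deletion-in-class {x} {y} {w} xy xw yw x-hi y-hi =
    ((λ a b (ab , p , q) → G-sym a b ab , (λ (r , s) → q (s , r)) , λ (r , s) → p (s , r)) , λ a (aa , _) → G-irr a aa) ,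
    (proj₁ con , λ a b → detour (proj₂ con a b)) , min-degree-4 G-e min-deg
    where
    G-e : Graph
    G-e = deleteEdge G (x , y , xy)
    w≢x : w ≢ x
    w≢x refl = G-irr w xw
    w≢y : w ≢ y
    w≢y refl = G-irr w yw
    detour : ∀ {a b} → Reach G a b → Reach G-e a b
    detour here = here
    detour (step {a} {b} ab r) with (a ≟ x ×-dec b ≟ y) | (a ≟ y ×-dec b ≟ x)
    ... | yes (refl , refl) | _ =
      step (xw , (λ (_ , q) → w≢y q) , λ (_ , q) → w≢x q)
        (step (G-sym y w yw , (λ (q , _) → w≢x q) , λ (q , _) → w≢y q) (detour r))
    ... | no _ | yes (refl , refl) =
      step (yw , (λ (_ , q) → w≢y q) , λ (_ , q) → w≢x q)
        (step (G-sym x w xw , (λ (q , _) → w≢x q) , λ (q , _) → w≢y q) (detour r))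
    ... | no p | no q = step (ab , p , q) (detour r)
    x≢y : x ≢ y
    x≢y refl = G-irr x xy
    min-deg : ∀ a → AtLeast 4 (Adj G-e a)
    min-deg a with a ≟ x | a ≟ y
    ... | yes refl | _ = AtLeast-map
      (λ z (az , z≢y) → az , (λ (_ , q) → z≢y q) , λ (q , _) → x≢y q) (AtLeast-remove _≟_ y x-hi)
    ... | no _ | yes refl = AtLeast-map
      (λ z (az , z≢x) → az , (λ (q , _) → x≢y (sym q)) , λ (_ , q) → z≢x q) (AtLeast-remove _≟_ x y-hi)
    ... | no a≢x | no a≢y = AtLeast-map
      (λ z az → az , (λ (q , _) → a≢x q) , λ (q , _) → a≢y q) (deg≥4 a)

  opaque
    edge-end : ∀ {x y} → Adj G x y → Deg≤4 G x ⊎ Deg≤4 G y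
    edge-end {x} {y} xy with deg? x | deg? y | edge-crit xy
    ... | inj₁ lo | _ | _ = inj₁ lo
    ... | inj₂ _ | inj₁ lo | _ = inj₂ lo
    ... | inj₂ hi | inj₂ hi′ | inj₁ (w , _ , xw , yw) =
      ⊥-elim (proj₁ (proj₂ mc (x , y , xy)) (deletion-in-class xy xw yw hi hi′))
    ... | inj₂ hi | inj₂ _ | inj₂ (lo , _) = ⊥-elim (high⇒¬low hi lo)

  -- Recognising squares of cycles and bricks inside the graph.

  module CycleIso (m : ℕ) (φ : Fin (5 + m) → V G) (φ-inj : ∀ i j → φ i ≡ φ j → i ≡ j)
    (φ-hom : ∀ i j → Adj (CycleSq m) i j → Adj G (φ i) (φ j))
    (φ-full : ∀ i z → Adj G (φ i) z → ∃ λ j → Adj (CycleSq m) i j × φ j ≡ z) where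

    -- The image of `φ` is closed under adjacency by `φ-full`, so connectedness makes it the whole
    -- graph.
    on-cycle : ∀ {u v} → Reach G u v → (∃ λ i → φ i ≡ u) → ∃ λ i → φ i ≡ v
    on-cycle here p = p
    on-cycle (step uw r) (i , refl) = let j , _ , eq = φ-full i _ uw in on-cycle r (j , eq)

    position : ∀ v → ∃ λ i → φ i ≡ v
    position v = on-cycle (proj₂ con (φ zero) v) (zero , refl)

    cycle-iso : SquareOfCycle G
    cycle-iso = m ,
      mk↔ₛ′ (λ v → proj₁ (position v)) φ (λ i → φ-inj _ _ (proj₂ (position (φ i)))) (λ v → proj₂ (position v)) ,
      λ x y → mk⇔ (push x y) λ ij → subst₂ (Adj G) (proj₂ (position x)) (proj₂ (position y)) (φ-hom _ _ ij)
      where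
      push : ∀ x y → Adj G x y → Adj (CycleSq m) (proj₁ (position x)) (proj₁ (position y))
      push x y xy with φ-full (proj₁ (position x)) y (subst (λ v → Adj G v y) (sym (proj₂ (position x))) xy)
      ... | j , ij , eq with φ-inj j (proj₁ (position y)) (trans eq (sym (proj₂ (position y))))
      ... | refl = ij

  open CycleIso public using (cycle-iso)

  -- For non-edges distinctness suffices, except at tips: an inner end has all its four neighbours
  -- in the brick already, and the two attachments of a bow-tie may well be adjacent through another
  -- brick.
  record BrickData (t : BrickType) (φ : Fin (size t) → V G) : Set where
    field
      at-edges    : All (λ (i , j) → Adj G (φ i) (φ j)) (edges t)
      at-nonEdges : All (λ (i , j) → φ i ≢ φ j) (nonEdges t)
      at-inner    : All (λ i → Deg≤4 G (φ i)) (inners t)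
      at-tips     : All (λ (i , j) → ¬ Adj G (φ i) (φ j)) (tips t)

  Covers : Placed G → V G → Set
  Covers P v = ∀ y → Adj G v y → Placed.Has P v y

  Outcome : V G → Set
  Outcome v = SquareOfCycle G ⊎ Σ (Placed G) λ P → Covers P v

  module Placement (t : BrickType) (¬tri : ¬ T (triangular t)) (φ : Fin (size t) → V G) (bd : BrickData t φ) where
    open BrickData bd

    hom : ∀ i j → BAdj t i j → Adj G (φ i) (φ j)
    hom i j ij with <-cmp i j
    ... | tri< i<j _ _ = All.lookup at-edges (∈-edges t i j i<j ij)
    ... | tri≈ _ refl _ = ⊥-elim (BAdj-irr t i ij)
    ... | tri> _ _ j<i = G-sym _ _ (All.lookup at-edges (∈-edges t j i j<i (BAdj-sym t i j ij)))

    inj : ∀ i j → φ i ≡ φ j → i ≡ j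
    inj i j eq with bAdj? t i j | <-cmp i j
    ... | yes ij | _ = ⊥-elim (G-irr _ (subst (Adj G (φ i)) (sym eq) (hom i j ij)))
    ... | no ¬ij | tri< i<j _ _ = ⊥-elim (All.lookup at-nonEdges (∈-nonEdges t i j i<j ¬ij) eq)
    ... | no _ | tri≈ _ i≡j _ = i≡j
    ... | no ¬ij | tri> _ _ j<i =
      ⊥-elim (All.lookup at-nonEdges (∈-nonEdges t j i j<i (¬ij ∘ BAdj-sym t j i)) (sym eq))

    inner-low : ∀ i → ¬ Attach t i → Deg≤4 G (φ i)
    inner-low i inner = All.lookup at-inner (∈-inners t i inner)

    Has : V G → V G → Set
    Has = BrickEdge t φ

    Has⇒adj : ∀ {x y} → Has x y → Adj G x y
    Has⇒adj (i , j , ij , refl , refl) = hom i j ij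

    has? : ∀ x y → Dec (Has x y)
    has? = brickEdge? _≟_ t φ

    full : ∀ i → bdeg t i ≡ 4 → Deg≤4 G (φ i) → ∀ z → Adj G (φ i) z → Has (φ i) z
    full i deg low z iz = let k , eq = covers _≟_ low (AtLeast-map (λ _ → Has⇒adj) four) z iz in
      subst (Has (φ i)) (sym eq) (pick-holds four k)
      where
      four : AtLeast 4 (Has (φ i))
      four = brick-at-least inj i (≤-reflexive (sym deg))

    inner-full : ∀ i → ¬ Attach t i → ∀ z → Adj G (φ i) z → Has (φ i) z
    inner-full i inner = full i (bdeg-inner t i inner) (inner-low i inner)

    tip-nonadjacent : ∀ {i j k} → Attach t i → Attach t k → BAdj t j i → BAdj t j k → ¬ Adj G (φ i) (φ k)
    tip-nonadjacent {i} {j} {k} a b ji jk ik with <-cmp i k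
    ... | tri< i<k _ _ = All.lookup at-tips (∈-tips t i k i<k a b (j , ji , jk)) ik
    ... | tri≈ _ refl _ = G-irr _ ik
    ... | tri> _ _ k<i = All.lookup at-tips (∈-tips t k i k<i b a (j , jk , ji)) (G-sym _ _ ik)

    -- If `x` is an attachment then `y` is inner, so `z` lies in the brick. If `z` were an
    -- attachment too, `x` and `z` would be adjacent tips; hence `z` is inner and the edge `x z`
    -- belongs to the brick.
    tri-closed : ∀ {x y z} → Has x y → Adj G x z → Adj G y z → Has x z
    tri-closed (i , j , ij , refl , refl) xz yz with attach? t i
    ... | no inner = inner-full i inner _ xz
    ... | yes a with edge-inner-end t ¬tri i j ij
    ... | inj₁ inner = inner-full i inner _ xz
    ... | inj₂ inner with brick-neighbour inj j (inner-full j inner _ yz)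
    ... | k , jk , refl with attach? t k
    ... | yes b = ⊥-elim (tip-nonadjacent a b (BAdj-sym t i j ij) jk xz)
    ... | no inner′ with brick-neighbour inj k (inner-full k inner′ _ (G-sym _ _ xz))
    ... | l , kl , eq with inj i l eq
    ... | refl = i , k , BAdj-sym t k i kl , refl , refl

    -- A whole brick uses four edges at its attachment, so leaving it requires degree at least 5
    -- there. In other bricks attachments have degree below 4 and the minimum degree provides the
    -- exit.
    place : (T (whole t) → ∀ i → Attach t i → Deg≥5 G (φ i)) → Placed G
    place high = record
      { type = t ; at = φ ; at-inj = inj ; at-hom = hom
      ; inner-full = inner-full
      ; attach-exit = exit
      ; tri-closed = tri-closed
      ; k3-split = λ tri → ⊥-elim (¬tri tri) }
      where
      exit : ∀ i → Attach t i → ∃ λ z → Adj G (φ i) z × ¬ Has (φ i) z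
      exit i a with T? (whole t)
      ... | yes w = escape _≟_ (has? (φ i)) (high w i a) (brick-at-most inj i (bdeg-whole t w i)) ≤-refl
      ... | no ¬w = escape _≟_ (has? (φ i)) (deg≥4 (φ i)) (brick-at-most inj i refl) (bdeg-attach-<4 t ¬w i a)

    closed⇒cycle : T (whole t) → (∀ i → Deg≤4 G (φ i)) → SquareOfCycle G
    closed⇒cycle w low = by-type t refl
      where
      by-type : ∀ s → s ≡ t → SquareOfCycle G
      by-type k5 refl = cycle-iso 0 φ inj (λ i j ij → hom i j (proj₁ (k5-cyclic i j) ij)) λ i z iz →
        let j , ij , eq = brick-neighbour {t = k5} inj i (full i (bdeg-whole t w i) (low i) z iz) in
        j , proj₂ (k5-cyclic i j) ij , sym eq
      by-type k222 refl = cycle-iso 1 (φ ∘ k222-order) (λ i j eq → k222-order-injective i j (inj _ _ eq))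
        (λ i j ij → hom _ _ (proj₁ (k222-cyclic i j) ij)) around
        where
        around : ∀ i z → Adj G (φ (k222-order i)) z → ∃ λ j → Adj (CycleSq 1) i j × φ (k222-order j) ≡ z
        around i z iz with brick-neighbour {t = k222} inj (k222-order i) (full (k222-order i) (bdeg-whole t w (k222-order i)) (low _) z iz)
        ... | k , ik , eq with k222-order-surjective k
        ... | j , refl = j , proj₂ (k222-cyclic i j) ik , sym eq
      by-type k5⁻ refl = ⊥-elim w
      by-type k222⁻ refl = ⊥-elim w
      by-type k5▽ refl = ⊥-elim w
      by-type k222▽ refl = ⊥-elim w
      by-type k5▷◁ refl = ⊥-elim w
      by-type k222▷◁ refl = ⊥-elim w
      by-type k3 refl = ⊥-elim w

    -- If the attachment of K₅ or of the octahedron has degree 4, no edge leaves the brick, which is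
    -- then the whole graph and the square of a cycle. The vertex `i` must be inner for all its
    -- edges to be covered.
    build : ∀ i → {False (attach? t i)} → Outcome (φ i)
    build i {inner} with T? (whole t)
    ... | no ¬w = inj₂ (place (λ w → ⊥-elim (¬w w)) , inner-full i (toWitnessFalse inner))
    ... | yes w with attachment t
    ... | r , a with deg? (φ r)
    ... | inj₂ hi = inj₂ (place (λ _ i b → subst (λ i → Deg≥5 G (φ i)) (whole-attachment-unique t w r i a b) hi) ,
      inner-full i (toWitnessFalse inner))
    ... | inj₁ lo = inj₁ (closed⇒cycle w low)
      where
      low : ∀ i → Deg≤4 G (φ i)
      low i with attach? t i
      ... | yes b = subst (λ i → Deg≤4 G (φ i)) (whole-attachment-unique t w r i a b) lo
      ... | no inner = inner-low i inner

  open Placement public using (build)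

  infix 4 _∼_ _≁_
  _∼_ _≁_ : V G → V G → Set
  _∼_ = Adj G
  x ≁ y = ¬ Adj G x y

  low : V G → Set
  low = Deg≤4 G

  ∼-sym : ∀ {x y} → x ∼ y → y ∼ x
  ∼-sym = G-sym _ _

  ≁-sym : ∀ {x y} → x ≁ y → y ≁ x
  ≁-sym n = n ∘ ∼-sym

  ∼⇒≢ : ∀ {x y} → x ∼ y → x ≢ y
  ∼⇒≢ xy refl = G-irr _ xy

  separate : ∀ {x y z} → z ∼ x → z ≁ y → x ≢ y
  separate zx zy refl = zy zx

  opaque
    other-low : ∀ {x y} → x ∼ y → Deg≥5 G x → low y
    other-low xy hi with edge-end xy
    ... | inj₁ lo = ⊥-elim (high⇒¬low hi lo)
    ... | inj₂ lo = lo

  opaque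
    low-unless-high : ∀ {x} → (Deg≥5 G x → ⊥) → low x
    low-unless-high {x} ¬hi with deg? x
    ... | inj₁ lo = lo
    ... | inj₂ hi = ⊥-elim (¬hi hi)

  -- Links of vertices of degree four

  record N4 (v a b c d : V G) : Set where
    constructor n4
    field
      v-low : low v
      va    : v ∼ a
      vb    : v ∼ b
      vc    : v ∼ c
      vd    : v ∼ d
      distinct : AllDistinct a b c d

    a≢b : a ≢ b
    a≢b = proj₁ distinct
    a≢c : a ≢ c
    a≢c = proj₁ (proj₂ distinct)
    a≢d : a ≢ d
    a≢d = proj₁ (proj₂ (proj₂ distinct))
    b≢c : b ≢ c
    b≢c = proj₁ (proj₂ (proj₂ (proj₂ distinct)))
    b≢d : b ≢ d
    b≢d = proj₁ (proj₂ (proj₂ (proj₂ (proj₂ distinct))))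
    c≢d : c ≢ d
    c≢d = proj₂ (proj₂ (proj₂ (proj₂ (proj₂ distinct))))

    four : AtLeast 4 (v ∼_)
    four = AtLeast-add a va (AtLeast-add b (vb , a≢b ∘ sym) (AtLeast-add c ((vc , a≢c ∘ sym) , b≢c ∘ sym)
      (AtLeast-add d (((vd , a≢d ∘ sym) , b≢d ∘ sym) , c≢d ∘ sym) (atLeast (λ ()) (λ ()) (λ ())))))

    only : ∀ {z} → v ∼ z → z ≡ a ⊎ z ≡ b ⊎ z ≡ c ⊎ z ≡ d
    only vz with covers _≟_ v-low four _ vz
    ... | 0F , eq = inj₁ eq
    ... | 1F , eq = inj₂ (inj₁ eq)
    ... | 2F , eq = inj₂ (inj₂ (inj₁ eq))
    ... | 3F , eq = inj₂ (inj₂ (inj₂ eq))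

    no-other : ∀ {z} → z ≢ a → z ≢ b → z ≢ c → z ≢ d → v ≁ z
    no-other p q r s vz with only vz
    ... | inj₁ eq = p eq
    ... | inj₂ (inj₁ eq) = q eq
    ... | inj₂ (inj₂ (inj₁ eq)) = r eq
    ... | inj₂ (inj₂ (inj₂ eq)) = s eq

  swap₁₂ : ∀ {v a b c d} → N4 v a b c d → N4 v b a c d
  swap₁₂ (n4 l va vb vc vd (p , q , r , s , t , u)) = n4 l vb va vc vd (p ∘ sym , s , t , q , r , u)

  swap₂₃ : ∀ {v a b c d} → N4 v a b c d → N4 v a c b d
  swap₂₃ (n4 l va vb vc vd (p , q , r , s , t , u)) = n4 l va vc vb vd (q , p , r , s ∘ sym , u , t)

  swap₃₄ : ∀ {v a b c d} → N4 v a b c d → N4 v a b d c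
  swap₃₄ (n4 l va vb vc vd (p , q , r , s , t , u)) = n4 l va vb vd vc (p , r , q , t , s , u ∘ sym)

  rotate : ∀ {v a b c d} → N4 v a b c d → N4 v b c d a
  rotate = swap₃₄ ∘ swap₂₃ ∘ swap₁₂

  opaque
    fourth : ∀ x p q r → ∃ λ s → x ∼ s × s ≢ p × s ≢ q × s ≢ r
    fourth x p q r =
      let one = AtLeast-remove _≟_ r (AtLeast-remove _≟_ q (AtLeast-remove _≟_ p (deg≥4 x)))
          ((xs , s≢p) , s≢q) , s≢r = pick-holds one zero
      in pick one zero , xs , s≢p , s≢q , s≢r

  opaque
    extend : ∀ {x p q r} → low x → x ∼ p → x ∼ q → x ∼ r → p ≢ q → p ≢ r → q ≢ r → ∃ λ s → N4 x p q r s
    extend {x} {p} {q} {r} lo xp xq xr p≢q p≢r q≢r =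
      let s , xs , s≢p , s≢q , s≢r = fourth x p q r in
      s , n4 lo xp xq xr xs (p≢q , p≢r , s≢p ∘ sym , q≢r , s≢q ∘ sym , s≢r ∘ sym)

  opaque
    -- (E2) for the edge `x s`: a common neighbour of degree 4 is one of the other three neighbours
    -- of `x`, while a twin `s` is adjacent to all three.
    crit4 : ∀ {x p q r s} → N4 x p q r s →
      (low p × p ∼ s) ⊎ (low q × q ∼ s) ⊎ (low r × r ∼ s) ⊎ (p ∼ s × q ∼ s × r ∼ s)
    crit4 n with edge-crit (N4.vd n)
    ... | inj₂ (_ , _ , _ , x⊆s) = inj₂ (inj₂ (inj₂
      (∼-sym (x⊆s _ (N4.a≢d n) (N4.va n)) , ∼-sym (x⊆s _ (N4.b≢d n) (N4.vb n)) , ∼-sym (x⊆s _ (N4.c≢d n) (N4.vc n)))))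
    ... | inj₁ (w , lo , xw , sw) with N4.only n xw
    ... | inj₁ refl = inj₁ (lo , ∼-sym sw)
    ... | inj₂ (inj₁ refl) = inj₂ (inj₁ (lo , ∼-sym sw))
    ... | inj₂ (inj₂ (inj₁ refl)) = inj₂ (inj₂ (inj₁ (lo , ∼-sym sw)))
    ... | inj₂ (inj₂ (inj₂ refl)) = ⊥-elim (G-irr _ sw)

  opaque
    crit-1 : ∀ {x p q r s} → N4 x p q r s → q ≁ s → r ≁ s → low p × p ∼ s
    crit-1 n ¬q ¬r with crit4 n
    ... | inj₁ l = l
    ... | inj₂ (inj₁ (_ , q)) = ⊥-elim (¬q q)
    ... | inj₂ (inj₂ (inj₁ (_ , r))) = ⊥-elim (¬r r)
    ... | inj₂ (inj₂ (inj₂ (_ , q , _))) = ⊥-elim (¬q q)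

  -- Links that determine the brick at once: K₄, K₄⁻, claw, paw and C₄.

  clique : ∀ {v a b c d} → N4 v a b c d → a ∼ b → a ∼ c → a ∼ d → b ∼ c → b ∼ d → c ∼ d →
    low b → low c → low d → Outcome v
  clique {v} {a} {b} {c} {d} n ab ac ad bc bd cd lb lc ld =
    build k5 (λ ()) (Vec.lookup (a ∷ v ∷ b ∷ c ∷ d ∷ [])) (record
      { at-edges = ∼-sym va ∷ ab ∷ ac ∷ ad ∷ vb ∷ vc ∷ vd ∷ bc ∷ bd ∷ cd ∷ []
      ; at-nonEdges = []
      ; at-inner = v-low ∷ lb ∷ lc ∷ ld ∷ []
      ; at-tips = [] }) 1F
    where open N4 n

  opaque
    -- By (E1) at most one vertex of the clique has degree at least 5; it is taken as attachment. If
    -- `a`, `b`, `c` all have degree 4, the attachment is `d`, whatever its degree.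
    link-K4 : ∀ {v a b c d} → N4 v a b c d → a ∼ b → a ∼ c → a ∼ d → b ∼ c → b ∼ d → c ∼ d → Outcome v
    link-K4 {v} {a} {b} {c} {d} n ab ac ad bc bd cd with deg? a | deg? b | deg? c
    ... | inj₂ hi | _ | _ = clique n ab ac ad bc bd cd (other-low ab hi) (other-low ac hi) (other-low ad hi)
    ... | inj₁ la | inj₂ hi | _ =
      clique (swap₁₂ n) (∼-sym ab) bc bd ac ad cd la (other-low bc hi) (other-low bd hi)
    ... | inj₁ la | inj₁ lb | inj₂ hi =
      clique (swap₁₂ (swap₂₃ n)) (∼-sym ac) (∼-sym bc) cd ab ad bd la lb (other-low cd hi)
    ... | inj₁ la | inj₁ lb | inj₁ lc =
      clique (swap₁₂ (swap₂₃ (swap₃₄ n))) (∼-sym ad) (∼-sym bd) (∼-sym cd) ab ac bc la lb lc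

  opaque
    -- Otherwise (E1) gives `b` and `c` degree 4. Let `e` be the fourth neighbour of `c`. All
    -- neighbours of `v` and `b` are known and `e` is not among them, so (E2) for `c e` leaves only
    -- `a`, which must have degree 4.
    diamond-hub-low : ∀ {v a b c d} → N4 v a b c d → a ∼ b → a ∼ c → a ∼ d → b ∼ c → b ∼ d → c ≁ d → low a
    diamond-hub-low {v} {a} {b} {c} {d} n ab ac ad bc bd c≁d = low-unless-high impossible
      where
      open N4 n
      impossible : ¬ Deg≥5 G a
      impossible hi with extend (other-low ac hi) (∼-sym ac) (∼-sym vc) (∼-sym bc) (∼⇒≢ (∼-sym va)) a≢b (∼⇒≢ vb)
      ... | e , nc = high⇒¬low hi (proj₁ (crit-1 nc
          (no-other (Nc.a≢d ∘ sym) (Nc.c≢d ∘ sym) (∼⇒≢ (∼-sym Nc.vd)) e≢d)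
          (N4.no-other nb (Nc.a≢d ∘ sym) (Nc.b≢d ∘ sym) (∼⇒≢ (∼-sym Nc.vd)) e≢d)))
        where
        module Nc = N4 nc
        e≢d : e ≢ d
        e≢d = separate Nc.vd c≁d
        nb : N4 b a v c d
        nb = n4 (other-low ab hi) (∼-sym ab) (∼-sym vb) bc bd
          (∼⇒≢ (∼-sym va) , ∼⇒≢ ac , ∼⇒≢ ad , ∼⇒≢ vc , ∼⇒≢ vd , c≢d)

  opaque
    link-diamond : ∀ {v a b c d} → N4 v a b c d → a ∼ b → a ∼ c → a ∼ d → b ∼ c → b ∼ d → c ≁ d → Outcome v
    link-diamond {v} {a} {b} {c} {d} n ab ac ad bc bd c≁d =
      build k5⁻ (λ ()) (Vec.lookup (c ∷ v ∷ d ∷ a ∷ b ∷ [])) (record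
        { at-edges = ∼-sym vc ∷ ∼-sym ac ∷ ∼-sym bc ∷ vd ∷ va ∷ vb ∷ ∼-sym ad ∷ ∼-sym bd ∷ ab ∷ []
        ; at-nonEdges = c≢d ∷ []
        ; at-inner = v-low ∷ diamond-hub-low n ab ac ad bc bd c≁d ∷
            diamond-hub-low (swap₁₂ n) (∼-sym ab) bc bd ac ad c≁d ∷ []
        ; at-tips = c≁d ∷ [] }) 1F
      where open N4 n

  opaque
    link-star : ∀ {v a b c d} → N4 v a b c d → a ∼ b → a ∼ c → a ∼ d → b ≁ c → b ≁ d → c ≁ d → Outcome v
    link-star {v} {a} {b} {c} {d} n ab ac ad b≁c b≁d c≁d =
      build k5▽ (λ ()) (Vec.lookup (b ∷ v ∷ c ∷ a ∷ d ∷ [])) (record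
        { at-edges = ∼-sym vb ∷ ∼-sym ab ∷ vc ∷ va ∷ vd ∷ ∼-sym ac ∷ ad ∷ []
        ; at-nonEdges = b≢c ∷ b≢d ∷ c≢d ∷ []
        ; at-inner = v-low ∷ proj₁ (crit-1 n b≁d c≁d) ∷ []
        ; at-tips = b≁c ∷ b≁d ∷ c≁d ∷ [] }) 1F
      where open N4 n

  opaque
    -- As for the diamond, with the fourth edge `c e` of `c`: now `v` and `a` have no room for `e`,
    -- and (E2) gives `b` degree 4.
    paw-low : ∀ {v a b c d} → N4 v a b c d → low a → a ∼ b → a ∼ c → a ∼ d → b ∼ c → b ≁ d → c ≁ d → low b
    paw-low {v} {a} {b} {c} {d} n la ab ac ad bc b≁d c≁d = low-unless-high impossible
      where
      open N4 n
      impossible : ¬ Deg≥5 G b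
      impossible hi with extend (other-low bc hi) (∼-sym bc) (∼-sym vc) (∼-sym ac) (∼⇒≢ (∼-sym vb)) (∼⇒≢ (∼-sym ab)) (∼⇒≢ va)
      ... | e , nc = high⇒¬low hi (proj₁ (crit-1 nc
          (no-other (Nc.c≢d ∘ sym) (Nc.a≢d ∘ sym) (∼⇒≢ (∼-sym Nc.vd)) e≢d)
          (N4.no-other na (Nc.b≢d ∘ sym) (Nc.a≢d ∘ sym) (∼⇒≢ (∼-sym Nc.vd)) e≢d)))
        where
        module Nc = N4 nc
        e≢d : e ≢ d
        e≢d = separate Nc.vd c≁d
        na : N4 a v b c d
        na = n4 la (∼-sym va) ab ac ad (∼⇒≢ vb , ∼⇒≢ vc , ∼⇒≢ vd , b≢c , b≢d , c≢d)

  paw-brick : ∀ {v a b c d z} → N4 v a b c d → low a → low b → low c → a ∼ b → a ∼ c → a ∼ d → b ∼ c → b ≁ d →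
    N4 b c v a z → c ∼ z → Outcome v
  paw-brick {v} {a} {b} {c} {d} {z} n la lb lc ab ac ad bc b≁d nb cz = build k5▷◁ (λ ()) vs bd 1F
    where
    open N4 n
    module Nb = N4 nb
    z≢d : z ≢ d
    z≢d = separate Nb.vd b≁d
    vs : Fin 6 → V G
    vs = Vec.lookup (d ∷ v ∷ a ∷ b ∷ c ∷ z ∷ [])
    bd : BrickData k5▷◁ vs
    bd = record
      { at-edges = ∼-sym vd ∷ ∼-sym ad ∷ va ∷ vb ∷ vc ∷ ab ∷ ac ∷ bc ∷ Nb.vd ∷ cz ∷ []
      ; at-nonEdges = (b≢d ∘ sym) ∷ (c≢d ∘ sym) ∷ (z≢d ∘ sym) ∷ Nb.b≢d ∷ Nb.c≢d ∷ []
      ; at-inner = v-low ∷ la ∷ lb ∷ lc ∷ []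
      ; at-tips = [] }

  -- The core of the bow-tie is the clique `v a b c`, with `d` attached to `v a`. The fourth
  -- neighbour `z` of `b` cannot be adjacent to `v` or `a`, so (E2) for `b z` joins it to `c`.
  link-paw : ∀ {v a b c d} → N4 v a b c d → a ∼ b → a ∼ c → a ∼ d → b ∼ c → b ≁ d → c ≁ d → Outcome v
  link-paw {v} {a} {b} {c} {d} n ab ac ad bc b≁d c≁d = paw-brick n la lb lc ab ac ad bc b≁d nb
      (proj₂ (crit-1 nb
        (no-other (Nb.c≢d ∘ sym) (∼⇒≢ (∼-sym Nb.vd)) (Nb.a≢d ∘ sym) z≢d)
        (N4.no-other na (Nb.b≢d ∘ sym) (∼⇒≢ (∼-sym Nb.vd)) (Nb.a≢d ∘ sym) z≢d)))
    where
    open N4 n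
    la : low a
    la = proj₁ (crit-1 n b≁d c≁d)
    lb : low b
    lb = paw-low n la ab ac ad bc b≁d c≁d
    lc : low c
    lc = paw-low (swap₂₃ n) la ac ab ad (∼-sym bc) c≁d b≁d
    b-fourth : ∃ λ z → N4 b c v a z
    b-fourth = extend lb bc (∼-sym vb) (∼-sym ab) (∼⇒≢ (∼-sym vc)) (∼⇒≢ (∼-sym ac)) (∼⇒≢ va)
    nb : N4 b c v a (proj₁ b-fourth)
    nb = proj₂ b-fourth
    module Nb = N4 nb
    z≢d : proj₁ b-fourth ≢ d
    z≢d = separate Nb.vd b≁d
    na : N4 a v b c d
    na = n4 la (∼-sym va) ab ac ad (∼⇒≢ vb , ∼⇒≢ vc , ∼⇒≢ vd , b≢c , b≢d , c≢d)

  opaque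
    -- The antipodal pairs are `x p`, `q q′` and `r r′`. The attachment is `x`, the only vertex of
    -- unrestricted degree.
    octahedron : ∀ {x p q q′ r r′} → low p → low q → low q′ → low r → low r′ →
      x ∼ q → x ∼ q′ → x ∼ r → x ∼ r′ → p ∼ q → p ∼ q′ → p ∼ r → p ∼ r′ → q ∼ r → q ∼ r′ → q′ ∼ r → q′ ∼ r′ →
      x ≢ p → q ≢ q′ → r ≢ r′ → Outcome p × Outcome r
    octahedron {x} {p} {q} {q′} {r} {r′} lp lq lq′ lr lr′ xq xq′ xr xr′ pq pq′ pr pr′ qr qr′ q′r q′r′ x≢p q≢q′ r≢r′ =
      build k222 (λ ()) vs octa 1F , build k222 (λ ()) vs octa 4F
      where
      vs : Fin 6 → V G
      vs = Vec.lookup (x ∷ p ∷ q ∷ q′ ∷ r ∷ r′ ∷ [])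
      octa : BrickData k222 vs
      octa = record
        { at-edges = xq ∷ xq′ ∷ xr ∷ xr′ ∷ pq ∷ pq′ ∷ pr ∷ pr′ ∷ qr ∷ qr′ ∷ q′r ∷ q′r′ ∷ []
        ; at-nonEdges = x≢p ∷ q≢q′ ∷ r≢r′ ∷ []
        ; at-inner = lp ∷ lq ∷ lq′ ∷ lr ∷ lr′ ∷ []
        ; at-tips = [] }

  -- With `a` high and `v` full, (E2) joins the fourth neighbours of `b` and of `d` to `c`, which
  -- has room for only one, so they coincide in `w`. The pairs `a c`, `b d`, `v w` are antipodal in
  -- an octahedron, complete or lacking the edge `a w`.
  C4-high : ∀ {v a b c d} → N4 v a b c d → a ∼ b → a ≁ c → a ∼ d → b ∼ c → b ≁ d → c ∼ d → Deg≥5 G a → Outcome v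
  C4-high {v} {a} {b} {c} {d} n ab a≁c ad bc b≁d cd hi = finish
    where
    open N4 n
    lb : low b
    lb = other-low ab hi
    ld : low d
    ld = other-low ad hi
    b-fourth : ∃ λ w → N4 b c v a w
    b-fourth = extend lb bc (∼-sym vb) (∼-sym ab) (∼⇒≢ (∼-sym vc)) (a≢c ∘ sym) (∼⇒≢ va)
    d-fourth : ∃ λ w → N4 d c v a w
    d-fourth = extend ld (∼-sym cd) (∼-sym vd) (∼-sym ad) (∼⇒≢ (∼-sym vc)) (a≢c ∘ sym) (∼⇒≢ va)
    w w′ : V G
    w = proj₁ b-fourth
    w′ = proj₁ d-fourth
    nb : N4 b c v a w
    nb = proj₂ b-fourth
    nd : N4 d c v a w′
    nd = proj₂ d-fourth
    module Nb = N4 nb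
    module Nd = N4 nd
    third : ∀ {b d w} → N4 v a b c d → N4 b c v a w → b ≁ d → low c × c ∼ w
    third n nb b≁d with crit4 nb
    ... | inj₁ l = l
    ... | inj₂ (inj₁ (_ , vw)) = ⊥-elim (N4.no-other n (N4.c≢d nb ∘ sym) (∼⇒≢ (∼-sym (N4.vd nb))) (N4.a≢d nb ∘ sym)
      (separate (N4.vd nb) b≁d) vw)
    ... | inj₂ (inj₂ (inj₁ (la , _))) = ⊥-elim (high⇒¬low hi la)
    ... | inj₂ (inj₂ (inj₂ (_ , vw , _))) = ⊥-elim (N4.no-other n (N4.c≢d nb ∘ sym) (∼⇒≢ (∼-sym (N4.vd nb)))
      (N4.a≢d nb ∘ sym) (separate (N4.vd nb) b≁d) vw)
    c-third : low c × c ∼ w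
    c-third = third n nb b≁d
    lc : low c
    lc = proj₁ c-third
    nc : N4 c v b d w
    nc = n4 lc (∼-sym vc) (∼-sym bc) cd (proj₂ c-third)
      (∼⇒≢ vb , ∼⇒≢ vd , Nb.b≢d , b≢d , ∼⇒≢ Nb.vd , separate Nb.vd b≁d ∘ sym)
    w′≡w : w′ ≡ w
    w′≡w with N4.only nc (proj₂ (third (swap₃₄ (swap₂₃ (swap₃₄ n))) nd (≁-sym b≁d)))
    ... | inj₁ eq = ⊥-elim (Nd.b≢d (sym eq))
    ... | inj₂ (inj₁ eq) = ⊥-elim (separate Nd.vd (≁-sym b≁d) eq)
    ... | inj₂ (inj₂ (inj₁ eq)) = ⊥-elim (∼⇒≢ Nd.vd (sym eq))
    ... | inj₂ (inj₂ (inj₂ eq)) = eq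
    dw : d ∼ w
    dw = subst (d ∼_) w′≡w Nd.vd
    finish : Outcome v
    finish with adj? a w
    ... | yes aw = proj₂ (octahedron lc lb ld v-low (other-low aw hi)
      ab ad (∼-sym va) aw (∼-sym bc) cd (∼-sym vc) (proj₂ c-third) (∼-sym vb) Nb.vd (∼-sym vd) dw
      a≢c b≢d Nb.b≢d)
    ... | no a≁w = build k222⁻ (λ ()) (Vec.lookup (a ∷ c ∷ w ∷ v ∷ b ∷ d ∷ [])) (record
      { at-edges = ∼-sym va ∷ ab ∷ ad ∷ proj₂ c-third ∷ ∼-sym vc ∷ ∼-sym bc ∷ cd ∷ ∼-sym Nb.vd ∷ ∼-sym dw ∷ vb ∷ vd ∷ []
      ; at-nonEdges = a≢c ∷ Nb.c≢d ∷ Nb.b≢d ∘ sym ∷ b≢d ∷ []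
      ; at-inner = lc ∷ v-low ∷ lb ∷ ld ∷ []
      ; at-tips = a≁w ∷ [] }) 3F

  -- `e` is not adjacent to `v`, whose neighbours are known, so (E2) for `b e` leaves `a` or `c`.
  C4-fourth : ∀ {v a b c d e} → N4 v a b c d → b ≁ d → N4 b v a c e → a ∼ e ⊎ c ∼ e
  C4-fourth n b≁d nb with crit4 nb
  ... | inj₁ (_ , ve) = ⊥-elim (N4.no-other n (N4.b≢d nb ∘ sym) (∼⇒≢ (∼-sym (N4.vd nb))) (N4.c≢d nb ∘ sym)
    (separate (N4.vd nb) b≁d) ve)
  ... | inj₂ (inj₁ (_ , ae)) = inj₁ ae
  ... | inj₂ (inj₂ (inj₁ (_ , ce))) = inj₂ ce
  ... | inj₂ (inj₂ (inj₂ (_ , ae , _))) = inj₁ ae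

  -- Let `z` be the fourth neighbour of `c`. If `b ∼ z`, then `b` has room only for `z = y`, and the
  -- fourth neighbour of `d` must be `y` as well: an octahedron. If `d ∼ z`, the cases `z = y` and
  -- `z ≠ y` give an octahedron and a bow-tie with ends `y` on `a b` and `z` on `c d`.
  C4-pair : ∀ {v a b c d y} → N4 v a b c d → a ∼ b → a ≁ c → a ∼ d → b ∼ c → b ≁ d → c ∼ d →
    low a → low b → low c → low d → N4 a v b d y → b ∼ y → Outcome v
  C4-pair {v} {a} {b} {c} {d} {y} n ab a≁c ad bc b≁d cd la lb lc ld na by =
    by-c (C4-fourth (rotate n) (≁-sym a≁c) nc)
    where
    open N4 n
    c-fourth : ∃ λ z → N4 c v b d z
    c-fourth = extend lc (∼-sym vc) (∼-sym bc) cd (∼⇒≢ vb) (∼⇒≢ vd) b≢d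
    d-fourth : ∃ λ z → N4 d v a c z
    d-fourth = extend ld (∼-sym vd) (∼-sym ad) (∼-sym cd) (∼⇒≢ va) (∼⇒≢ vc) a≢c
    z z′ : V G
    z = proj₁ c-fourth
    z′ = proj₁ d-fourth
    nc : N4 c v b d z
    nc = proj₂ c-fourth
    nd : N4 d v a c z′
    nd = proj₂ d-fourth
    module Na = N4 na
    module Nc = N4 nc
    module Nd = N4 nd
    y≢c : y ≢ c
    y≢c = separate Na.vd a≁c
    y≢d : y ≢ d
    y≢d = separate by b≁d
    nb : N4 b v a c y
    nb = n4 lb (∼-sym vb) (∼-sym ab) bc by (∼⇒≢ va , ∼⇒≢ vc , Na.a≢d , a≢c , ∼⇒≢ Na.vd , y≢c ∘ sym)
    octa : c ∼ y → d ∼ y → Outcome v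
    octa cy dy = proj₁ (octahedron v-low la lc lb ld
      (∼-sym Na.vd) (∼-sym cy) (∼-sym by) (∼-sym dy) va vc vb vd ab ad (∼-sym bc) cd (Na.a≢d ∘ sym) a≢c b≢d)
    bowtied : d ∼ z → Dec (z ≡ y) → Outcome v
    bowtied dz (yes z≡y) = octa (subst (c ∼_) z≡y Nc.vd) (subst (d ∼_) z≡y dz)
    bowtied dz (no z≢y) = build k222▷◁ (λ ()) (Vec.lookup (y ∷ v ∷ a ∷ c ∷ b ∷ d ∷ z ∷ [])) (record
      { at-edges = ∼-sym Na.vd ∷ ∼-sym by ∷ va ∷ vc ∷ vb ∷ vd ∷ ab ∷ ad ∷ ∼-sym bc ∷ cd ∷ Nc.vd ∷ dz ∷ []
      ; at-nonEdges = Na.a≢d ∘ sym ∷ y≢c ∷ y≢d ∷ z≢y ∘ sym ∷ Nc.a≢d ∷ a≢c ∷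
          separate Nc.vd (≁-sym a≁c) ∘ sym ∷ b≢d ∷ separate dz (≁-sym b≁d) ∘ sym ∷ []
      ; at-inner = v-low ∷ la ∷ lc ∷ lb ∷ ld ∷ []
      ; at-tips = [] }) 1F
    by-d : c ∼ y → a ∼ z′ ⊎ c ∼ z′ → Outcome v
    by-d cy (inj₁ az′) with N4.only na az′
    ... | inj₁ eq = ⊥-elim (Nd.a≢d (sym eq))
    ... | inj₂ (inj₁ eq) = ⊥-elim (separate Nd.vd (≁-sym b≁d) eq)
    ... | inj₂ (inj₂ (inj₁ eq)) = ⊥-elim (∼⇒≢ Nd.vd (sym eq))
    ... | inj₂ (inj₂ (inj₂ eq)) = octa cy (subst (d ∼_) eq Nd.vd)
    by-d cy (inj₂ cz′) with N4.only (n4 lc (∼-sym vc) (∼-sym bc) cd cy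
      (∼⇒≢ vb , ∼⇒≢ vd , Na.a≢d , b≢d , ∼⇒≢ by , y≢d ∘ sym)) cz′
    ... | inj₁ eq = ⊥-elim (Nd.a≢d (sym eq))
    ... | inj₂ (inj₁ eq) = ⊥-elim (separate Nd.vd (≁-sym b≁d) eq)
    ... | inj₂ (inj₂ (inj₁ eq)) = ⊥-elim (∼⇒≢ Nd.vd (sym eq))
    ... | inj₂ (inj₂ (inj₂ eq)) = octa cy (subst (d ∼_) eq Nd.vd)
    by-c : b ∼ z ⊎ d ∼ z → Outcome v
    by-c (inj₂ dz) = bowtied dz (z ≟ y)
    by-c (inj₁ bz) with N4.only nb bz
    ... | inj₁ eq = ⊥-elim (Nc.a≢d (sym eq))
    ... | inj₂ (inj₁ eq) = ⊥-elim (separate Nc.vd (≁-sym a≁c) eq)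
    ... | inj₂ (inj₂ (inj₁ eq)) = ⊥-elim (∼⇒≢ Nc.vd (sym eq))
    ... | inj₂ (inj₂ (inj₂ eq)) = by-d (subst (c ∼_) eq Nc.vd) (swap (C4-fourth (rotate (rotate n)) (≁-sym b≁d) (swap₂₃ nd)))

  C4-low : ∀ {v a b c d y} → N4 v a b c d → a ∼ b → a ≁ c → a ∼ d → b ∼ c → b ≁ d → c ∼ d →
    low a → low b → low c → low d → N4 a v b d y → b ∼ y ⊎ d ∼ y → Outcome v
  C4-low n ab a≁c ad bc b≁d cd la lb lc ld na (inj₁ by) = C4-pair n ab a≁c ad bc b≁d cd la lb lc ld na by
  C4-low n ab a≁c ad bc b≁d cd la lb lc ld na (inj₂ dy) =
    C4-pair (swap₃₄ (swap₂₃ (swap₃₄ n))) ad a≁c ab (∼-sym cd) (≁-sym b≁d) (∼-sym bc) la ld lc lb (swap₂₃ na) dy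

  link-C4 : ∀ {v a b c d} → N4 v a b c d → a ∼ b → a ≁ c → a ∼ d → b ∼ c → b ≁ d → c ∼ d → Outcome v
  link-C4 {v} {a} {b} {c} {d} n ab a≁c ad bc b≁d cd with deg? a | deg? b | deg? c | deg? d
  ... | inj₂ hi | _ | _ | _ = C4-high n ab a≁c ad bc b≁d cd hi
  ... | _ | inj₂ hi | _ | _ = C4-high (rotate n) bc b≁d (∼-sym ab) cd (≁-sym a≁c) (∼-sym ad) hi
  ... | _ | _ | inj₂ hi | _ =
    C4-high (rotate (rotate n)) cd (≁-sym a≁c) (∼-sym bc) (∼-sym ad) (≁-sym b≁d) ab hi
  ... | _ | _ | _ | inj₂ hi =
    C4-high (rotate (rotate (rotate n))) (∼-sym ad) (≁-sym b≁d) (∼-sym cd) ab a≁c bc hi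
  ... | inj₁ la | inj₁ lb | inj₁ lc | inj₁ ld =
    let _ , na = extend la (∼-sym va) ab ad (∼⇒≢ vb) (∼⇒≢ vd) b≢d in
    C4-low n ab a≁c ad bc b≁d cd la lb lc ld na
      (swap (C4-fourth (rotate (rotate (rotate n))) a≁c (swap₂₃ na)))
    where open N4 n

  -- Links that are paths.

  record Path (v a b c d : V G) : Set where
    constructor path
    field
      nbrs : N4 v a b c d
      ab   : a ∼ b
      bc   : b ∼ c
      cd   : c ∼ d
      a≁c  : a ≁ c
      a≁d  : a ≁ d
      b≁d  : b ≁ d
    open N4 nbrs public

    -- The end `a` of the path has only `b` in common with `v`, so (E2) for `v a` concerns `b`;
    -- likewise `d` and `c`.
    b-low : low b
    b-low = proj₁ (crit-1 (rotate nbrs) (≁-sym a≁c) (≁-sym a≁d))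

    c-low : low c
    c-low = proj₁ (crit-1 (swap₁₂ (swap₂₃ nbrs)) a≁d b≁d)

    -- Consecutive edges from `v` to the path lie in a common triangle, so a brick containing one of
    -- them contains all four.
    spread : (P : Placed G) → Placed.Has P v c → Covers P v
    spread P Pvc y vy with only vy
    ... | inj₁ refl = Placed.tri-closed P (Placed.tri-closed P Pvc vb (∼-sym bc)) va (∼-sym ab)
    ... | inj₂ (inj₁ refl) = Placed.tri-closed P Pvc vb (∼-sym bc)
    ... | inj₂ (inj₂ (inj₁ refl)) = Pvc
    ... | inj₂ (inj₂ (inj₂ refl)) = Placed.tri-closed P Pvc vd cd

    from-c : Outcome c → Outcome v
    from-c (inj₁ sq) = inj₁ sq
    from-c (inj₂ (P , cov)) = inj₂ (P , spread P (Placed.Has-sym P (cov v (∼-sym vc))))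

    from-b : Outcome b → Outcome v
    from-b (inj₁ sq) = inj₁ sq
    from-b (inj₂ (P , cov)) = inj₂ (P , spread P
      (Placed.tri-closed P (Placed.Has-sym P (cov v (∼-sym vb))) vc bc))

  module _ {v a b c d e : V G} (p : Path v a b c d) (nc : N4 c v b d e) where
    open Path p
    private module Nc = N4 nc

    v≁e : v ≁ e
    v≁e = no-other (separate Nc.vd (≁-sym a≁c)) (Nc.b≢d ∘ sym) (∼⇒≢ (∼-sym Nc.vd)) (Nc.c≢d ∘ sym)

    -- The inner triangle is `v b c`; the attachments `e`, `d`, `a` are the antipodes of `v`, `b`,
    -- `c` respectively.
    fan : b ∼ e → d ≁ e → a ≁ e → Outcome v
    fan be d≁e a≁e = build k222▽ (λ ()) (Vec.lookup (e ∷ v ∷ d ∷ b ∷ a ∷ c ∷ [])) (record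
      { at-edges = ∼-sym be ∷ ∼-sym Nc.vd ∷ vd ∷ vb ∷ va ∷ vc ∷ ∼-sym cd ∷ ∼-sym ab ∷ bc ∷ []
      ; at-nonEdges = Nc.a≢d ∘ sym ∷ Nc.c≢d ∘ sym ∷ separate Nc.vd (≁-sym a≁c) ∷ b≢d ∘ sym ∷ a≢d ∘ sym ∷ a≢c ∷ []
      ; at-inner = v-low ∷ b-low ∷ c-low ∷ []
      ; at-tips = ≁-sym d≁e ∷ ≁-sym a≁e ∷ ≁-sym a≁d ∷ [] }) 1F

    -- (E2) for `c e` makes `e` adjacent to `b` or `d`, as `v` is full. Both: the link of `c` is a
    -- 4-cycle. Only `b`: the link of `b` is a 4-cycle if `a ∼ e`, and otherwise the octahedron
    -- without a triangle appears. Only `d`: the link of `c` is again a path.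
    advance : Outcome v ⊎ Path c b v d e
    advance with adj? b e | adj? d e | adj? a e
    ... | yes be | yes de | _ = inj₁ (from-c
      (link-C4 (swap₃₄ nc) vb v≁e vd be b≁d (∼-sym de)))
    ... | yes be | no d≁e | yes ae = inj₁ (from-b
      (link-C4 nb (∼-sym va) a≁c ae vc v≁e Nc.vd))
      where
      nb : N4 b a v c e
      nb = n4 b-low (∼-sym ab) (∼-sym vb) bc be
        (∼⇒≢ (∼-sym va) , a≢c , separate Nc.vd (≁-sym a≁c) ∘ sym , ∼⇒≢ vc , Nc.a≢d , ∼⇒≢ Nc.vd)
    ... | yes be | no d≁e | no a≁e = inj₁ (fan be d≁e a≁e)
    ... | no b≁e | yes de | _ = inj₂ (path (swap₁₂ nc) (∼-sym vb) vd de b≁d b≁e v≁e)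
    ... | no b≁e | no d≁e | _ = ⊥-elim (v≁e (proj₂ (crit-1 nc b≁e d≁e)))

  next : ∀ {v a b c d} → Path v a b c d → Outcome v ⊎ ∃ λ e → Path c b v d e
  next p = let e , nc = extend c-low (∼-sym vc) (∼-sym bc) cd (∼⇒≢ vb) (∼⇒≢ vd) b≢d in
    [ inj₁ , (λ q → inj₂ (e , q)) ]′ (advance p nc)
    where open Path p

  -- Walks along squared paths

  PathAt : (ℕ → V G) → ℕ → Set
  PathAt w i = Path (w (2 + i)) (w i) (w (1 + i)) (w (3 + i)) (w (4 + i))

  infixr 5 _◃_
  _◃_ : V G → (ℕ → V G) → ℕ → V G
  (x ◃ w) zero = x
  (x ◃ w) (suc i) = w i

  -- The sequence is total on ℕ, but the path conditions control only its entries up to index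
  -- `4 + k`.
  Chain : ℕ → (v a b c d : V G) → Set
  Chain k v a b c d = Σ (ℕ → V G) λ w →
    (w 0 ≡ a × w 1 ≡ b × w 2 ≡ v × w 3 ≡ c × w 4 ≡ d) × (∀ i → i ≤ k → PathAt w i)

  run : ∀ k {v a b c d} → Path v a b c d → Outcome v ⊎ Chain k v a b c d
  run zero {v} {a} {b} {c} {d} p = inj₂ (a ◃ b ◃ v ◃ c ◃ (λ _ → d) ,
    (refl , refl , refl , refl , refl) , λ { zero z≤n → p })
  run (suc k) p = [ inj₁ , (λ (e , q) → [ inj₁ ∘ Path.from-c p , inj₂ ∘ prepend p ]′ (run k q)) ]′ (next p)
    where
    prepend : ∀ {v a b c d e} → Path v a b c d → Chain k c b v d e → Chain (suc k) v a b c d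
    prepend {a = a} p (w , (refl , refl , refl , refl , refl) , h) =
      a ◃ w , (refl , refl , refl , refl , refl) , λ { zero _ → p ; (suc i) (s≤s i≤k) → h i i≤k }

  InjectiveBelow : (ℕ → V G) → ℕ → Set
  InjectiveBelow w n = ∀ {i j} → i < n → j < n → w i ≡ w j → i ≡ j

  FirstRepeat : (ℕ → V G) → ℕ → Set
  FirstRepeat w j = InjectiveBelow w j × ∃ λ i → i < j × w i ≡ w j

  first-repeat : ∀ w n → InjectiveBelow w n ⊎ ∃ λ j → j < n × FirstRepeat w j
  first-repeat w zero = inj₁ λ ()
  first-repeat w (suc n) with first-repeat w n
  ... | inj₂ (j , j<n , r) = inj₂ (j , m≤n⇒m≤1+n j<n , r)
  ... | inj₁ inj with any? (λ (i : Fin n) → w (toℕ i) ≟ w n)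
  ... | yes (i , eq) = inj₂ (n , n<1+n n , inj , toℕ i , toℕ<n i , eq)
  ... | no none = inj₁ λ i<1+n j<1+n → grow (m≤n⇒m<n∨m≡n (≤-pred i<1+n)) (m≤n⇒m<n∨m≡n (≤-pred j<1+n))
    where
    new : ∀ {i} → i < n → w i ≢ w n
    new i<n eq = none (fromℕ< i<n , trans (cong w (toℕ-fromℕ< i<n)) eq)
    grow : ∀ {i j} → i < n ⊎ i ≡ n → j < n ⊎ j ≡ n → w i ≡ w j → i ≡ j
    grow (inj₁ i<n) (inj₁ j<n) eq = inj i<n j<n eq
    grow (inj₁ i<n) (inj₂ refl) eq = ⊥-elim (new i<n eq)
    grow (inj₂ refl) (inj₁ j<n) eq = ⊥-elim (new j<n (sym eq))
    grow (inj₂ refl) (inj₂ refl) eq = refl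

  repeat : ∀ w → ∃ λ j → j ≤ proj₁ fin × FirstRepeat w j
  repeat w with first-repeat w (suc (proj₁ fin))
  ... | inj₂ (j , j<1+n , r) = j , ≤-pred j<1+n , r
  ... | inj₁ inj = ⊥-elim (≤⇒≯ (injective⇒≤ {f = λ i → Inverse.to (proj₂ fin) (w (toℕ i))}
    λ eq → toℕ-injective (inj (toℕ<n _) (toℕ<n _) (to-injective (proj₂ fin) _ _ eq))) (n<1+n _))

  -- Closing the walk into the square of a cycle.

  module Closing (w : ℕ → V G) (bound : ℕ) (at : ∀ i → i ≤ bound → PathAt w i) where

    distinct⁵ : ∀ i → i ≤ bound →
      w i ≢ w (1 + i) × w i ≢ w (2 + i) × w i ≢ w (3 + i) × w i ≢ w (4 + i)
    distinct⁵ i i≤ = a≢b , ∼⇒≢ (∼-sym va) , a≢c , a≢d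
      where open Path (at i i≤)

    -- Five consecutive entries are distinct, so a repetition is at distance at least 5. This
    -- supplies the lower bound on the length of the cycle.
    gap : ∀ i k → i ≤ bound → w i ≡ w (k + (1 + i)) → ∃ λ r → k ≡ 4 + r
    gap i 0 i≤ eq = ⊥-elim (proj₁ (distinct⁵ i i≤) eq)
    gap i 1 i≤ eq = ⊥-elim (proj₁ (proj₂ (distinct⁵ i i≤)) eq)
    gap i 2 i≤ eq = ⊥-elim (proj₁ (proj₂ (proj₂ (distinct⁵ i i≤))) eq)
    gap i 3 i≤ eq = ⊥-elim (proj₂ (proj₂ (proj₂ (distinct⁵ i i≤))) eq)
    gap i (suc (suc (suc (suc r)))) _ _ = r , refl

    later : ∀ {q k} → InjectiveBelow w (2 + q) → q ≤ bound → k < q → w (2 + q) ∼ w k →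
      w k ≡ w (3 + q) ⊎ w k ≡ w (4 + q)
    later {q} {k} inj q≤ k<q adj with Path.only (at q q≤) adj
    ... | inj₁ eq = ⊥-elim (<-irrefl (inj (≤-trans k<q (m≤n+m q 2)) (m≤n+m (1 + q) 1) eq) k<q)
    ... | inj₂ (inj₁ eq) =
      ⊥-elim (<-irrefl (inj (≤-trans k<q (m≤n+m q 2)) ≤-refl eq) (m≤n⇒m≤1+n k<q))
    ... | inj₂ (inj₂ p) = p

    -- If w i = w j is the first repetition then i = 0: otherwise the three neighbours w (i − 1),
    -- w (i + 1), w (i + 2) of w j would all lie in {w (j + 1), w (j + 2)}.
    starts-at-0 : ∀ i r → let q = 4 + r + i in q ≤ bound → InjectiveBelow w (2 + q) → w (1 + i) ≢ w (2 + q)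
    starts-at-0 i r q≤ inj eq = clash (later inj q≤ i<q (near (∼-sym P.ab)))
        (later inj q≤ 2+i<q (near (∼-sym P.vb))) (later inj q≤ 3+i<q (near P.bc))
      where
      q = 4 + r + i
      i<q : i < q
      i<q = s≤s (m≤n+m i (3 + r))
      2+i<q : 2 + i < q
      2+i<q = s≤s (s≤s (s≤s (≤-trans (m≤n+m i r) (m≤n+m (r + i) 1))))
      3+i<q : 3 + i < q
      3+i<q = s≤s (s≤s (s≤s (s≤s (m≤n+m i r))))
      module P = Path (at i (≤-trans (<⇒≤ i<q) q≤))
      near : ∀ {x} → w (1 + i) ∼ x → w (2 + q) ∼ x
      near {x} = subst (_∼ x) eq
      below : ∀ {k} → k < q → k < 2 + q
      below k<q = ≤-trans k<q (m≤n+m q 2)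
      same : ∀ {k l} {A : Set} → k < q → l < q → k ≢ l → ∀ {x} → w k ≡ x → w l ≡ x → A
      same k<q l<q k≢l p p′ = ⊥-elim (k≢l (inj (below k<q) (below l<q) (trans p (sym p′))))
      clash : ∀ {x y} → w i ≡ x ⊎ w i ≡ y → w (2 + i) ≡ x ⊎ w (2 + i) ≡ y → w (3 + i) ≡ x ⊎ w (3 + i) ≡ y → ⊥
      clash (inj₁ p) (inj₁ p′) _ = same i<q 2+i<q (λ ()) p p′
      clash (inj₂ p) (inj₂ p′) _ = same i<q 2+i<q (λ ()) p p′
      clash (inj₁ p) _ (inj₁ p′) = same i<q 3+i<q (λ ()) p p′
      clash (inj₂ p) _ (inj₂ p′) = same i<q 3+i<q (λ ()) p p′
      clash _ (inj₁ p) (inj₁ p′) = same 2+i<q 3+i<q (λ ()) p p′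
      clash _ (inj₂ p) (inj₂ p′) = same 2+i<q 3+i<q (λ ()) p p′

    module Cycle (r : ℕ) (j≤ : 5 + r ≤ bound) (inj : InjectiveBelow w (5 + r)) (w₀ : w 0 ≡ w (5 + r)) where

      module P (s : ℕ) (s≤ : s ≤ 5 + r) = Path (at s (≤-trans s≤ j≤))
      module P₀ = P 0 z≤n
      module Pⱼ = P (3 + r) (m≤n+m (3 + r) 2)
      module Pⱼ₁ = P (4 + r) (m≤n+m (4 + r) 1)

      -- In the reversed case `w 2` is adjacent to `w (4 + r)`, which must then be `w 4`, so
      -- `r = 0`. But then `w 0 = w 5` is adjacent to `w 3`, against the path around `w 2`.
      not-reversed : ¬ (w 1 ≡ w (7 + r) × w 2 ≡ w (6 + r))
      not-reversed (_ , w₂) with P₀.only (subst (_∼ w (4 + r)) (sym w₂) Pⱼ₁.va)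
      ... | inj₁ eq with () ← inj ≤-refl (s≤s z≤n) eq
      ... | inj₂ (inj₁ eq) with () ← inj ≤-refl (s≤s (s≤s z≤n)) eq
      ... | inj₂ (inj₂ (inj₁ eq)) with () ← inj ≤-refl (s≤s (s≤s (s≤s (s≤s z≤n)))) eq
      ... | inj₂ (inj₂ (inj₂ eq)) = small r (inj ≤-refl (s≤s (s≤s (s≤s (s≤s (s≤s z≤n))))) eq) w₀ Pⱼ.va
        where
        small : ∀ r → 4 + r ≡ 4 → w 0 ≡ w (5 + r) → w (5 + r) ∼ w (3 + r) → ⊥
        small zero _ w₀ adj = P₀.a≁c (subst (_∼ w 3) (sym w₀) adj)

      w₁₂ : w 1 ≡ w (6 + r) × w 2 ≡ w (7 + r)
      w₁₂ with later inj q≤ (s≤s (s≤s z≤n)) (subst (_∼ w 1) w₀ P₀.ab)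
             | later inj q≤ (s≤s (s≤s (s≤s z≤n))) (subst (_∼ w 2) w₀ (∼-sym P₀.va))
        where q≤ = ≤-trans (m≤n+m (3 + r) 2) j≤
      ... | inj₁ p | inj₂ q = p , q
      ... | inj₁ p | inj₁ q with () ← inj (s≤s (s≤s z≤n)) (s≤s (s≤s (s≤s z≤n))) (trans p (sym q))
      ... | inj₂ p | inj₂ q with () ← inj (s≤s (s≤s z≤n)) (s≤s (s≤s (s≤s z≤n))) (trans p (sym q))
      ... | inj₂ p | inj₁ q = ⊥-elim (not-reversed (p , q))

      -- `w 3` is a neighbour of `w 1 = w (6 + r)`. Of the four neighbours there, three are
      -- `w (4 + r)`, `w 0` and `w 2`, which differ from `w 3`.
      w₃ : w 3 ≡ w (8 + r)
      w₃ with Pⱼ₁.only (subst (_∼ w 3) (proj₁ w₁₂) P₀.bc)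
      ... | inj₁ eq with () ← inj (s≤s (s≤s (s≤s (s≤s z≤n)))) ≤-refl eq
      ... | inj₂ (inj₁ eq) with () ← inj (s≤s (s≤s (s≤s (s≤s z≤n)))) (s≤s z≤n) (trans eq (sym w₀))
      ... | inj₂ (inj₂ (inj₁ eq)) with () ← inj (s≤s (s≤s (s≤s (s≤s z≤n)))) (s≤s (s≤s (s≤s z≤n))) (trans eq (sym (proj₂ w₁₂)))
      ... | inj₂ (inj₂ (inj₂ eq)) = eq

      open CycleSquare r using (n; C; absorb)

      -- Periodicity is needed only up to `8 + r`: the centres representing all residues run from 2
      -- to `6 + r`, and neighbours lie at most two steps ahead.
      wrap : ∀ x → x ≤ 8 + r → w (x % n) ≡ w x
      wrap x x≤ with x <? n
      ... | yes x<n = cong w (m<n⇒m%n≡m x<n)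
      ... | no x≮n with m≤n⇒∃[o]m+o≡n (≮⇒≥ x≮n)
      ... | o , refl = trans (cong w (trans (cong (_% n) (+-comm n o)) ([m+n]%n≡m%n o n))) (around o o≤3)
        where
        o≤3 : o ≤ 3
        o≤3 = cancel r x≤
          where
          cancel : ∀ r → 5 + r + o ≤ 8 + r → o ≤ 3
          cancel zero (s≤s (s≤s (s≤s (s≤s (s≤s le))))) = le
          cancel (suc r) (s≤s le) = cancel r le
        around : ∀ o → o ≤ 3 → w (o % n) ≡ w (n + o)
        around 0 _ = trans w₀ (cong w (+-comm 0 n))
        around 1 _ = trans (proj₁ w₁₂) (cong w (+-comm 1 n))
        around 2 _ = trans (proj₂ w₁₂) (cong w (+-comm 2 n))
        around 3 _ = trans w₃ (cong w (+-comm 3 n))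
        around (suc (suc (suc (suc _)))) (s≤s (s≤s (s≤s ())))

      φ : Fin n → V G
      φ i = w (toℕ i)

      φ-inj : ∀ i j → φ i ≡ φ j → i ≡ j
      φ-inj i j eq = toℕ-injective (inj (toℕ<n i) (toℕ<n j) eq)

      step₁ : ∀ i j → (toℕ i + 1) % n ≡ toℕ j → φ i ∼ φ j
      step₁ i j eq = subst (φ i ∼_)
        (trans (cong w (+-comm 1 (toℕ i))) (trans (sym (wrap (toℕ i + 1) le)) (cong w eq))) (P.ab (toℕ i) (<⇒≤ (toℕ<n i)))
        where
        le : toℕ i + 1 ≤ 8 + r
        le = subst (_≤ 8 + r) (+-comm 1 (toℕ i)) (≤-trans (toℕ<n i) (m≤n+m n 3))

      step₂ : ∀ i j → (toℕ i + 2) % n ≡ toℕ j → φ i ∼ φ j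
      step₂ i j eq = subst (φ i ∼_)
        (trans (cong w (+-comm 2 (toℕ i))) (trans (sym (wrap (toℕ i + 2) le)) (cong w eq))) (∼-sym (P.va (toℕ i) (<⇒≤ (toℕ<n i))))
        where
        le : toℕ i + 2 ≤ 8 + r
        le = subst (_≤ 8 + r) (+-comm 2 (toℕ i)) (≤-trans (s≤s (toℕ<n i)) (m≤n+m (1 + n) 2))

      φ-hom : ∀ i j → Adj C i j → φ i ∼ φ j
      φ-hom i j (inj₁ p) = step₁ i j p
      φ-hom i j (inj₂ (inj₁ p)) = step₂ i j p
      φ-hom i j (inj₂ (inj₂ (inj₁ p))) = ∼-sym (step₁ j i p)
      φ-hom i j (inj₂ (inj₂ (inj₂ p))) = ∼-sym (step₂ j i p)

      residue : ℕ → Fin n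
      residue x = fromℕ< (m%n<n x n)

      toℕ-residue : ∀ x → toℕ (residue x) ≡ x % n
      toℕ-residue x = toℕ-fromℕ< _

      φ-residue : ∀ x → x ≤ 8 + r → φ (residue x) ≡ w x
      φ-residue x x≤ = trans (cong w (toℕ-residue x)) (wrap x x≤)

      shifted : ∀ x k → (toℕ (residue x) + k) % n ≡ toℕ (residue (x + k))
      shifted x k = trans (cong (λ y → (y + k) % n) (toℕ-residue x)) (trans (absorb x k) (sym (toℕ-residue (x + k))))

      neighbours : ∀ s → s ≤ 4 + r → ∀ z → w (2 + s) ∼ z →
        ∃ λ j → Adj C (residue (2 + s)) j × φ j ≡ z
      neighbours s s≤ z adj with P.only s (m≤n⇒m≤1+n s≤) adj
      ... | inj₁ refl = residue s ,
        inj₂ (inj₂ (inj₂ (trans (shifted s 2) (cong (toℕ ∘ residue) (+-comm s 2))))) ,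
        φ-residue s (≤-trans s≤ (m≤n+m (4 + r) 4))
      ... | inj₂ (inj₁ refl) = residue (1 + s) ,
        inj₂ (inj₂ (inj₁ (trans (shifted (1 + s) 1) (cong (toℕ ∘ residue) (+-comm (1 + s) 1))))) ,
        φ-residue (1 + s) (s≤s (≤-trans s≤ (m≤n+m (4 + r) 3)))
      ... | inj₂ (inj₂ (inj₁ refl)) = residue (3 + s) ,
        inj₁ (trans (shifted (2 + s) 1) (cong (toℕ ∘ residue) (+-comm (2 + s) 1))) ,
        φ-residue (3 + s) (s≤s (s≤s (s≤s (≤-trans s≤ (m≤n+m (4 + r) 1)))))
      ... | inj₂ (inj₂ (inj₂ refl)) = residue (4 + s) ,
        inj₂ (inj₁ (trans (shifted (2 + s) 2) (cong (toℕ ∘ residue) (+-comm (2 + s) 2)))) ,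
        φ-residue (4 + s) (s≤s (s≤s (s≤s (s≤s s≤))))

      -- The residues 0 and 1 have no two predecessors in the walk, so they are represented by the
      -- centres at `n` and `n + 1`.
      lift : ∀ i → ∃ λ s → s ≤ 4 + r × residue (2 + s) ≡ i
      lift i with toℕ i in eq
      ... | 0 = 3 + r , m≤n+m (3 + r) 1 , toℕ-injective (trans (toℕ-residue n) (trans ([m+n]%n≡m%n 0 n) (sym eq)))
      ... | 1 = 4 + r , ≤-refl , toℕ-injective (trans (toℕ-residue (1 + n)) (trans ([m+n]%n≡m%n 1 n) (sym eq)))
      ... | suc (suc s) = s , ≤-trans (m≤n+m s 2) (≤-pred i<n) ,
          toℕ-injective (trans (toℕ-residue (2 + s)) (trans (m<n⇒m%n≡m i<n) (sym eq)))
        where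
        i<n : 2 + s < n
        i<n = subst (_< n) eq (toℕ<n i)

      φ-full : ∀ i z → φ i ∼ z → ∃ λ j → Adj C i j × φ j ≡ z
      φ-full i z adj with lift i
      ... | s , s≤ , refl = neighbours s s≤ z
        (subst (_∼ z) (φ-residue (2 + s) (s≤s (s≤s (≤-trans s≤ (m≤n+m (4 + r) 2))))) adj)

      square : SquareOfCycle G
      square = cycle-iso r φ φ-inj φ-hom φ-full

    closes : ∀ j → j ≤ bound → FirstRepeat w j → SquareOfCycle G
    closes j j≤ (inj , i , i<j , eq) with m≤n⇒∃[o]m+o≡n i<j
    ... | k , refl with gap i k (≤-trans (<⇒≤ i<j) j≤) (trans eq (cong w (+-comm (1 + i) k)))
    closes _ j≤ (inj , zero , i<j , eq) | _ , refl | r , refl = Cycle.square r j≤ inj eq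
    closes _ j≤ (inj , suc i , i<j , eq) | _ , refl | r , refl = ⊥-elim
      (starts-at-0 i r (≤-trans (m≤n+m _ 2) j′≤) (subst (InjectiveBelow w) j≡ inj) (trans eq (cong w j≡)))
      where
      j≡ : 2 + i + (4 + r) ≡ 6 + r + i
      j≡ = cong (2 +_) (+-comm i (4 + r))
      j′≤ : 6 + r + i ≤ bound
      j′≤ = subst (_≤ bound) j≡ j≤

  link-P4 : ∀ {v a b c d} → Path v a b c d → Outcome v
  -- The number of vertices bounds the index of the first repetition, so path conditions up to this
  -- bound are all that closing the walk requires.
  link-P4 p = [ (λ o → o) , (λ (w , _ , at) → inj₁ (let j , j≤ , r = repeat w in
    Closing.closes w (proj₁ fin) at j j≤ r)) ]′ (run (proj₁ fin) p)

  -- Determining the shape of a link.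

  Rel : Bool → V G → V G → Set
  Rel true x y = x ∼ y
  Rel false x y = x ≁ y

  Rel-sym : ∀ b {x y} → Rel b x y → Rel b y x
  Rel-sym true = ∼-sym
  Rel-sym false = ≁-sym

  Rel-dec : ∀ {x y} (d : Dec (x ∼ y)) → Rel (isYes d) x y
  Rel-dec (yes xy) = xy
  Rel-dec (no x≁y) = x≁y

  Linked : Vec Bool 6 → V G → V G → V G → V G → Set
  Linked (p ∷ q ∷ r ∷ s ∷ t ∷ u ∷ []) a b c d =
    Rel p a b × Rel q a c × Rel r a d × Rel s b c × Rel t b d × Rel u c d

  opaque
    link-shape : ∀ {v} → low v → ∃ λ s → ∃ λ a → ∃ λ b → ∃ λ c → ∃ λ d → N4 v a b c d × Linked (shape s) a b c d
    link-shape {v} lo = let s , i , j , k , l , dis , eq = normal-form es connected in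
      s , f i , f j , f k , f l , relabelled dis , subst (λ e → Linked e (f i) (f j) (f k) (f l)) eq (linked dis)
      where
      f : Fin 4 → V G
      f = pick (deg≥4 v)
      f-≢ : ∀ {i j} → i ≢ j → f i ≢ f j
      f-≢ i≢j eq = i≢j (pick-inj (deg≥4 v) _ _ eq)
      edge : Fin 4 → Fin 4 → Bool
      edge i j = isYes (adj? (f i) (f j))
      es : Vec Bool 6
      es = edge 0F 1F ∷ edge 0F 2F ∷ edge 0F 3F ∷ edge 1F 2F ∷ edge 1F 3F ∷ edge 2F 3F ∷ []

      relabelled : ∀ {i j k l} → AllDistinct i j k l → N4 v (f i) (f j) (f k) (f l)
      relabelled (p , q , r , s , t , u) = n4 lo (adj _) (adj _) (adj _) (adj _)
        (f-≢ p , f-≢ q , f-≢ r , f-≢ s , f-≢ t , f-≢ u)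
        where
        adj : ∀ i → v ∼ f i
        adj = pick-holds (deg≥4 v)

      rel : ∀ i j → i ≢ j → Rel (entry es i j) (f i) (f j)
      rel 0F 1F _ = Rel-dec (adj? _ _)
      rel 0F 2F _ = Rel-dec (adj? _ _)
      rel 0F 3F _ = Rel-dec (adj? _ _)
      rel 1F 2F _ = Rel-dec (adj? _ _)
      rel 1F 3F _ = Rel-dec (adj? _ _)
      rel 2F 3F _ = Rel-dec (adj? _ _)
      rel 1F 0F _ = Rel-sym (edge 0F 1F) (Rel-dec (adj? _ _))
      rel 2F 0F _ = Rel-sym (edge 0F 2F) (Rel-dec (adj? _ _))
      rel 3F 0F _ = Rel-sym (edge 0F 3F) (Rel-dec (adj? _ _))
      rel 2F 1F _ = Rel-sym (edge 1F 2F) (Rel-dec (adj? _ _))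
      rel 3F 1F _ = Rel-sym (edge 1F 3F) (Rel-dec (adj? _ _))
      rel 3F 2F _ = Rel-sym (edge 2F 3F) (Rel-dec (adj? _ _))
      rel 0F 0F i≢i = ⊥-elim (i≢i refl)
      rel 1F 1F i≢i = ⊥-elim (i≢i refl)
      rel 2F 2F i≢i = ⊥-elim (i≢i refl)
      rel 3F 3F i≢i = ⊥-elim (i≢i refl)

      linked : ∀ {i j k l} → AllDistinct i j k l → Linked (relabel es i j k l) (f i) (f j) (f k) (f l)
      linked (p , q , r , s , t , u) = rel _ _ p , rel _ _ q , rel _ _ r , rel _ _ s , rel _ _ t , rel _ _ u

      touched : ∀ {x y z u} → N4 v x y z u → x ∼ u ⊎ y ∼ u ⊎ z ∼ u
      touched n with crit4 n
      ... | inj₁ (_ , xu) = inj₁ xu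
      ... | inj₂ (inj₁ (_ , yu)) = inj₂ (inj₁ yu)
      ... | inj₂ (inj₂ (inj₁ (_ , zu))) = inj₂ (inj₂ zu)
      ... | inj₂ (inj₂ (inj₂ (xu , _))) = inj₁ xu

      seen : ∀ i j → f i ∼ f j → T (edge i j)
      seen i j = fromWitness

      seen′ : ∀ i j → f j ∼ f i → T (edge i j)
      seen′ i j = fromWitness ∘ ∼-sym

      connected : T (noIsolated es)
      connected = all-true
        (some-true (map⊎ (seen′ 0F 1F) (map⊎ (seen′ 0F 2F) (seen′ 0F 3F)) (touched (rotate n₀))))
        (some-true (map⊎ (seen 0F 1F) (map⊎ (seen′ 1F 2F) (seen′ 1F 3F)) (touched (swap₃₄ (swap₂₃ n₀)))))
        (some-true (map⊎ (seen 0F 2F) (map⊎ (seen 1F 2F) (seen′ 2F 3F)) (touched (swap₃₄ n₀))))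
        (some-true (map⊎ (seen 0F 3F) (map⊎ (seen 1F 3F) (seen 2F 3F)) (touched n₀)))
        where
        n₀ : N4 v (f 0F) (f 1F) (f 2F) (f 3F)
        n₀ = relabelled ((λ ()) , (λ ()) , (λ ()) , (λ ()) , (λ ()) , λ ())

  -- Links consisting of two disjoint edges, and triangular bricks.

  record SplitAt (x y w : V G) : Set where
    constructor mkSplit
    field
      {p q} : V G
      nbrs  : N4 x y w p q
      yw    : y ∼ w
      pq    : p ∼ q
      y≁p   : y ≁ p
      y≁q   : y ≁ q
      w≁p   : w ≁ p
      w≁q   : w ≁ q
    open N4 nbrs public

    -- (E2) for the edge `x w`, whose ends have only `y` in common.
    y-low : low y
    y-low = proj₁ (crit-1 (swap₃₄ (swap₂₃ nbrs)) (≁-sym w≁p) (≁-sym w≁q))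

    w-low : low w
    w-low = proj₁ (crit-1 (rotate nbrs) (≁-sym y≁p) (≁-sym y≁q))

    unique-common : ∀ {z} → x ∼ z → y ∼ z → z ≡ w
    unique-common xz yz with only xz
    ... | inj₁ refl = ⊥-elim (G-irr _ yz)
    ... | inj₂ (inj₁ eq) = eq
    ... | inj₂ (inj₂ (inj₁ refl)) = ⊥-elim (y≁p yz)
    ... | inj₂ (inj₂ (inj₂ refl)) = ⊥-elim (y≁q yz)

  split-swap : ∀ {x y w} → SplitAt x y w → SplitAt x w y
  split-swap (mkSplit n yw pq y≁p y≁q w≁p w≁q) = mkSplit (swap₁₂ n) (∼-sym yw) pq w≁p w≁q y≁p y≁q

  Split : V G → Set
  Split x = ∃ λ y → ∃ λ w → SplitAt x y w

  split-at : ∀ {x} → Split x → ∀ {y} → x ∼ y → ∃ λ w → SplitAt x y w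
  split-at (_ , _ , s@(mkSplit n yw pq y≁p y≁q w≁p w≁q)) xz with N4.only n xz
  ... | inj₁ refl = _ , s
  ... | inj₂ (inj₁ refl) = _ , split-swap s
  ... | inj₂ (inj₂ (inj₁ refl)) = _ ,
    mkSplit (rotate (rotate n)) pq yw (≁-sym y≁p) (≁-sym w≁p) (≁-sym y≁q) (≁-sym w≁q)
  ... | inj₂ (inj₂ (inj₂ refl)) = _ ,
    mkSplit (swap₁₂ (rotate (rotate n))) (∼-sym pq) yw (≁-sym y≁q) (≁-sym w≁q) (≁-sym y≁p) (≁-sym w≁p)

  inner-or-split : ∀ {v} → low v → Outcome v ⊎ Split v
  inner-or-split {v} lo = let s , a , b , c , d , n , l = link-shape lo in dispatch s n l
    where
    dispatch : ∀ s {a b c d} → N4 v a b c d → Linked (shape s) a b c d → Outcome v ⊎ Split v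
    dispatch 0F n (ab , ac , ad , bc , bd , cd) = inj₁ (link-K4 n ab ac ad bc bd cd)
    dispatch 1F n (ab , ac , ad , bc , bd , cd) = inj₁ (link-diamond n ab ac ad bc bd cd)
    dispatch 2F n (ab , ac , ad , bc , bd , cd) = inj₁ (link-paw n ab ac ad bc bd cd)
    dispatch 3F n (ab , ac , ad , bc , bd , cd) = inj₁ (link-star n ab ac ad bc bd cd)
    dispatch 4F n (ab , ac , ad , bc , bd , cd) = inj₁ (link-C4 n ab ac ad bc bd cd)
    dispatch 5F n (ab , ac , ad , bc , bd , cd) = inj₁ (link-P4 (path n ab bc cd ac ad bd))
    dispatch 6F n (ab , ac , ad , bc , bd , cd) = inj₂ (_ , _ , mkSplit n ab cd ac ad bc bd)

  -- With all three corners split, no edge of the triangle lies in a second triangle, so the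
  -- triangle is closed under triangles by itself. The other two neighbours of a corner are
  -- adjacent, as `k3-split` asks.
  module Triangle {x y w : V G} (sx : SplitAt x y w) (sy : SplitAt y x w) (sw : SplitAt w x y) where

    at : Fin 3 → V G
    at = Vec.lookup (x ∷ y ∷ w ∷ [])

    split : ∀ i j → i ≢ j → ∃ λ k → SplitAt (at i) (at j) (at k) × BAdj k3 i k
    split 0F 1F _ = 2F , sx , _
    split 0F 2F _ = 1F , split-swap sx , _
    split 1F 0F _ = 2F , sy , _
    split 1F 2F _ = 0F , split-swap sy , _
    split 2F 0F _ = 1F , sw , _
    split 2F 1F _ = 0F , split-swap sw , _
    split 0F 0F i≢i = ⊥-elim (i≢i refl)
    split 1F 1F i≢i = ⊥-elim (i≢i refl)
    split 2F 2F i≢i = ⊥-elim (i≢i refl)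

    hom : ∀ i j → BAdj k3 i j → at i ∼ at j
    hom i j ij = SplitAt.va (proj₁ (proj₂ (split i j λ { refl → BAdj-irr k3 i ij })))

    inj : ∀ i j → at i ≡ at j → i ≡ j
    inj i j eq with i Fin.≟ j
    ... | yes i≡j = i≡j
    ... | no i≢j = ⊥-elim (∼⇒≢ (hom i j (k3-adjacent i j i≢j)) eq)

    Has : V G → V G → Set
    Has = BrickEdge k3 at

    has? : ∀ u v → Dec (Has u v)
    has? = brickEdge? _≟_ k3 at

    tri-closed : ∀ {u v z} → Has u v → u ∼ z → v ∼ z → Has u z
    tri-closed (i , j , ij , refl , refl) uz vz with split i j (λ { refl → BAdj-irr k3 i ij })
    ... | k , s , ik = i , k , ik , refl , sym (SplitAt.unique-common s uz vz)

    other : ∀ i → ∃ λ (j : Fin 3) → i ≢ j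
    other 0F = 1F , λ ()
    other 1F = 0F , λ ()
    other 2F = 0F , λ ()

    outside : ∀ i → ∃ λ p → ∃ λ q → p ∼ q × at i ∼ p × at i ∼ q × ¬ Has (at i) p × ¬ Has (at i) q ×
      (∀ z → at i ∼ z → z ≡ p ⊎ z ≡ q ⊎ Has (at i) z)
    outside i = p , q , pq , vc , vd , outer y≁p w≁p , outer y≁q w≁q , full
      where
      j = proj₁ (other i)
      k = proj₁ (split i j (proj₂ (other i)))
      open SplitAt (proj₁ (proj₂ (split i j (proj₂ (other i)))))
      full : ∀ z → at i ∼ z → z ≡ p ⊎ z ≡ q ⊎ Has (at i) z
      full z iz with only iz
      ... | inj₁ refl = inj₂ (inj₂ (i , j , k3-adjacent i j (proj₂ (other i)) , refl , refl))
      ... | inj₂ (inj₁ refl) = inj₂ (inj₂ (i , k , proj₂ (proj₂ (split i j (proj₂ (other i)))) , refl , refl))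
      ... | inj₂ (inj₂ (inj₁ refl)) = inj₁ refl
      ... | inj₂ (inj₂ (inj₂ refl)) = inj₂ (inj₁ refl)
      outer : ∀ {z} → at j ≁ z → at k ≁ z → ¬ Has (at i) z
      outer j≁z k≁z (i′ , l , i′l , eq , refl) with l Fin.≟ j
      ... | no l≢j = j≁z (hom j l (k3-adjacent j l (l≢j ∘ sym)))
      ... | yes refl = k≁z (∼-sym yw)

    placed : Placed G
    placed = record
      { type = k3 ; at = at ; at-inj = inj ; at-hom = hom
      ; inner-full = λ i inner → ⊥-elim (inner (k3-attach i))
      ; attach-exit = λ i a → escape _≟_ (has? (at i)) (deg≥4 (at i)) (brick-at-most {t = k3} inj i refl)
          (bdeg-attach-<4 k3 (λ ()) i a)
      ; tri-closed = tri-closed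
      ; k3-split = λ _ → outside }

  -- Covering every edge by a placed brick.

  Covered : V G → V G → Set
  Covered x y = SquareOfCycle G ⊎ Σ (Placed G) λ P → Placed.Has P x y

  outcome⇒covered : ∀ {x y} → Outcome x → x ∼ y → Covered x y
  outcome⇒covered (inj₁ sq) _ = inj₁ sq
  outcome⇒covered (inj₂ (P , cov)) xy = inj₂ (P , cov _ xy)

  covered-sym : ∀ {x y} → Covered x y → Covered y x
  covered-sym (inj₁ sq) = inj₁ sq
  covered-sym (inj₂ (P , has)) = inj₂ (P , Placed.Has-sym P has)

  covered-tri : ∀ {x y z} → Covered x y → x ∼ z → y ∼ z → Covered x z
  covered-tri (inj₁ sq) _ _ = inj₁ sq
  covered-tri (inj₂ (P , has)) xz yz = inj₂ (P , Placed.tri-closed P has xz yz)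

  -- If `y` or `w` has another link shape, its outcome covers an edge of the triangle at `x`, and
  -- closure under triangles carries this to `x y`. Otherwise all three corners are split, and
  -- uniqueness of the common neighbour matches their splittings.
  cover-split : ∀ {x y w} → SplitAt x y w → Covered x y
  cover-split {x} {y} {w} sx = by-y (inner-or-split y-low) (inner-or-split w-low)
    where
    open SplitAt sx
    partner : ∀ {u v t} → u ∼ v → u ∼ t → v ∼ t → Split u → SplitAt u v t
    partner uv ut vt sp = let _ , s = split-at sp uv in
      subst (SplitAt _ _) (sym (SplitAt.unique-common s ut vt)) s
    by-y : Outcome y ⊎ Split y → Outcome w ⊎ Split w → Covered x y
    by-y (inj₁ o) _ = covered-sym (outcome⇒covered o (∼-sym va))
    by-y (inj₂ _) (inj₁ o) = covered-tri (covered-sym (outcome⇒covered o (∼-sym vb))) va (∼-sym yw)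
    by-y (inj₂ sp-y) (inj₂ sp-w) = inj₂
      (Triangle.placed sx (partner (∼-sym va) yw vb sp-y) (partner (∼-sym vb) (∼-sym yw) va sp-w) ,
       0F , 1F , _ , refl , refl)

  cover-low : ∀ {x y} → low x → x ∼ y → Covered x y
  cover-low lo xy = [ (λ o → outcome⇒covered o xy) , (λ sp → cover-split (proj₂ (split-at sp xy))) ]′
    (inner-or-split lo)

  cover : ∀ {x y} → x ∼ y → Covered x y
  cover xy = [ (λ lo → cover-low lo xy) , (λ lo → covered-sym (cover-low lo (∼-sym xy))) ]′ (edge-end xy)


  all-covered : SquareOfCycle G ⊎ (∀ x y → x ∼ y → Σ (Placed G) λ P → Placed.Has P x y)
  all-covered = distribute fin λ x → distribute fin (pair x)
    where
    pair : ∀ x y → SquareOfCycle G ⊎ (x ∼ y → Σ (Placed G) λ P → Placed.Has P x y)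
    pair x y with adj? x y
    ... | no x≁y = inj₂ (⊥-elim ∘ x≁y)
    ... | yes xy = [ inj₁ , (λ r → inj₂ λ _ → r) ]′ (cover xy)

  classification : SquareOfCycle G ⊎ FromBricks G
  classification = [ inj₁ , (λ cov → inj₂ (Assembly.from-bricks G fin G-sym G-irr con adj? edge cov)) ]′ all-covered
    where
    edge : Edge G
    edge = let v = proj₁ con in v , pick (deg≥4 v) 0F , pick-holds (deg≥4 v) 0F

theorem5 : (G : Graph) → Finite (V G) → Symmetric G →
    MinimalCritical G ⇔ (SquareOfCycle G ⊎ FromBricks G)
theorem5 G fin G-sym = mk⇔ (Classification.classification G fin) λ where
  (inj₁ sq) → square-of-cycle⇒minimal-critical G sq
  (inj₂ (H , good , R , tb)) → Composition.minimal-critical G G-sym H good R tb
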